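{- Let $p\ge5$ be a prime, let $\mathcal{X}=(\Omega,S)$ be a Cayley scheme over $C_2\times C_2\times C_p$, let $E$ be a principal equivalence relation of $\mathcal{X}$, and let $\mathcal{Y}=\mathcal{X}_E$. Then: (1) if $n_E\le4$, then $\mathrm{Aut}(\mathcal{X})^{\Omega/E}=\mathrm{Aut}(\mathcal{X}_{\Omega/E})$; (2) if $n_E\ge p$, then either (a) $\mathcal{Y}$ is quasitrivial, or (b) for each fiber $\Delta$ of $\mathcal{Y}$, the homogeneous component $\mathcal{Y}_\Delta$ is isomorphic to a proper cyclotomic scheme over $C_p$.
   Context: A coherent configuration on a finite set $\Omega$ is a pair $\mathcal{X}=(\Omega,S)$, $S$ a partition of $\Omega\times\Omega$ such that $1_\Omega$ is a union of elements of $S$, $S$ is closed under transposition, and for $r,s,t\in S$ the number $|\alpha r\cap\beta s^*|$ is independent of $(\alpha,\beta)\in t$ ($\alpha r=\{\gamma:(\alpha,\gamma)\in r\}$). Fibers are the sets $\Delta$ with $1_\Delta\in S$ ($1_\Delta$ the diagonal of $\Delta$); for a fiber $\Delta$, the homogeneous component is $\mathcal{Y}_\Delta=(\Delta,\{s\cap(\Delta\times\Delta)\ne\varnothing\})$. $\mathrm{Aut}$ is the group of permutations fixing each basis relation; $\mathrm{Aut}(\mathcal{Y})^\Delta$ is the group induced on an invariant set $\Delta$ and $\mathrm{Aut}(\mathcal{X})^{\Omega/E}$ the group induced on the set $\Omega/E$ of classes of $E$. A coherent configuration is quasitrivial if $\mathrm{Aut}(\mathcal{Y})^\Delta=\mathrm{Sym}(\Delta)$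 for every fiber $\Delta$. Isomorphism: bijection of point sets mapping basis relations onto basis relations. For binary relations $T$, the coherent closure of $S\cup T$ is the unique minimal coherent configuration on $\Omega$ having all elements of $S\cup T$ as unions of basis relations; $\mathcal{X}_E$ is the coherent closure of $S\cup\{1_\Delta:\Delta\in\Omega/E\}$. A Cayley scheme over a group $M$ is a coherent configuration $(M,S)$ invariant under all right multiplications; it is cyclotomic if there is $K\le\mathrm{Aut}(M)$ such that $S$ is the set of orbits on $M\times M$ of the group generated by right multiplications and $K$, proper if $K\ne\mathrm{Aut}(M)$. $\mathcal{E}=\mathcal{E}(\mathcal{X})$ is the set of equivalence relations that are unions of basis relations; for $E\in\mathcal{E}$, $n_E$ is the size of its classes, $r_{\Omega/E}=\{(\Lambda,\Delta):r\cap(\Lambda\times\Delta)\ne\varnothing\}$, and $\mathcal{X}_{\Omega/E}=(\Omega/E,\{s_{\Omega/E}:s\in S\})$. $r\cdot s=\{(\alpha,\gamma):\exists\beta,(\alpha,\beta)\in r,(\beta,\gamma)\in s\}$. Tensor product of $(\Omega_i,S_i)$: points $\Omega_1\times\Omega_2$, basis relations $\{((\alpha_1,\alpha_2),(\beta_1,\beta_2)):(\alpha_i,\beta_i)\in s_i\}$. $E\in\mathcal{E}$ has a complement w.r.t. tensor product if some $F\in\mathcal{E}$ has $E\cap F=1_\Omega$, $E\cdot F=\Omega\times\Omega$ and $\mathcal{X}\cong\mathcal{X}_{\Omega/E}\otimes\mathcal{X}_{\Omega/F}$; for $E\subseteq F$ in $\mathcal{E}$, $\mathcal{X}$ is the $F/E$-wreath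 product if every $r\in S$ with $r\cap F=\varnothing$ equals $\bigcup_{(\Delta,\Lambda)\in r_{\Omega/E}}\Delta\times\Lambda$, and $E$ has a complement w.r.t. generalized wreath product if this holds for some $F\in\mathcal{E}$. For $\mathcal{X}$ homogeneous of degree $4p$, $E\in\mathcal{E}$ is principal if either (E1) $n_E\ge p$ and $E$ is minimal with respect to inclusion among elements of $\mathcal{E}$ other than $1_\Omega$; or (E2) no element of $\mathcal{E}$ satisfies (E1), $n_E\le4$, and $E$ has a complement w.r.t. tensor product or generalized wreath product. -}

module Defs where

open import Data.Bool using (Bool; true; false; _∧_; _∨_; if_then_else_; T)
open import Data.Nat using (ℕ; zero; suc; _+_; _*_; _∸_; _≤_; _%_; _≡ᵇ_)
open import Data.Nat.DivMod using (m%n<n)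
open import Data.Fin using (Fin; toℕ; fromℕ<)
open import Data.Fin.Properties using () renaming (_≟_ to _≟F_)
open import Data.List using (List; []; _∷_; foldr; cartesianProduct; allFin)
open import Data.Bool.ListAction using (any)
open import Data.Maybe using (Maybe; just; nothing)
open import Data.Product using (Σ; ∃; _×_; _,_; proj₁; proj₂)
open import Data.Product.Properties using (≡-dec)
open import Data.Sum using (_⊎_)
open import Relation.Nullary using (¬_; ⌊_⌋)
open import Relation.Binary.Definitions using (DecidableEquality)
open import Relation.Binary.PropositionalEquality using (_≡_)
open import Function.Bundles using (_↔_; Inverse)

BRel : Set → Set
BRel Ω = Ω → Ω → Bool

-- A partition S of Ω × Ω is given by a "colouring" col : Ω → Ω → ℕ;
-- the basis relations are the (nonempty) colour classes, each of which
-- is indexed by any of its pairs (a , b).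
Coloring : Set → Set
Coloring Ω = Ω → Ω → ℕ

basis : {Ω : Set} → Coloring Ω → Ω → Ω → BRel Ω
basis col a b x y = col x y ≡ᵇ col a b

IsUnion : {Ω : Set} → Coloring Ω → BRel Ω → Set
IsUnion col R = ∀ x y x' y' → col x y ≡ col x' y' → R x y ≡ R x' y'

AutFam : {A I : Set} → (I → BRel A) → (A ↔ A) → Set
AutFam rel g = ∀ i x y → rel i (Inverse.to g x) (Inverse.to g y) ≡ rel i x y

Iso : {A B I J : Set} → (I → BRel A) → (J → BRel B) → Set
Iso {A} {B} {I} {J} rA rB =
  Σ (A ↔ B) λ f →
    (∀ i → ∃ λ j → ∀ x y → rA i x y ≡ rB j (Inverse.to f x) (Inverse.to f y))
  × (∀ j → ∃ λ i → ∀ x y → rA i x y ≡ rB j (Inverse.to f x) (Inverse.to f y))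

-- Coherent configurations on a finite set Ω, enumerated (each element
-- exactly once) by the list els.

module Scheme {Ω : Set} (_≟_ : DecidableEquality Ω) (els : List Ω) where

  count : (Ω → Bool) → ℕ
  count P = foldr (λ x n → if P x then suc n else n) 0 els

  anyΩ : (Ω → Bool) → Bool
  anyΩ P = any P els

  diagR : BRel Ω
  diagR x y = ⌊ x ≟ y ⌋

  record IsCC (col : Coloring Ω) : Set where
    field
      diagUnion : IsUnion col diagR
      transp : ∀ a b → Σ (Ω × Ω) λ cd →
                 ∀ x y → basis col a b y x ≡ basis col (proj₁ cd) (proj₂ cd) x y
      coh : ∀ a b c d e f α β α' β' →
              T (basis col e f α β) → T (basis col e f α' β') →
              count (λ γ → basis col a b α γ ∧ basis col c d γ β)
                ≡ count (λ γ → basis col a b α' γ ∧ basis col c d γ β')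

  Aut : Coloring Ω → (Ω ↔ Ω) → Set
  Aut col g = AutFam (λ (ab : Ω × Ω) → basis col (proj₁ ab) (proj₂ ab)) g

  record IsEquiv (R : BRel Ω) : Set where
    field
      refl' : ∀ x → T (R x x)
      sym' : ∀ x y → T (R x y) → T (R y x)
      trans' : ∀ x y z → T (R x y) → T (R y z) → T (R x z)

  InE : Coloring Ω → BRel Ω → Set
  InE col R = IsUnion col R × IsEquiv R

  Sub : BRel Ω → BRel Ω → Set
  Sub R Q = ∀ x y → T (R x y) → T (Q x y)

  SameRel : BRel Ω → BRel Ω → Set
  SameRel R Q = ∀ x y → R x y ≡ Q x y

  -- Quotient Ω/E: represented by the canonical representatives, i.e. the
  -- first element (in els) of each class.
  firstSat : (Ω → Bool) → List Ω → Maybe Ω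
  firstSat P [] = nothing
  firstSat P (y ∷ ys) = if P y then just y else firstSat P ys

  isRep : BRel Ω → Ω → Bool
  isRep R x with firstSat (R x) els
  ... | just y = ⌊ y ≟ x ⌋
  ... | nothing = false

  Quot : BRel Ω → Set
  Quot R = Σ Ω λ x → T (isRep R x)

  qrel : Coloring Ω → (R : BRel Ω) → Ω × Ω → BRel (Quot R)
  qrel col R ab Λ Δ =
    anyΩ λ x → anyΩ λ y →
      R x (proj₁ Λ) ∧ R y (proj₁ Δ) ∧ basis col (proj₁ ab) (proj₂ ab) x y

  Induces : (R : BRel Ω) → (Ω ↔ Ω) → (Quot R ↔ Quot R) → Set
  Induces R g φ = ∀ (Λ : Quot R) x → T (R x (proj₁ Λ)) →
                    T (R (Inverse.to g x) (proj₁ (Inverse.to φ Λ)))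

  QuotAutEq : Coloring Ω → BRel Ω → Set
  QuotAutEq col R =
    (∀ g → Aut col g → ∃ λ φ → AutFam (qrel col R) φ × Induces R g φ)
    × (∀ φ → AutFam (qrel col R) φ → ∃ λ g → Aut col g × Induces R g φ)

  TensorCompl : Coloring Ω → BRel Ω → Set
  TensorCompl col E = Σ (BRel Ω) λ F →
      InE col F
    × SameRel (λ x y → E x y ∧ F x y) diagR
    × (∀ x z → ∃ λ y → T (E x y) × T (F y z))
    × Iso (λ (ab : Ω × Ω) → basis col (proj₁ ab) (proj₂ ab))
          (λ (ij : (Ω × Ω) × (Ω × Ω)) (u v : Quot E × Quot F) →
             qrel col E (proj₁ ij) (proj₁ u) (proj₁ v)
             ∧ qrel col F (proj₂ ij) (proj₂ u) (proj₂ v))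

  IsWreath : Coloring Ω → BRel Ω → BRel Ω → Set
  IsWreath col E F = ∀ a b →
    (∀ x y → T (basis col a b x y) → ¬ T (F x y)) →
    ∀ x y → basis col a b x y
            ≡ anyΩ (λ x' → anyΩ (λ y' → E x x' ∧ E y y' ∧ basis col a b x' y'))

  WreathCompl : Coloring Ω → BRel Ω → Set
  WreathCompl col E = Σ (BRel Ω) λ F → InE col F × Sub E F × IsWreath col E F

  NotDiag : BRel Ω → Set
  NotDiag R = ¬ SameRel R diagR

  E1 : ℕ → Coloring Ω → BRel Ω → Set
  E1 p col R =
      (∀ x → p ≤ count (R x))
    × NotDiag R
    × (∀ F → InE col F → NotDiag F → Sub F R → SameRel F R)

  Principal : ℕ → Coloring Ω → BRel Ω → Set
  Principal p col R =
    InE col R ×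
      (E1 p col R
       ⊎ ((∀ F → InE col F → ¬ E1 p col F)
          × (∀ x → count (R x) ≤ 4)
          × (TensorCompl col R ⊎ WreathCompl col R)))

  diagClass : BRel Ω → Ω → BRel Ω
  diagClass R z x y = diagR x y ∧ R z x

  ContainsE : Coloring Ω → BRel Ω → Coloring Ω → Set
  ContainsE col R col' =
    (∀ a b → IsUnion col' (basis col a b)) × (∀ z → IsUnion col' (diagClass R z))

  IsClosureE : Coloring Ω → BRel Ω → Coloring Ω → Set
  IsClosureE col R col' =
    IsCC col' × ContainsE col R col'
    × (∀ col'' → IsCC col'' → ContainsE col R col'' →
         ∀ a b → IsUnion col'' (basis col' a b))

  Fib : Coloring Ω → Ω → Set
  Fib col a = Σ Ω λ x → T (basis col a a x x)

  homComp : (col : Coloring Ω) (a : Ω) → Fib col a × Fib col a → BRel (Fib col a)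
  homComp col a uv x y =
    basis col (proj₁ (proj₁ uv)) (proj₁ (proj₂ uv)) (proj₁ x) (proj₁ y)

  Quasitrivial : Coloring Ω → Set
  Quasitrivial col = ∀ a (π : Fib col a ↔ Fib col a) →
    ∃ λ g → Aut col g × (∀ (u : Fib col a) → Inverse.to g (proj₁ u) ≡ proj₁ (Inverse.to π u))

addMod : ∀ {n} → Fin n → Fin n → Fin n
addMod {zero} () j
addMod {suc n} i j = fromℕ< (m%n<n (toℕ i + toℕ j) (suc n))

M : ℕ → Set
M p = Fin 2 × Fin 2 × Fin p

_·M_ : ∀ {p} → M p → M p → M p
(a , b , c) ·M (a' , b' , c') = addMod a a' , addMod b b' , addMod c c'

_≟M_ : ∀ {p} → DecidableEquality (M p)
_≟M_ = ≡-dec _≟F_ (≡-dec _≟F_ _≟F_)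

elsM : (p : ℕ) → List (M p)
elsM p = cartesianProduct (allFin 2) (cartesianProduct (allFin 2) (allFin p))

module SM (p : ℕ) = Scheme {M p} _≟M_ (elsM p)

IsCayleyM : (p : ℕ) → Coloring (M p) → Set
IsCayleyM p col = SM.IsCC p col
  × (∀ g a b x y → basis col a b (x ·M g) (y ·M g) ≡ basis col a b x y)

-- m mod n (with the convention m mod 0 = m; only used for n = p prime)
modN : ℕ → ℕ → ℕ
modN zero m = m
modN (suc n) m = m % suc n

anyFin : (n : ℕ) → (Fin n → Bool) → Bool
anyFin n P = any P (allFin n)

-- K ≤ Aut(C_p): a set of nonzero multipliers containing 1, closed under
-- multiplication mod p (hence a subgroup of the finite group of units).
record IsAutSubgroup (p : ℕ) (K : Fin p → Bool) : Set where
  field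
    hasOne : ∃ λ k → T (K k) × toℕ k ≡ 1
    nonzero : ∀ k → T (K k) → ¬ toℕ k ≡ 0
    closed : ∀ k l → T (K k) → T (K l) → ∃ λ m → T (K m) × toℕ m ≡ modN p (toℕ k * toℕ l)

ProperK : (p : ℕ) → (Fin p → Bool) → Set
ProperK p K = ∃ λ k → ¬ toℕ k ≡ 0 × ¬ T (K k)

diffMod : (p : ℕ) → Fin p → Fin p → ℕ
diffMod p x y = modN p (toℕ y + (p ∸ toℕ x))

-- basis relation of Cyc(K, C_p) containing (a , b):
-- the orbit of (a,b) under x ↦ σ(x) + t, σ ∈ K, t ∈ C_p.
cycRel : (p : ℕ) → (Fin p → Bool) → Fin p × Fin p → BRel (Fin p)
cycRel p K ab x y =
  anyFin p λ k → K k ∧ (diffMod p x y ≡ᵇ modN p (toℕ k * diffMod p (proj₁ ab) (proj₂ ab)))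

{-# OPTIONS --safe #-}
-- Let V = C₂ × C₂ and P = C_p. A Cayley scheme over M = V × P is given by its S-ring, the partition of M into
-- the classes of c x = col 0 x, and E by the subgroup H of M that is its class of 0.
--
-- Since the q-th power of the indicator of a union of classes is, modulo a prime q, an indicator again, all
-- maps (v , z) ↦ (v , u z) with u ≠ 0 permute the classes (Schur). Reducing the convolution square of the
-- indicator of a class X modulo 2 and 4 shows that the layers {v : (v , w) ∈ X} with w ≠ 0 are even unless P is
-- a union of classes, and produces lines ⟨t⟩ of V for which ⟨t⟩ × P is a union of classes.
--
-- (1) If n_E ≤ 4, then H ≤ V and P is not a union of classes. The layers yield a complement of H in M such
-- that adding an element of H to the projection onto the complement respects the classes; automorphisms of
-- the quotient lift along this complement.
--
-- (2) If n_E ≥ p, then H contains P and is minimal. If H ≠ P, then H ∖ {0} is a single class, each coset of H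
-- is a single class up to at most one point, and the closure is invariant under Sym(H) acting on all cosets in
-- parallel. If H = P, then the closure is invariant under P and is permuted by translations and multipliers,
-- so that on each fiber it is a cyclotomic scheme; when this scheme has rank 2, Sym(P) again acts in parallel.

module Submission where

open import Defs
open import Data.Nat as ℕ using (ℕ; zero; suc; _∸_; _≤_; _<_; z≤n; s≤s; _!; NonZero; _<ᵇ_; ⌊_/2⌋)
open import Data.Nat.DivMod using (m%n<n; %-distribˡ-+; %-distribˡ-*; m<n⇒m%n≡m; n%n≡0; m/n*n≡m; m*n%n≡0; _%_; _/_; m≡m%n+[m/n]*n; [m+kn]%n≡m%n)
open import Data.Fin using (Fin; toℕ; fromℕ<; zero; suc; fromℕ; inject₁; combine)
open import Data.Fin.Properties using (toℕ-fromℕ<; toℕ-injective; toℕ<n; toℕ≤n; toℕ-fromℕ; toℕ-inject₁; combine-injective) renaming (_≟_ to _≟F_)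
open import Data.Product using (∃; _×_; _,_; proj₁; proj₂)
open import Relation.Binary.PropositionalEquality using (_≡_; _≢_; refl; sym; trans; cong; cong₂; subst; subst₂; isEquivalence; module ≡-Reasoning)
open import Algebra.Bundles using (AbelianGroup; CommutativeSemiring)
open import Data.Vec using ([]; _∷_; lookup)
open import Level using (0ℓ)
open import Data.Bool using (Bool; true; false; _∧_; _∨_; not; if_then_else_; T; _xor_)
open import Data.Bool.ListAction using (any)
open import Data.List using (List; []; _∷_; _++_; map; foldr; tabulate; allFin; cartesianProduct)
open import Data.Product.Properties using (≡-dec)
open import Data.Sum using (_⊎_; inj₁; inj₂)
open import Data.Empty using (⊥-elim; ⊥)
open import Function using (_∘_; id)
open import Relation.Nullary using (¬_; ⌊_⌋; yes; no; Dec)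
open import Relation.Binary.Definitions using (DecidableEquality; tri<; tri≈; tri>)
open import Data.Nat.Properties using (_!*_!≢0)
open import Data.Nat.Primality using (Prime; euclidsLemma; prime⇒nonZero; prime⇒nonTrivial; composite)
open import Data.Nat.Divisibility using (_∣_; _∤_; divides; m∣m*n; >⇒∤; m%n≡0⇒n∣m)
open import Data.Nat.Combinatorics using (_C_; nCn≡1; nCk≡n!/k![n-k]!; k![n∸k]!∣n!)
open import Algebra.Structures.Biased using (isCommutativeSemiringˡ; isCommutativeMonoidˡ)
open import Relation.Binary.Structures using (IsEquivalence)
open import Data.Nat.Primality.Factorisation using (factorise; PrimeFactorisation)
open import Data.Nat.Coprimality using (prime⇒coprime; coprime-Bézout)
open import Data.Nat.GCD using (module Bézout)
open import Data.Nat.ListAction using (product)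
open import Data.List.Relation.Unary.All using (All; []; _∷_)
open import Data.Bool.Properties using (T-irrelevant)
open import Data.Maybe using (Maybe; just; nothing)
open import Data.Maybe.Properties using (just-injective)
open import Function.Bundles using (_↔_; Inverse; mk↔ₛ′)
import Data.Nat.Properties as ℕ

-- The moduli 2 and 4 come from a reflection. At (v , z) the convolution square is a sum over w of
-- correlations between the layers at w and at z - w. As p is odd, w ↦ z - w fixes only z / 2 and
-- pairs off equal terms, so modulo 2 a single layer decides the value; when all layers are
-- invariant under one t ≠ 0, every term is even and a single layer decides the value modulo 4. What
-- is left are questions about subsets of V, settled by evaluating a Boolean formula on all sixteen
-- of them. Multiplication by a prime q fixes V pointwise only if q is odd, so a unit modulo p is
-- first represented by an odd number and then factored. Two devices turn information on layers into
-- subgroups. The translations that stabilize a union of classes form a union of classes themselves,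
-- so under minimality of H one nonzero stabilizing translation from H brings all of H with it. And
-- a class that meets V is preserved by all multipliers, since these fix V pointwise; hence all its
-- layers off V coincide.

module Residue (n : ℕ) where
  p : ℕ
  p = suc n

  ⟦_⟧ : ℕ → Fin p
  ⟦ m ⟧ = fromℕ< (m%n<n m p)

  infixl 6 _+ₚ_
  infixl 7 _*ₚ_
  _+ₚ_ : Fin p → Fin p → Fin p
  i +ₚ j = addMod i j
  abstract
    -- Abstract, so that type checking meets atoms instead of remainder computations. Addition stays
    -- transparent because the group law of `M p` is built from `addMod`.
    _*ₚ_ : Fin p → Fin p → Fin p
    i *ₚ j = ⟦ toℕ i ℕ.* toℕ j ⟧
    -ₚ_ : Fin p → Fin p
    -ₚ i = ⟦ p ∸ toℕ i ⟧

    *ₚ-def : ∀ i j → i *ₚ j ≡ ⟦ toℕ i ℕ.* toℕ j ⟧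
    *ₚ-def i j = refl
    -ₚ-def : ∀ i → -ₚ i ≡ ⟦ p ∸ toℕ i ⟧
    -ₚ-def i = refl

  toℕ-⟦⟧ : ∀ m → toℕ ⟦ m ⟧ ≡ m % p
  toℕ-⟦⟧ m = toℕ-fromℕ< (m%n<n m p)

  ⟦⟧-cong : ∀ {a b} → a % p ≡ b % p → ⟦ a ⟧ ≡ ⟦ b ⟧
  ⟦⟧-cong {a} {b} e = toℕ-injective (trans (toℕ-⟦⟧ a) (trans e (sym (toℕ-⟦⟧ b))))

  ⟦toℕ⟧ : ∀ i → ⟦ toℕ i ⟧ ≡ i
  ⟦toℕ⟧ i = toℕ-injective (trans (toℕ-⟦⟧ (toℕ i)) (m<n⇒m%n≡m (toℕ<n i)))

  ⟦⟧-+ : ∀ a b → ⟦ a ⟧ +ₚ ⟦ b ⟧ ≡ ⟦ a ℕ.+ b ⟧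
  ⟦⟧-+ a b = ⟦⟧-cong {toℕ ⟦ a ⟧ ℕ.+ toℕ ⟦ b ⟧} {a ℕ.+ b} (trans (cong₂ (λ x y → (x ℕ.+ y) % p) (toℕ-⟦⟧ a) (toℕ-⟦⟧ b))
                            (sym (%-distribˡ-+ a b p)))

  ⟦⟧-* : ∀ a b → ⟦ a ⟧ *ₚ ⟦ b ⟧ ≡ ⟦ a ℕ.* b ⟧
  ⟦⟧-* a b = trans (*ₚ-def ⟦ a ⟧ ⟦ b ⟧) (⟦⟧-cong {toℕ ⟦ a ⟧ ℕ.* toℕ ⟦ b ⟧} {a ℕ.* b} (trans (cong₂ (λ x y → (x ℕ.* y) % p) (toℕ-⟦⟧ a) (toℕ-⟦⟧ b))
                            (sym (%-distribˡ-* a b p))))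

  private
    -- Every residue is some `⟦ m ⟧`, so an identity need only be checked on these, where `⟦⟧-+` and
    -- `⟦⟧-*` turn it into an identity of natural numbers.
    via₂ : (f g : Fin p → Fin p → Fin p) → (∀ a b → f ⟦ a ⟧ ⟦ b ⟧ ≡ g ⟦ a ⟧ ⟦ b ⟧) → ∀ i j → f i j ≡ g i j
    via₂ f g h i j = subst₂ (λ x y → f x y ≡ g x y) (⟦toℕ⟧ i) (⟦toℕ⟧ j) (h (toℕ i) (toℕ j))

    via₃ : (f g : Fin p → Fin p → Fin p → Fin p) →
           (∀ a b c → f ⟦ a ⟧ ⟦ b ⟧ ⟦ c ⟧ ≡ g ⟦ a ⟧ ⟦ b ⟧ ⟦ c ⟧) → ∀ i j k → f i j k ≡ g i j k
    via₃ f g h i j k = subst (λ z → f i j z ≡ g i j z) (⟦toℕ⟧ k)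
      (via₂ (λ x y → f x y ⟦ toℕ k ⟧) (λ x y → g x y ⟦ toℕ k ⟧) (λ a b → h a b (toℕ k)) i j)

  +ₚ-comm : ∀ i j → i +ₚ j ≡ j +ₚ i
  +ₚ-comm i j = cong ⟦_⟧ (ℕ.+-comm (toℕ i) (toℕ j))

  *ₚ-comm : ∀ i j → i *ₚ j ≡ j *ₚ i
  *ₚ-comm i j = trans (*ₚ-def i j) (trans (cong ⟦_⟧ (ℕ.*-comm (toℕ i) (toℕ j))) (sym (*ₚ-def j i)))

  +ₚ-assoc : ∀ i j k → (i +ₚ j) +ₚ k ≡ i +ₚ (j +ₚ k)
  +ₚ-assoc = via₃ _ _ λ a b c → begin
    (⟦ a ⟧ +ₚ ⟦ b ⟧) +ₚ ⟦ c ⟧ ≡⟨ cong (_+ₚ ⟦ c ⟧) (⟦⟧-+ a b) ⟩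
    ⟦ a ℕ.+ b ⟧ +ₚ ⟦ c ⟧      ≡⟨ ⟦⟧-+ (a ℕ.+ b) c ⟩
    ⟦ a ℕ.+ b ℕ.+ c ⟧         ≡⟨ cong ⟦_⟧ (ℕ.+-assoc a b c) ⟩
    ⟦ a ℕ.+ (b ℕ.+ c) ⟧       ≡⟨ ⟦⟧-+ a (b ℕ.+ c) ⟨
    ⟦ a ⟧ +ₚ ⟦ b ℕ.+ c ⟧      ≡⟨ cong (⟦ a ⟧ +ₚ_) (⟦⟧-+ b c) ⟨
    ⟦ a ⟧ +ₚ (⟦ b ⟧ +ₚ ⟦ c ⟧) ∎
    where open ≡-Reasoning

  *ₚ-assoc : ∀ i j k → (i *ₚ j) *ₚ k ≡ i *ₚ (j *ₚ k)
  *ₚ-assoc = via₃ _ _ λ a b c → begin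
    (⟦ a ⟧ *ₚ ⟦ b ⟧) *ₚ ⟦ c ⟧ ≡⟨ cong (_*ₚ ⟦ c ⟧) (⟦⟧-* a b) ⟩
    ⟦ a ℕ.* b ⟧ *ₚ ⟦ c ⟧      ≡⟨ ⟦⟧-* (a ℕ.* b) c ⟩
    ⟦ a ℕ.* b ℕ.* c ⟧         ≡⟨ cong ⟦_⟧ (ℕ.*-assoc a b c) ⟩
    ⟦ a ℕ.* (b ℕ.* c) ⟧       ≡⟨ ⟦⟧-* a (b ℕ.* c) ⟨
    ⟦ a ⟧ *ₚ ⟦ b ℕ.* c ⟧      ≡⟨ cong (⟦ a ⟧ *ₚ_) (⟦⟧-* b c) ⟨
    ⟦ a ⟧ *ₚ (⟦ b ⟧ *ₚ ⟦ c ⟧) ∎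
    where open ≡-Reasoning

  *ₚ-distribˡ : ∀ i j k → i *ₚ (j +ₚ k) ≡ i *ₚ j +ₚ i *ₚ k
  *ₚ-distribˡ = via₃ _ _ λ a b c → begin
    ⟦ a ⟧ *ₚ (⟦ b ⟧ +ₚ ⟦ c ⟧)             ≡⟨ cong (⟦ a ⟧ *ₚ_) (⟦⟧-+ b c) ⟩
    ⟦ a ⟧ *ₚ ⟦ b ℕ.+ c ⟧                  ≡⟨ ⟦⟧-* a (b ℕ.+ c) ⟩
    ⟦ a ℕ.* (b ℕ.+ c) ⟧                   ≡⟨ cong ⟦_⟧ (ℕ.*-distribˡ-+ a b c) ⟩
    ⟦ a ℕ.* b ℕ.+ a ℕ.* c ⟧               ≡⟨ ⟦⟧-+ (a ℕ.* b) (a ℕ.* c) ⟨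
    ⟦ a ℕ.* b ⟧ +ₚ ⟦ a ℕ.* c ⟧            ≡⟨ cong₂ _+ₚ_ (⟦⟧-* a b) (⟦⟧-* a c) ⟨
    ⟦ a ⟧ *ₚ ⟦ b ⟧ +ₚ ⟦ a ⟧ *ₚ ⟦ c ⟧      ∎
    where open ≡-Reasoning

  *ₚ-distribʳ : ∀ i j k → (j +ₚ k) *ₚ i ≡ j *ₚ i +ₚ k *ₚ i
  *ₚ-distribʳ i j k = trans (*ₚ-comm (j +ₚ k) i) (trans (*ₚ-distribˡ i j k) (cong₂ _+ₚ_ (*ₚ-comm i j) (*ₚ-comm i k)))

  +ₚ-identityˡ : ∀ i → ⟦ 0 ⟧ +ₚ i ≡ i
  +ₚ-identityˡ i = trans (cong (⟦ 0 ⟧ +ₚ_) (sym (⟦toℕ⟧ i))) (trans (⟦⟧-+ 0 (toℕ i)) (⟦toℕ⟧ i))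

  *ₚ-identityˡ : ∀ i → ⟦ 1 ⟧ *ₚ i ≡ i
  *ₚ-identityˡ i = trans (cong (⟦ 1 ⟧ *ₚ_) (sym (⟦toℕ⟧ i)))
    (trans (⟦⟧-* 1 (toℕ i)) (trans (cong ⟦_⟧ (ℕ.*-identityˡ (toℕ i))) (⟦toℕ⟧ i)))

  -ₚ-inverseʳ : ∀ i → i +ₚ (-ₚ i) ≡ ⟦ 0 ⟧
  -ₚ-inverseʳ i = begin
    i +ₚ (-ₚ i)                      ≡⟨ cong₂ _+ₚ_ (sym (⟦toℕ⟧ i)) (-ₚ-def i) ⟩
    ⟦ toℕ i ⟧ +ₚ ⟦ p ∸ toℕ i ⟧       ≡⟨ ⟦⟧-+ (toℕ i) (p ∸ toℕ i) ⟩
    ⟦ toℕ i ℕ.+ (p ∸ toℕ i) ⟧        ≡⟨ cong ⟦_⟧ (ℕ.m+[n∸m]≡n (toℕ≤n i)) ⟩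
    ⟦ p ⟧                            ≡⟨ ⟦⟧-cong {p} {0} (n%n≡0 p) ⟩
    ⟦ 0 ⟧                            ∎
    where open ≡-Reasoning

-- Abelian groups and the solution of equations in them

abelianGroup≡ : {A : Set} (_∙_ : A → A → A) (ε : A) (_⁻¹ : A → A) →
  (∀ x y z → (x ∙ y) ∙ z ≡ x ∙ (y ∙ z)) → (∀ x y → x ∙ y ≡ y ∙ x) →
  (∀ x → ε ∙ x ≡ x) → (∀ x → x ∙ (x ⁻¹) ≡ ε) → AbelianGroup _ _
abelianGroup≡ _∙_ ε _⁻¹ assoc comm idˡ invʳ = record
  { isAbelianGroup = record
    { isGroup = record
      { isMonoid = record
        { isSemigroup = record
          { isMagma = record { isEquivalence = isEquivalence ; ∙-cong = cong₂ _∙_ }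
          ; assoc = assoc }
        ; identity = idˡ , λ x → trans (comm x ε) (idˡ x) }
      ; inverse = (λ x → trans (comm (x ⁻¹) x) (invʳ x)) , invʳ
      ; ⁻¹-cong = cong _⁻¹ }
    ; comm = comm } }

-- A solver for equations in abelian groups: an expression e is split as pos e − neg e with pos e and
-- neg e free of inverses, so that e₁ = e₂ reduces to pos e₁ + neg e₂ = pos e₂ + neg e₁, which the
-- solver for commutative monoids decides.
module AbelianSolver (G : AbelianGroup 0ℓ 0ℓ) where
  open AbelianGroup G hiding (refl; sym; isEquivalence) renaming (trans to ≈-trans)
  open import Algebra.Solver.CommutativeMonoid commutativeMonoid as CM
    using (Expr; normalise; Env) renaming (_⊕_ to _∙ₑ_; id to εₑ)
  import Algebra.Solver.CommutativeMonoid.Normal commutativeMonoid as N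
  open import Algebra.Properties.CommutativeSemigroup commutativeSemigroup using (interchange)
  open import Algebra.Properties.Group group using (∙-cancelʳ)
  open import Relation.Binary.Reasoning.Setoid setoid

  infixl 6 _⊕_ _⊖_
  infix 8 ⊝_
  data Exp (n : ℕ) : Set where
    var : Fin n → Exp n
    𝟘 : Exp n
    _⊕_ : Exp n → Exp n → Exp n
    ⊝_ : Exp n → Exp n

  _⊖_ : ∀ {n} → Exp n → Exp n → Exp n
  e ⊖ f = e ⊕ ⊝ f

  eval : ∀ {n} → Exp n → Env n → Carrier
  eval (var i) ρ = lookup ρ i
  eval 𝟘 ρ = ε
  eval (e ⊕ f) ρ = eval e ρ ∙ eval f ρ
  eval (⊝ e) ρ = (eval e ρ) ⁻¹

  pos neg : ∀ {n} → Exp n → Expr n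
  pos (var i) = Expr.var i
  pos 𝟘 = εₑ
  pos (e ⊕ f) = pos e ∙ₑ pos f
  pos (⊝ e) = neg e
  neg (var i) = εₑ
  neg 𝟘 = εₑ
  neg (e ⊕ f) = neg e ∙ₑ neg f
  neg (⊝ e) = pos e

  private
    _⟨_⟩ : ∀ {n} → Expr n → Env n → Carrier
    _⟨_⟩ = N.⟦_⟧

    split : ∀ {n} (e : Exp n) ρ → eval e ρ ∙ neg e ⟨ ρ ⟩ ≈ pos e ⟨ ρ ⟩
    split (var i) ρ = identityʳ _
    split 𝟘 ρ = identityʳ _
    split (e ⊕ f) ρ = ≈-trans (interchange _ _ _ _) (∙-cong (split e ρ) (split f ρ))
    split (⊝ e) ρ = begin
      eval e ρ ⁻¹ ∙ pos e ⟨ ρ ⟩                  ≈⟨ ∙-congˡ (split e ρ) ⟨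
      eval e ρ ⁻¹ ∙ (eval e ρ ∙ neg e ⟨ ρ ⟩)     ≈⟨ assoc _ _ _ ⟨
      eval e ρ ⁻¹ ∙ eval e ρ ∙ neg e ⟨ ρ ⟩       ≈⟨ ∙-congʳ (inverseˡ _) ⟩
      ε ∙ neg e ⟨ ρ ⟩                            ≈⟨ identityˡ _ ⟩
      neg e ⟨ ρ ⟩                                ∎

  abel : ∀ {n} (e f : Exp n) → normalise (pos e ∙ₑ neg f) ≡ normalise (pos f ∙ₑ neg e) →
         (ρ : Env n) → eval e ρ ≈ eval f ρ
  abel e f eq ρ = ∙-cancelʳ (neg e ⟨ ρ ⟩ ∙ neg f ⟨ ρ ⟩) _ _ (begin
    eval e ρ ∙ (neg e ⟨ ρ ⟩ ∙ neg f ⟨ ρ ⟩)    ≈⟨ assoc _ _ _ ⟨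
    eval e ρ ∙ neg e ⟨ ρ ⟩ ∙ neg f ⟨ ρ ⟩      ≈⟨ ∙-congʳ (split e ρ) ⟩
    (pos e ∙ₑ neg f) ⟨ ρ ⟩                    ≈⟨ N.correct (pos e ∙ₑ neg f) ρ ⟨
    N.⟦ normalise (pos e ∙ₑ neg f) ⟧⇓ ρ       ≡⟨ cong (λ v → N.⟦ v ⟧⇓ ρ) eq ⟩
    N.⟦ normalise (pos f ∙ₑ neg e) ⟧⇓ ρ       ≈⟨ N.correct (pos f ∙ₑ neg e) ρ ⟩
    (pos f ∙ₑ neg e) ⟨ ρ ⟩                    ≈⟨ ∙-congʳ (split f ρ) ⟨
    eval f ρ ∙ neg f ⟨ ρ ⟩ ∙ neg e ⟨ ρ ⟩      ≈⟨ assoc _ _ _ ⟩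
    eval f ρ ∙ (neg f ⟨ ρ ⟩ ∙ neg e ⟨ ρ ⟩)    ≈⟨ ∙-congˡ (comm _ _) ⟩
    eval f ρ ∙ (neg e ⟨ ρ ⟩ ∙ neg f ⟨ ρ ⟩)    ∎)

  x₀ : ∀ {n} → Exp (1 ℕ.+ n)
  x₀ = var zero
  x₁ : ∀ {n} → Exp (2 ℕ.+ n)
  x₁ = var (suc zero)
  x₂ : ∀ {n} → Exp (3 ℕ.+ n)
  x₂ = var (suc (suc zero))
  x₃ : ∀ {n} → Exp (4 ℕ.+ n)
  x₃ = var (suc (suc (suc zero)))
  x₄ : ∀ {n} → Exp (5 ℕ.+ n)
  x₄ = var (suc (suc (suc (suc zero))))

-- The group M as a product of V and P

V : Set
V = Fin 2 × Fin 2

infixl 6 _+ᵥ_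
_+ᵥ_ : V → V → V
(a , b) +ᵥ (a' , b') = addMod a a' , addMod b b'

module Group (n : ℕ) where
  open Residue n public
  module R₂ = Residue 1

  infixl 6 _+_ _-_
  infix 8 -_

  0ₚ 1ₚ : Fin p
  0ₚ = ⟦ 0 ⟧
  1ₚ = ⟦ 1 ⟧

  el : V → Fin p → M p
  el (a , b) c = a , b , c

  vpart : M p → V
  vpart (a , b , c) = a , b
  ppart : M p → Fin p
  ppart (a , b , c) = c

  _+_ : M p → M p → M p
  _+_ = _·M_
  -- V has exponent 2, so inversion changes the last coordinate only.
  -_ : M p → M p
  - (a , b , c) = a , b , -ₚ c
  0ₘ : M p
  0ₘ = zero , zero , 0ₚ
  _-_ : M p → M p → M p
  x - y = x + - y

  self-inverse : ∀ (a : Fin 2) → addMod a a ≡ zero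
  self-inverse zero = refl
  self-inverse (suc zero) = refl

  groupM groupP : AbelianGroup 0ℓ 0ℓ
  groupM = abelianGroup≡ _+_ 0ₘ -_
    (λ (a , b , c) (a' , b' , c') (a'' , b'' , c'') →
      cong₂ _,_ (R₂.+ₚ-assoc a a' a'') (cong₂ _,_ (R₂.+ₚ-assoc b b' b'') (+ₚ-assoc c c' c'')))
    (λ (a , b , c) (a' , b' , c') →
      cong₂ _,_ (R₂.+ₚ-comm a a') (cong₂ _,_ (R₂.+ₚ-comm b b') (+ₚ-comm c c')))
    (λ (a , b , c) → cong₂ _,_ (R₂.+ₚ-identityˡ a) (cong₂ _,_ (R₂.+ₚ-identityˡ b) (+ₚ-identityˡ c)))
    (λ (a , b , c) → cong₂ _,_ (self-inverse a) (cong₂ _,_ (self-inverse b) (-ₚ-inverseʳ c)))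
  groupP = abelianGroup≡ _+ₚ_ 0ₚ -ₚ_ +ₚ-assoc +ₚ-comm +ₚ-identityˡ -ₚ-inverseʳ

  module SolveM = AbelianSolver groupM
  module SolveP = AbelianSolver groupP

  μ : Fin p → M p → M p
  μ u x = el (vpart x) (u *ₚ ppart x)

  μ-+ : ∀ u x y → μ u (x + y) ≡ μ u x + μ u y
  μ-+ u x y = cong (el _) (*ₚ-distribˡ u (ppart x) (ppart y))

-- Booleans, finite sums and enumerations

ι : Bool → ℕ
ι true = 1
ι false = 0

T⇒≡ : ∀ {b} → T b → b ≡ true
T⇒≡ {true} _ = refl

≡⇒T : ∀ {b} → b ≡ true → T b
≡⇒T refl = _

true≢false : ∀ {b} → b ≡ true → b ≡ false → ∀ {A : Set} → A
true≢false refl ()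

∧-true : ∀ {a b} → a ∧ b ≡ true → a ≡ true × b ≡ true
∧-true {true} {true} _ = refl , refl

true-∧ : ∀ {a b} → a ≡ true → b ≡ true → a ∧ b ≡ true
true-∧ refl refl = refl

decide : ∀ b → b ≡ true ⊎ b ≡ false
decide true = inj₁ refl
decide false = inj₂ refl

≢true : ∀ {b} → ¬ b ≡ true → b ≡ false
≢true {true} h = ⊥-elim (h refl)
≢true {false} h = refl

bool-ext : ∀ {a b} → (a ≡ true → b ≡ true) → (b ≡ true → a ≡ true) → a ≡ b
bool-ext {true} {b} f g = sym (f refl)
bool-ext {false} {true} f g = g refl
bool-ext {false} {false} f g = refl

ι-∧ : ∀ a b → ι (a ∧ b) ≡ ι a ℕ.* ι b
ι-∧ true b = sym (ℕ.+-identityʳ (ι b))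
ι-∧ false b = refl

≡ᵇ-true : ∀ {m n} → m ≡ n → (m ℕ.≡ᵇ n) ≡ true
≡ᵇ-true {m} {n} e = T⇒≡ (ℕ.≡⇒≡ᵇ m n e)

≡ᵇ-≡ : ∀ {m n} → (m ℕ.≡ᵇ n) ≡ true → m ≡ n
≡ᵇ-≡ {m} {n} e = ℕ.≡ᵇ⇒≡ m n (≡⇒T e)

module _ {A : Set} (_≟_ : DecidableEquality A) where
  ⌊≟⌋-true : ∀ {x y} → x ≡ y → ⌊ x ≟ y ⌋ ≡ true
  ⌊≟⌋-true {x} {y} e with x ≟ y
  ... | yes _ = refl
  ... | no ne = ⊥-elim (ne e)

  ⌊≟⌋-false : ∀ {x y} → x ≢ y → ⌊ x ≟ y ⌋ ≡ false
  ⌊≟⌋-false {x} {y} ne with x ≟ y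
  ... | yes e = ⊥-elim (ne e)
  ... | no _ = refl

  ⌊≟⌋-≡ : ∀ {x y} → ⌊ x ≟ y ⌋ ≡ true → x ≡ y
  ⌊≟⌋-≡ {x} {y} e with x ≟ y
  ... | yes e' = e'

∑ : {A : Set} → List A → (A → ℕ) → ℕ
∑ xs f = foldr (λ x n → f x ℕ.+ n) 0 xs

module _ {A : Set} where
  ∑-cong : ∀ (xs : List A) {f g} → (∀ x → f x ≡ g x) → ∑ xs f ≡ ∑ xs g
  ∑-cong [] h = refl
  ∑-cong (x ∷ xs) h = cong₂ ℕ._+_ (h x) (∑-cong xs h)

  ∑-mono : ∀ (xs : List A) {f g} → (∀ x → f x ≤ g x) → ∑ xs f ≤ ∑ xs g
  ∑-mono [] h = z≤n
  ∑-mono (x ∷ xs) h = ℕ.+-mono-≤ (h x) (∑-mono xs h)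

  ∑-zero : ∀ (xs : List A) {f} → (∀ x → f x ≡ 0) → ∑ xs f ≡ 0
  ∑-zero [] h = refl
  ∑-zero (x ∷ xs) h = cong₂ ℕ._+_ (h x) (∑-zero xs h)

  ∑-+ : ∀ (xs : List A) f g → ∑ xs (λ x → f x ℕ.+ g x) ≡ ∑ xs f ℕ.+ ∑ xs g
  ∑-+ [] f g = refl
  ∑-+ (x ∷ xs) f g = trans (cong (f x ℕ.+ g x ℕ.+_) (∑-+ xs f g)) (interchange (f x) (g x) (∑ xs f) (∑ xs g))
    where open import Algebra.Properties.CommutativeSemigroup ℕ.+-commutativeSemigroup using (interchange)

  ∑-*ˡ : ∀ (xs : List A) k f → ∑ xs (λ x → k ℕ.* f x) ≡ k ℕ.* ∑ xs f
  ∑-*ˡ [] k f = sym (ℕ.*-zeroʳ k)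
  ∑-*ˡ (x ∷ xs) k f = trans (cong (k ℕ.* f x ℕ.+_) (∑-*ˡ xs k f)) (sym (ℕ.*-distribˡ-+ k (f x) (∑ xs f)))

  ∑-*ʳ : ∀ (xs : List A) k f → ∑ xs (λ x → f x ℕ.* k) ≡ ∑ xs f ℕ.* k
  ∑-*ʳ xs k f = trans (∑-cong xs (λ x → ℕ.*-comm (f x) k)) (trans (∑-*ˡ xs k f) (ℕ.*-comm k (∑ xs f)))

  ∑-++ : ∀ (xs ys : List A) f → ∑ (xs ++ ys) f ≡ ∑ xs f ℕ.+ ∑ ys f
  ∑-++ [] ys f = refl
  ∑-++ (x ∷ xs) ys f = trans (cong (f x ℕ.+_) (∑-++ xs ys f)) (sym (ℕ.+-assoc (f x) _ _))

  ∑-nonzero : ∀ (xs : List A) f → ∑ xs f ≢ 0 → ∃ λ x → f x ≢ 0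
  ∑-nonzero [] f h = ⊥-elim (h refl)
  ∑-nonzero (x ∷ xs) f h with f x in eq
  ... | suc m = x , λ e → ℕ.1+n≢0 (trans (sym eq) e)
  ... | zero = ∑-nonzero xs f h

  count≡∑ : ∀ (xs : List A) P → foldr (λ x n → if P x then suc n else n) 0 xs ≡ ∑ xs (ι ∘ P)
  count≡∑ [] P = refl
  count≡∑ (x ∷ xs) P with P x
  ... | true = cong suc (count≡∑ xs P)
  ... | false = count≡∑ xs P

∑-map : ∀ {A B : Set} (g : A → B) xs f → ∑ (map g xs) f ≡ ∑ xs (f ∘ g)
∑-map g [] f = refl
∑-map g (x ∷ xs) f = cong (f (g x) ℕ.+_) (∑-map g xs f)

∑-swap : ∀ {A B : Set} (xs : List A) (ys : List B) (f : A → B → ℕ) →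
         ∑ xs (λ x → ∑ ys (f x)) ≡ ∑ ys (λ y → ∑ xs (λ x → f x y))
∑-swap [] ys f = sym (∑-zero ys (λ _ → refl))
∑-swap (x ∷ xs) ys f = trans (cong (∑ ys (f x) ℕ.+_) (∑-swap xs ys f)) (sym (∑-+ ys (f x) _))

∑-product : ∀ {A B : Set} (xs : List A) (ys : List B) (f : A × B → ℕ) →
            ∑ (cartesianProduct xs ys) f ≡ ∑ xs (λ x → ∑ ys (λ y → f (x , y)))
∑-product [] ys f = refl
∑-product (x ∷ xs) ys f = trans (∑-++ (map (x ,_) ys) _ f) (cong₂ ℕ._+_ (∑-map (x ,_) ys f) (∑-product xs ys f))

∑-tabulate : ∀ {B : Set} {m} (g : Fin m → B) f → ∑ (tabulate g) f ≡ ∑ (allFin m) (f ∘ g)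
∑-tabulate {m = zero} g f = refl
∑-tabulate {m = suc m} g f = cong (f (g zero) ℕ.+_)
  (trans (∑-tabulate (g ∘ suc) f) (sym (∑-tabulate suc (f ∘ g))))

∑-const : ∀ m k → ∑ (allFin m) (λ _ → k) ≡ m ℕ.* k
∑-const zero k = refl
∑-const (suc m) k = cong (k ℕ.+_) (trans (∑-tabulate {m = m} suc (λ _ → k)) (∑-const m k))

-- A duplicate-free list of all elements, with "each element exactly once" phrased through sums.
record Enumeration (A : Set) : Set where
  field
    elements : List A
    _≟_ : DecidableEquality A
    single : ∀ f a → (∀ x → x ≢ a → f x ≡ 0) → ∑ elements f ≡ f a

  ∑ₑ : (A → ℕ) → ℕ
  ∑ₑ = ∑ elements

  δ : A → A → ℕ
  δ a x = ι ⌊ x ≟ a ⌋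

  δ-same : ∀ a → δ a a ≡ 1
  δ-same a = cong ι (⌊≟⌋-true _≟_ refl)

  δ-diff : ∀ {a x} → x ≢ a → δ a x ≡ 0
  δ-diff ne = cong ι (⌊≟⌋-false _≟_ ne)

  ∑-δ : ∀ a f → ∑ₑ (λ x → δ a x ℕ.* f x) ≡ f a
  ∑-δ a f = trans (single _ a (λ x ne → cong (ℕ._* f x) (δ-diff ne)))
                  (trans (cong (ℕ._* f a) (δ-same a)) (ℕ.+-identityʳ (f a)))

  -- Each f (σ x) is expanded as a sum of δ-multiples of values of f; after exchanging the sums,
  -- only x = τ y contributes to the term at y.
  ∑-reindex : ∀ (σ τ : A → A) → (∀ x → σ (τ x) ≡ x) → (∀ x → τ (σ x) ≡ x) →
              ∀ f → ∑ₑ (f ∘ σ) ≡ ∑ₑ f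
  ∑-reindex σ τ στ τσ f = begin
    ∑ₑ (f ∘ σ)                                   ≡⟨ ∑-cong elements (λ x → ∑-δ (σ x) f) ⟨
    ∑ₑ (λ x → ∑ₑ (λ y → δ (σ x) y ℕ.* f y))      ≡⟨ ∑-swap elements elements _ ⟩
    ∑ₑ (λ y → ∑ₑ (λ x → δ (σ x) y ℕ.* f y))      ≡⟨ ∑-cong elements inner ⟩
    ∑ₑ f                                         ∎
    where
    open ≡-Reasoning
    inner : ∀ y → ∑ₑ (λ x → δ (σ x) y ℕ.* f y) ≡ f y
    inner y = trans (single _ (τ y) λ x ne → cong (ℕ._* f y) (δ-diff (λ e → ne (trans (sym (τσ x)) (cong τ (sym e))))))
      (trans (cong (λ z → δ z y ℕ.* f y) (στ y)) (trans (cong (ℕ._* f y) (δ-same y)) (ℕ.+-identityʳ (f y))))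

  term≤∑ : ∀ f a → f a ≤ ∑ₑ f
  term≤∑ f a = ℕ.≤-trans (ℕ.≤-reflexive (sym (∑-δ a f))) (∑-mono elements le)
    where
    le : ∀ x → δ a x ℕ.* f x ≤ f x
    le x with ⌊ x ≟ a ⌋
    ... | true = ℕ.≤-reflexive (ℕ.+-identityʳ (f x))
    ... | false = z≤n

  -- Existence is decided by the sum of the indicator: a nonzero sum has a nonzero term, and a zero
  -- sum bounds every term by 0.
  search : (P : A → Bool) → (∃ λ x → P x ≡ true) ⊎ (∀ x → P x ≡ false)
  search P with ∑ₑ (ι ∘ P) in eq
  ... | suc m = inj₁ (witness (∑-nonzero elements (ι ∘ P) (λ e → ℕ.1+n≢0 (trans (sym eq) e))))
    where
    witness : (∃ λ x → ι (P x) ≢ 0) → ∃ λ x → P x ≡ true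
    witness (x , ne) = x , lem (P x) ne
      where
      lem : ∀ b → ι b ≢ 0 → b ≡ true
      lem true _ = refl
      lem false h = ⊥-elim (h refl)
  ... | zero = inj₂ λ x → lem (P x) (ℕ.≤-trans (term≤∑ (ι ∘ P) x) (ℕ.≤-reflexive eq))
    where
    lem : ∀ b → ι b ≤ 0 → b ≡ false
    lem false _ = refl
    lem true ()

  ∑-witness : ∀ P → ∑ₑ (ι ∘ P) ≢ 0 → ∃ λ x → P x ≡ true
  ∑-witness P h with search P
  ... | inj₁ w = w
  ... | inj₂ none = ⊥-elim (h (∑-zero elements (λ x → cong ι (none x))))

  witness-∑ : ∀ P x → P x ≡ true → ∑ₑ (ι ∘ P) ≢ 0
  witness-∑ P x e z = ℕ.1+n≰n (ℕ.≤-trans (ℕ.≤-reflexive (sym (cong ι e))) (ℕ.≤-trans (term≤∑ (ι ∘ P) x) (ℕ.≤-reflexive z)))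

  any-true : ∀ P → any P elements ≡ true → ∃ λ x → P x ≡ true
  any-true P = go elements
    where
    go : ∀ xs → any P xs ≡ true → ∃ λ x → P x ≡ true
    go (x ∷ xs) e with P x in eq
    ... | true = x , eq
    ... | false = go xs e

  true-any : ∀ P x → P x ≡ true → any P elements ≡ true
  true-any P x e = ≢true′ (λ f → witness-∑ P x e (none elements f))
    where
    ≢true′ : ∀ {b} → ¬ b ≡ false → b ≡ true
    ≢true′ {true} h = refl
    ≢true′ {false} h = ⊥-elim (h refl)
    none : ∀ xs → any P xs ≡ false → ∑ xs (ι ∘ P) ≡ 0
    none [] _ = refl
    none (x ∷ xs) e with P x
    ... | false = none xs e

fin-enum : ∀ m → Enumeration (Fin m)
fin-enum m = record { elements = allFin m ; _≟_ = _≟F_ ; single = go m }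
  where
  go : ∀ m (f : Fin m → ℕ) a → (∀ x → x ≢ a → f x ≡ 0) → ∑ (allFin m) f ≡ f a
  go (suc m) f zero h = trans (cong (f zero ℕ.+_) (trans (∑-tabulate suc f) (∑-zero (allFin m) (λ x → h (suc x) λ ()))))
                              (ℕ.+-identityʳ (f zero))
  go (suc m) f (suc a) h = trans (cong₂ ℕ._+_ (h zero λ ()) (∑-tabulate suc f))
                                 (go m (f ∘ suc) a λ x ne → h (suc x) λ { refl → ne refl })

product-enum : ∀ {A B} → Enumeration A → Enumeration B → Enumeration (A × B)
product-enum EA EB = record
  { elements = cartesianProduct (Enumeration.elements EA) (Enumeration.elements EB)
  ; _≟_ = ≡-dec (Enumeration._≟_ EA) (Enumeration._≟_ EB)
  ; single = λ f (a , b) h → trans (∑-product (Enumeration.elements EA) (Enumeration.elements EB) f)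
      (trans (Enumeration.single EA _ a λ x ne → ∑-zero (Enumeration.elements EB) λ y → h (x , y) λ { refl → ne refl })
             (Enumeration.single EB _ b λ y ne → h (a , y) λ { refl → ne refl })) }

-- Abstract, so that sums over all elements do not unfold to sums over the triples of Fin 2 × Fin 2 × Fin p.
abstract
  elem-enum : ∀ p → Enumeration (M p)
  elem-enum p = product-enum (fin-enum 2) (product-enum (fin-enum 2) (fin-enum p))

  elem-enum-elements : ∀ p → Enumeration.elements (elem-enum p) ≡ elsM p
  elem-enum-elements p = refl

  count-∑ₑ : ∀ p P → SM.count p P ≡ Enumeration.∑ₑ (elem-enum p) (ι ∘ P)
  count-∑ₑ p P = count≡∑ (elsM p) P

-- Binomial coefficients modulo a prime and the Frobenius identity

prime∤! : ∀ {q} → Prime q → ∀ {k} → k < q → q ∤ k !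
prime∤! pr {zero} k<q q∣1 = >⇒∤ {1} (ℕ.nonTrivial⇒n>1 _ {{prime⇒nonTrivial pr}}) q∣1
prime∤! pr {suc k} k<q q∣ with euclidsLemma (suc k) (k !) pr q∣
... | inj₁ d = >⇒∤ k<q d
... | inj₂ d = prime∤! pr (ℕ.<-trans (ℕ.n<1+n k) k<q) d

-- q divides q ! = (q C k) · k ! · (q - k) !, but neither of the two factorials, all of whose
-- factors are smaller than q.
prime∣C : ∀ {q} → Prime q → ∀ {k} → 0 < k → k < q → q ∣ (q C k)
prime∣C {q} pr {k} 0<k k<q with euclidsLemma (q C k) (k ! ℕ.* (q ∸ k) !) pr (subst (q ∣_) eq (q∣q! pr))
  where
  k≤q = ℕ.<⇒≤ k<q
  q∣q! : ∀ {q} → Prime q → q ∣ q !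
  q∣q! {zero} pr = ⊥-elim (ℕ.≢-nonZero⁻¹ 0 {{prime⇒nonZero pr}} refl)
  q∣q! {suc q} pr = m∣m*n (q !)
  instance _ = k !* (q ∸ k) !≢0
  eq : q ! ≡ (q C k) ℕ.* (k ! ℕ.* (q ∸ k) !)
  eq = sym (trans (cong (ℕ._* (k ! ℕ.* (q ∸ k) !)) (nCk≡n!/k![n-k]! k≤q)) (m/n*n≡m (k![n∸k]!∣n! k≤q)))
... | inj₁ d = d
... | inj₂ d with euclidsLemma (k !) ((q ∸ k) !) pr d
... | inj₁ e = ⊥-elim (prime∤! pr k<q e)
... | inj₂ e = ⊥-elim (prime∤! pr (ℕ.∸-monoʳ-< 0<k (ℕ.<⇒≤ k<q)) e)

module Frobenius {a ℓ} (S : CommutativeSemiring a ℓ) where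
  open CommutativeSemiring S hiding (refl; sym; zero; isEquivalence) renaming (trans to ≈-trans)
  open import Algebra.Properties.CommutativeSemiring.Binomial S using (theorem; binomialTerm)
  open import Algebra.Properties.Semiring.Exp semiring using (_^_)
  open import Algebra.Properties.Semiring.Mult semiring using (×-assocˡ; ×-congˡ; ×-homo-1) renaming (_×_ to _·_)
  open import Algebra.Properties.Semiring.Sum semiring using (sum; sum-init-last; sum-cong-≋; sum-replicate-zero)
  open import Relation.Binary.Reasoning.Setoid setoid

  multiple-zero : ∀ {q} → (∀ x → q · x ≈ 0#) → ∀ {m} → q ∣ m → ∀ x → m · x ≈ 0#
  multiple-zero {q} char {m} (divides d eq) x = begin
    m · x              ≈⟨ ×-congˡ (trans eq (ℕ.*-comm d q)) ⟩
    (q ℕ.* d) · x      ≈⟨ ×-assocˡ x q d ⟨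
    q · (d · x)        ≈⟨ char (d · x) ⟩
    0#                 ∎

  -- In the binomial theorem the inner coefficients are divisible by q, and multiples of q vanish by
  -- assumption.
  frobenius : ∀ {q} → Prime q → (∀ x → q · x ≈ 0#) → ∀ x y → (x + y) ^ q ≈ x ^ q + y ^ q
  frobenius {zero} pr = ⊥-elim (ℕ.≢-nonZero⁻¹ 0 {{prime⇒nonZero pr}} refl)
  frobenius {suc r} pr char x y = ≈-trans (theorem (suc r) x y) (begin
      t zero + sum (t ∘ suc)                                            ≈⟨ +-congˡ (sum-init-last (t ∘ suc)) ⟩
      t zero + (sum (λ i → t (suc (inject₁ i))) + t (suc (fromℕ r)))    ≈⟨ +-cong first (+-cong middle last′) ⟩
      y ^ suc r + (0# + x ^ suc r)                                      ≈⟨ +-congˡ (+-identityˡ _) ⟩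
      y ^ suc r + x ^ suc r                                             ≈⟨ +-comm _ _ ⟩
      x ^ suc r + y ^ suc r                                             ∎)
      where
      t = binomialTerm x y (suc r)
      first : t zero ≈ y ^ suc r
      first = ≈-trans (×-homo-1 _) (*-identityˡ _)
      middle : sum (λ i → t (suc (inject₁ i))) ≈ 0#
      middle = ≈-trans (sum-cong-≋ λ i → multiple-zero char
          (prime∣C pr (s≤s z≤n) (s≤s (subst (_< r) (sym (toℕ-inject₁ i)) (toℕ<n i)))) _)
        (sum-replicate-zero r)
      last′ : t (suc (fromℕ r)) ≈ x ^ suc r
      last′ rewrite toℕ-fromℕ r | nCn≡1 (suc r) | ℕ.n∸n≡0 r = ≈-trans (×-homo-1 _) (*-identityʳ _)

-- The group algebra of M modulo q

∑-% : ∀ {A : Set} q .{{_ : NonZero q}} (xs : List A) {f g} → (∀ x → f x % q ≡ g x % q) → ∑ xs f % q ≡ ∑ xs g % q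
∑-% q [] h = refl
∑-% q (x ∷ xs) {f} {g} h = trans (%-distribˡ-+ (f x) (∑ xs f) q)
  (trans (cong₂ (λ a b → (a ℕ.+ b) % q) (h x) (∑-% q xs h)) (sym (%-distribˡ-+ (g x) (∑ xs g) q)))

%-cong-+ : ∀ q .{{_ : NonZero q}} {a a' b b'} → a % q ≡ a' % q → b % q ≡ b' % q → (a ℕ.+ b) % q ≡ (a' ℕ.+ b') % q
%-cong-+ q {a} {a'} {b} {b'} e e' = trans (%-distribˡ-+ a b q) (trans (cong₂ (λ a b → (a ℕ.+ b) % q) e e') (sym (%-distribˡ-+ a' b' q)))

%-cong-* : ∀ q .{{_ : NonZero q}} {a a' b b'} → a % q ≡ a' % q → b % q ≡ b' % q → (a ℕ.* b) % q ≡ (a' ℕ.* b') % q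
%-cong-* q {a} {a'} {b} {b'} e e' = trans (%-distribˡ-* a b q) (trans (cong₂ (λ a b → (a ℕ.* b) % q) e e') (sym (%-distribˡ-* a' b' q)))

module GroupAlgebra (n : ℕ) where
  open Group n public
  open Enumeration (elem-enum p) public
  open SolveM

  infixl 7 _⊛_
  _⊛_ : (M p → ℕ) → (M p → ℕ) → (M p → ℕ)
  (f ⊛ g) x = ∑ₑ λ γ → f γ ℕ.* g (x - γ)

  shift-sum : ∀ a (f : M p → ℕ) → ∑ₑ (λ γ → f (γ + a)) ≡ ∑ₑ f
  shift-sum a = ∑-reindex (_+ a) (_- a)
    (λ x → abel (x₀ ⊖ x₁ ⊕ x₁) x₀ refl (x ∷ a ∷ [])) (λ x → abel (x₀ ⊕ x₁ ⊖ x₁) x₀ refl (x ∷ a ∷ []))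

  reflect-sum : ∀ a (f : M p → ℕ) → ∑ₑ (λ γ → f (a - γ)) ≡ ∑ₑ f
  reflect-sum a = ∑-reindex (λ x → a - x) (λ x → a - x) inv inv
    where
    inv : ∀ x → a - (a - x) ≡ x
    inv x = abel (x₀ ⊖ (x₀ ⊖ x₁)) x₁ refl (a ∷ x ∷ [])

  ⊛-comm : ∀ f g x → (f ⊛ g) x ≡ (g ⊛ f) x
  ⊛-comm f g x = trans (sym (reflect-sum x _)) (∑-cong elements λ γ →
    trans (ℕ.*-comm (f (x - γ)) _) (cong (λ z → g z ℕ.* f (x - γ)) (abel (x₀ ⊖ (x₀ ⊖ x₁)) x₁ refl (x ∷ γ ∷ []))))

  ⊛-assoc : ∀ f g h x → ((f ⊛ g) ⊛ h) x ≡ (f ⊛ (g ⊛ h)) x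
  ⊛-assoc f g h x = begin
    ∑ₑ (λ γ → (∑ₑ λ β → f β ℕ.* g (γ - β)) ℕ.* h (x - γ))
      ≡⟨ ∑-cong elements (λ γ → sym (∑-*ʳ elements (h (x - γ)) _)) ⟩
    ∑ₑ (λ γ → ∑ₑ λ β → f β ℕ.* g (γ - β) ℕ.* h (x - γ))
      ≡⟨ ∑-swap elements elements _ ⟩
    ∑ₑ (λ β → ∑ₑ λ γ → f β ℕ.* g (γ - β) ℕ.* h (x - γ))
      ≡⟨ ∑-cong elements (λ β → shift-sum β _) ⟨
    ∑ₑ (λ β → ∑ₑ λ γ → f β ℕ.* g (γ + β - β) ℕ.* h (x - (γ + β)))
      ≡⟨ ∑-cong elements (λ β → trans (∑-cong elements (λ γ → inner β γ)) (∑-*ˡ elements (f β) _)) ⟩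
    ∑ₑ (λ β → f β ℕ.* ∑ₑ λ γ → g γ ℕ.* h (x - β - γ)) ∎
    where
    open ≡-Reasoning
    inner : ∀ β γ → f β ℕ.* g (γ + β - β) ℕ.* h (x - (γ + β)) ≡ f β ℕ.* (g γ ℕ.* h (x - β - γ))
    inner β γ = trans (ℕ.*-assoc (f β) _ _) (cong₂ (λ u v → f β ℕ.* (g u ℕ.* h v))
      (abel (x₀ ⊕ x₁ ⊖ x₁) x₀ refl (γ ∷ β ∷ [])) (abel (x₀ ⊖ (x₁ ⊕ x₂)) (x₀ ⊖ x₂ ⊖ x₁) refl (x ∷ γ ∷ β ∷ [])))

  ⊛-identityˡ : ∀ f x → (δ 0ₘ ⊛ f) x ≡ f x
  ⊛-identityˡ f x = trans (∑-δ 0ₘ (λ γ → f (x - γ))) (cong f (abel (x₀ ⊖ 𝟘) x₀ refl (x ∷ [])))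

  ⊛-distribʳ : ∀ f g h x → ((λ y → g y ℕ.+ h y) ⊛ f) x ≡ (g ⊛ f) x ℕ.+ (h ⊛ f) x
  ⊛-distribʳ f g h x = trans (∑-cong elements λ γ → ℕ.*-distribʳ-+ (f (x - γ)) (g γ) (h γ)) (∑-+ elements _ _)

  δ-⊛-δ : ∀ a b x → (δ a ⊛ δ b) x ≡ δ (a + b) x
  δ-⊛-δ a b x = trans (∑-δ a (λ γ → δ b (x - γ))) (cong ι (bool-ext
    (λ e → ⌊≟⌋-true _≟_ (trans (abel x₀ (x₁ ⊕ (x₀ ⊖ x₁)) refl (x ∷ a ∷ [])) (cong (a +_) (⌊≟⌋-≡ _≟_ e))))
    (λ e → ⌊≟⌋-true _≟_ (trans (cong (_- a) (⌊≟⌋-≡ _≟_ e)) (abel (x₀ ⊕ x₁ ⊖ x₀) x₁ refl (a ∷ b ∷ []))))))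

  -- Counting functions up to congruence form a semiring, and the binomial theorem asks for no more;
  -- thus counts remain natural numbers and no subtraction occurs.
  groupAlgebra-mod : ∀ q .{{_ : NonZero q}} → CommutativeSemiring 0ℓ 0ℓ
  groupAlgebra-mod q = record
    { Carrier = M p → ℕ
    ; _≈_ = λ f g → ∀ x → f x % q ≡ g x % q
    ; _+_ = λ f g x → f x ℕ.+ g x
    ; _*_ = _⊛_
    ; 0# = λ _ → 0
    ; 1# = δ 0ₘ
    ; isCommutativeSemiring = isCommutativeSemiringˡ record
      { +-isCommutativeMonoid = isCommutativeMonoidˡ record
        { isSemigroup = record
          { isMagma = record { isEquivalence = eqv ; ∙-cong = λ {f} {f'} {g} {g'} e e' x → %-cong-+ q {f x} {f' x} {g x} {g' x} (e x) (e' x) }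
          ; assoc = λ f g h x → cong (_% q) (ℕ.+-assoc (f x) (g x) (h x)) }
        ; identityˡ = λ f x → refl
        ; comm = λ f g x → cong (_% q) (ℕ.+-comm (f x) (g x)) }
      ; *-isCommutativeMonoid = isCommutativeMonoidˡ record
        { isSemigroup = record
          { isMagma = record { isEquivalence = eqv ; ∙-cong = λ {f} {f'} {g} {g'} e e' x →
              ∑-% q elements (λ γ → %-cong-* q {f γ} {f' γ} {g (x - γ)} {g' (x - γ)} (e γ) (e' (x - γ))) }
          ; assoc = λ f g h x → cong (_% q) (⊛-assoc f g h x) }
        ; identityˡ = λ f x → cong (_% q) (⊛-identityˡ f x)
        ; comm = λ f g x → cong (_% q) (⊛-comm f g x) }
      ; distribʳ = λ f g h x → cong (_% q) (⊛-distribʳ f g h x)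
      ; zeroˡ = λ f x → cong (_% q) (∑-zero elements λ γ → refl) } }
    where
    eqv : IsEquivalence {A = M p → ℕ} (λ f g → ∀ x → f x % q ≡ g x % q)
    eqv = record { refl = λ x → refl ; sym = λ e x → sym (e x) ; trans = λ e e' x → trans (e x) (e' x) }

  infixr 7 _·_
  _·_ : ℕ → M p → M p
  zero · a = 0ₘ
  suc k · a = a + k · a

  module _ (q : ℕ) .{{_ : NonZero q}} where
    open CommutativeSemiring (groupAlgebra-mod q) using (semiring; +-cong; *-congˡ) renaming (_≈_ to _≈ₐ_; _+_ to _⊞_; trans to ≈-trans)
    open import Algebra.Properties.Semiring.Exp semiring using (_^_; ^-congˡ)
    open import Algebra.Properties.Semiring.Mult semiring using () renaming (_×_ to _⊠_)

    δ-^ : ∀ a k → δ a ^ k ≈ₐ δ (k · a)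
    δ-^ a zero x = refl
    δ-^ a (suc k) = ≈-trans {(δ a ^ suc k)} {δ a ⊛ δ (k · a)} {δ (suc k · a)} (*-congˡ {δ a} (δ-^ a k)) (λ x → cong (_% q) (δ-⊛-δ a (k · a) x))

    char-q : ∀ k f x → (k ⊠ f) x ≡ k ℕ.* f x
    char-q zero f x = refl
    char-q (suc k) f x = cong (f x ℕ.+_) (char-q k f x)

    zero-^ : ∀ k → (λ _ → 0) ^ suc k ≈ₐ (λ _ → 0)
    zero-^ k x = cong (_% q) (∑-zero elements λ γ → refl)

    -- The indicator of X pushed forward along φ, cut down to the entries of a list so that its
    -- powers can be computed by induction on the list.
    restrict : (M p → Bool) → (M p → M p) → List (M p) → M p → ℕ
    restrict X φ xs x = ∑ xs λ a → ι (X a) ℕ.* δ (φ a) x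

    -- The Frobenius identity splits off the head of the list, and the q-th power of δ a is δ (q ·
    -- a).
    restrict-^ : Prime q → ∀ X xs → restrict X id xs ^ q ≈ₐ restrict X (q ·_) xs
    restrict-^ pr X [] = pow-zero q pr
      where
      pow-zero : ∀ r → Prime r → (λ _ → 0) ^ r ≈ₐ (λ _ → 0)
      pow-zero zero pr = ⊥-elim (ℕ.≢-nonZero⁻¹ 0 {{prime⇒nonZero pr}} refl)
      pow-zero (suc r) _ = zero-^ r
    restrict-^ pr X (a ∷ xs) = ≈-trans {restrict X id (a ∷ xs) ^ q}
        {((λ x → ι (X a) ℕ.* δ a x) ^ q) ⊞ (restrict X id xs ^ q)} {restrict X (q ·_) (a ∷ xs)}
        (frobenius pr (λ f x → trans (cong (_% q) (trans (char-q q f x) (ℕ.*-comm q (f x)))) (trans (m*n%n≡0 (f x) q) (sym (m*n%n≡0 0 q))))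
          (λ x → ι (X a) ℕ.* δ a x) (restrict X id xs))
        (+-cong {((λ x → ι (X a) ℕ.* δ a x) ^ q)} (head (X a)) (restrict-^ pr X xs))
      where
      open Frobenius (groupAlgebra-mod q) using (frobenius)
      head : ∀ b → (λ x → ι b ℕ.* δ a x) ^ q ≈ₐ (λ x → ι b ℕ.* δ (q · a) x)
      head true = ≈-trans {(λ x → ι true ℕ.* δ a x) ^ q} {δ a ^ q} {λ x → ι true ℕ.* δ (q · a) x}
        (^-congˡ q {λ x → ι true ℕ.* δ a x} {δ a} (λ x → cong (_% q) (ℕ.+-identityʳ (δ a x))))
        (≈-trans {δ a ^ q} {δ (q · a)} {λ x → ι true ℕ.* δ (q · a) x} (δ-^ a q) (λ x → cong (_% q) (sym (ℕ.+-identityʳ (δ (q · a) x)))))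
      head false = restrict-^ pr X []

-- Division modulo p and multiples in M

module Field (n : ℕ) (pr : Prime (suc n)) (5≤p : 5 ≤ suc n) where
  open GroupAlgebra n public

  toℕ-0 : toℕ 0ₚ ≡ 0
  toℕ-0 = toℕ-⟦⟧ 0

  toℕ-1 : toℕ 1ₚ ≡ 1
  toℕ-1 = trans (toℕ-⟦⟧ 1) (m<n⇒m%n≡m (ℕ.≤-trans (s≤s (s≤s z≤n)) 5≤p))

  1≢0 : 1ₚ ≢ 0ₚ
  1≢0 e = ℕ.1+n≢0 (trans (sym toℕ-1) (trans (cong toℕ e) toℕ-0))

  *-zeroˡ : ∀ z → 0ₚ *ₚ z ≡ 0ₚ
  *-zeroˡ z = trans (cong (0ₚ *ₚ_) (sym (⟦toℕ⟧ z))) (⟦⟧-* 0 (toℕ z))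

  *-zeroʳ : ∀ z → z *ₚ 0ₚ ≡ 0ₚ
  *-zeroʳ z = trans (*ₚ-comm z 0ₚ) (*-zeroˡ z)

  *-identityʳ : ∀ z → z *ₚ 1ₚ ≡ z
  *-identityʳ z = trans (*ₚ-comm z 1ₚ) (*ₚ-identityˡ z)

  abstract
    inverse : ∀ u → u ≢ 0ₚ → ∃ λ v → v *ₚ u ≡ 1ₚ
    inverse u u≢0 with coprime-Bézout (prime⇒coprime pr {{ℕ.≢-nonZero λ e → u≢0 (toℕ-injective (trans e (sym toℕ-0)))}} (toℕ<n u))
    ... | Bézout.-+ x y eq = ⟦ y ⟧ , (begin
        ⟦ y ⟧ *ₚ u               ≡⟨ cong (⟦ y ⟧ *ₚ_) (⟦toℕ⟧ u) ⟨
        ⟦ y ⟧ *ₚ ⟦ toℕ u ⟧       ≡⟨ ⟦⟧-* y (toℕ u) ⟩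
        ⟦ y ℕ.* toℕ u ⟧          ≡⟨ cong ⟦_⟧ eq ⟨
        ⟦ 1 ℕ.+ x ℕ.* p ⟧        ≡⟨ ⟦⟧-+ 1 (x ℕ.* p) ⟨
        1ₚ +ₚ ⟦ x ℕ.* p ⟧        ≡⟨ cong (1ₚ +ₚ_) (⟦⟧-cong {x ℕ.* p} {0} (m*n%n≡0 x p)) ⟩
        1ₚ +ₚ 0ₚ                 ≡⟨ trans (+ₚ-comm 1ₚ 0ₚ) (+ₚ-identityˡ 1ₚ) ⟩
        1ₚ                       ∎)
      where open ≡-Reasoning
    -- Here 1 + y u = x p, so y u = - 1 and the inverse of u is - y.
    ... | Bézout.+- x y eq = -ₚ ⟦ y ⟧ , (begin
        (-ₚ ⟦ y ⟧) *ₚ u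
          ≡⟨ SolveP.abel x₀ (x₀ ⊕ x₁ ⊕ x₂ ⊖ (x₂ ⊕ x₁)) refl ((-ₚ ⟦ y ⟧) *ₚ u ∷ ⟦ y ⟧ *ₚ u ∷ 1ₚ ∷ []) ⟩
        (-ₚ ⟦ y ⟧) *ₚ u +ₚ ⟦ y ⟧ *ₚ u +ₚ 1ₚ +ₚ (-ₚ (1ₚ +ₚ ⟦ y ⟧ *ₚ u))
          ≡⟨ cong₂ (λ a b → a +ₚ 1ₚ +ₚ (-ₚ b)) cancels one+yu ⟩
        0ₚ +ₚ 1ₚ +ₚ (-ₚ 0ₚ)
          ≡⟨ SolveP.abel (𝟘 ⊕ x₀ ⊖ 𝟘) x₀ refl (1ₚ ∷ []) ⟩
        1ₚ ∎)
      where
      open ≡-Reasoning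
      open SolveP
      one+yu : 1ₚ +ₚ ⟦ y ⟧ *ₚ u ≡ 0ₚ
      one+yu = trans (cong (λ w → 1ₚ +ₚ ⟦ y ⟧ *ₚ w) (sym (⟦toℕ⟧ u))) (trans (cong (1ₚ +ₚ_) (⟦⟧-* y (toℕ u)))
        (trans (⟦⟧-+ 1 (y ℕ.* toℕ u)) (trans (cong ⟦_⟧ eq) (⟦⟧-cong {x ℕ.* p} {0} (m*n%n≡0 x p)))))
      cancels : (-ₚ ⟦ y ⟧) *ₚ u +ₚ ⟦ y ⟧ *ₚ u ≡ 0ₚ
      cancels = trans (sym (*ₚ-distribʳ u (-ₚ ⟦ y ⟧) ⟦ y ⟧))
        (trans (cong (_*ₚ u) (trans (+ₚ-comm (-ₚ ⟦ y ⟧) ⟦ y ⟧) (-ₚ-inverseʳ ⟦ y ⟧))) (*-zeroˡ u))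

  private
    2≢0 : ⟦ 2 ⟧ ≢ 0ₚ
    2≢0 e = ℕ.1+n≢0 (trans (sym (trans (toℕ-⟦⟧ 2) (m<n⇒m%n≡m (ℕ.≤-trans (s≤s (s≤s (s≤s z≤n))) 5≤p)))) (trans (cong toℕ e) toℕ-0))

  halve : Fin p → Fin p
  halve z = proj₁ (inverse ⟦ 2 ⟧ 2≢0) *ₚ z

  halve-+ : ∀ z → halve z +ₚ halve z ≡ z
  halve-+ z = begin
    h *ₚ z +ₚ h *ₚ z            ≡⟨ *ₚ-distribʳ z h h ⟨
    (h +ₚ h) *ₚ z               ≡⟨ cong (_*ₚ z) (cong₂ _+ₚ_ (*-identityʳ h) (*-identityʳ h)) ⟨
    (h *ₚ 1ₚ +ₚ h *ₚ 1ₚ) *ₚ z   ≡⟨ cong (_*ₚ z) (*ₚ-distribˡ h 1ₚ 1ₚ) ⟨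
    (h *ₚ (1ₚ +ₚ 1ₚ)) *ₚ z      ≡⟨ cong (λ w → (h *ₚ w) *ₚ z) (⟦⟧-+ 1 1) ⟩
    (h *ₚ ⟦ 2 ⟧) *ₚ z           ≡⟨ cong (_*ₚ z) (proj₂ (inverse ⟦ 2 ⟧ 2≢0)) ⟩
    1ₚ *ₚ z                     ≡⟨ *ₚ-identityˡ z ⟩
    z                           ∎
    where
    open ≡-Reasoning
    h = proj₁ (inverse ⟦ 2 ⟧ 2≢0)

  *-cancel-0 : ∀ {u z} → u ≢ 0ₚ → u *ₚ z ≡ 0ₚ → z ≡ 0ₚ
  *-cancel-0 {u} {z} u≢0 e = let (v , vu) = inverse u u≢0 in begin
    z               ≡⟨ *ₚ-identityˡ z ⟨
    1ₚ *ₚ z         ≡⟨ cong (_*ₚ z) vu ⟨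
    (v *ₚ u) *ₚ z   ≡⟨ *ₚ-assoc v u z ⟩
    v *ₚ (u *ₚ z)   ≡⟨ cong (v *ₚ_) e ⟩
    v *ₚ 0ₚ         ≡⟨ *-zeroʳ v ⟩
    0ₚ              ∎
    where open ≡-Reasoning

  abstract
    ratio : ∀ {w z} → w ≢ 0ₚ → z ≢ 0ₚ → ∃ λ u → u ≢ 0ₚ × u *ₚ z ≡ w
    ratio {w} {z} w≢0 z≢0 = let (v , vz) = inverse z z≢0 in
      w *ₚ v , (λ e → w≢0 (trans (sym (eq v vz)) (trans (cong (_*ₚ z) e) (*-zeroˡ z)))) , eq v vz
      where
      eq : ∀ v → v *ₚ z ≡ 1ₚ → (w *ₚ v) *ₚ z ≡ w
      eq v vz = trans (*ₚ-assoc w v z) (trans (cong (w *ₚ_) vz) (*-identityʳ w))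

  μ-1 : ∀ x → μ 1ₚ x ≡ x
  μ-1 x = cong (el (vpart x)) (*ₚ-identityˡ (ppart x))

  μ-μ : ∀ u v x → μ u (μ v x) ≡ μ (u *ₚ v) x
  μ-μ u v x = cong (el (vpart x)) (sym (*ₚ-assoc u v (ppart x)))

  μ-inverse : ∀ {u v} → v *ₚ u ≡ 1ₚ → ∀ x → μ v (μ u x) ≡ x
  μ-inverse e x = trans (μ-μ _ _ x) (trans (cong (λ w → μ w x) e) (μ-1 x))

  ppart-· : ∀ k a → ppart (k · a) ≡ ⟦ k ⟧ *ₚ ppart a
  ppart-· zero a = sym (*-zeroˡ (ppart a))
  ppart-· (suc k) a = begin
    ppart a +ₚ ppart (k · a)             ≡⟨ cong₂ _+ₚ_ (sym (*ₚ-identityˡ (ppart a))) (ppart-· k a) ⟩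
    1ₚ *ₚ ppart a +ₚ ⟦ k ⟧ *ₚ ppart a    ≡⟨ *ₚ-distribʳ (ppart a) 1ₚ ⟦ k ⟧ ⟨
    (1ₚ +ₚ ⟦ k ⟧) *ₚ ppart a             ≡⟨ cong (_*ₚ ppart a) (⟦⟧-+ 1 k) ⟩
    ⟦ suc k ⟧ *ₚ ppart a                 ∎
    where open ≡-Reasoning

  double-V : ∀ v w → v +ᵥ (v +ᵥ w) ≡ w
  double-V (a , b) (a' , b') = cong₂ _,_ (double a a') (double b b')
    where
    double : ∀ (a b : Fin 2) → addMod a (addMod a b) ≡ b
    double zero zero = refl
    double zero (suc zero) = refl
    double (suc zero) zero = refl
    double (suc zero) (suc zero) = refl

  vpart-· : ∀ k a → vpart (suc (2 ℕ.* k) · a) ≡ vpart a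
  vpart-· zero a = cong vpart (SolveM.abel (SolveM._⊕_ SolveM.x₀ SolveM.𝟘) SolveM.x₀ refl (a ∷ []))
  vpart-· (suc k) a = trans (cong (λ m → vpart (suc m · a)) (ℕ.*-suc 2 k))
    (trans (cong (vpart a +ᵥ_) refl) (trans (double-V (vpart a) (vpart (suc (2 ℕ.* k) · a))) (vpart-· k a)))

-- The S-ring of the scheme

module SRing (n : ℕ) (pr : Prime (suc n)) (5≤p : 5 ≤ suc n)
             (col : Coloring (M (suc n))) (cay : IsCayleyM (suc n) col) where
  open Field n pr 5≤p public
  open SolveM
  module CC = SM.IsCC p (proj₁ cay)

  c : M p → ℕ
  c = col 0ₘ

  col-shift : ∀ x y g → col (x + g) (y + g) ≡ col x y
  col-shift x y g = ≡ᵇ-≡ (trans (proj₂ cay g x y x y) (≡ᵇ-true {col x y} refl))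

  col-c : ∀ x y → col x y ≡ c (y - x)
  col-c x y = sym (trans (sym (col-shift 0ₘ (y - x) x))
    (cong₂ col (abel (𝟘 ⊕ x₀) x₀ refl (x ∷ [])) (abel (x₁ ⊖ x₀ ⊕ x₀) x₁ refl (x ∷ y ∷ []))))

  Cls : {A : Set} → (M p → A) → Set
  Cls f = ∀ x y → c x ≡ c y → f x ≡ f y

  c-zero : ∀ x → c x ≡ c 0ₘ → x ≡ 0ₘ
  c-zero x e = sym (⌊≟⌋-≡ _≟M_ (trans (CC.diagUnion 0ₘ x 0ₘ 0ₘ e) (⌊≟⌋-true _≟M_ {0ₘ} refl)))

  c-neg : ∀ x y → c x ≡ c y → c (- x) ≡ c (- y)
  c-neg x y e with CC.transp 0ₘ (- x)
  ... | (a , b) , h = sym (trans (cy y) (≡ᵇ-≡ (trans (h 0ₘ y) (≡ᵇ-true (trans (sym e) cx)))))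
    where
    cy : ∀ y → c (- y) ≡ col y 0ₘ
    cy y = sym (trans (col-c y 0ₘ) (cong c (abel (𝟘 ⊖ x₀) (⊝ x₀) refl (y ∷ []))))
    cx : c x ≡ col a b
    cx = ≡ᵇ-≡ (trans (sym (h 0ₘ x)) (≡ᵇ-true (sym (cy x))))

  coh : ∀ x y → c x ≡ c y → ∀ a b →
        ∑ₑ (λ γ → ι ((c γ ℕ.≡ᵇ c a) ∧ (c (x - γ) ℕ.≡ᵇ c b))) ≡ ∑ₑ (λ γ → ι ((c γ ℕ.≡ᵇ c a) ∧ (c (y - γ) ℕ.≡ᵇ c b)))
  coh x y e a b = trans (sym (conv x)) (trans
      (CC.coh 0ₘ a 0ₘ b 0ₘ x 0ₘ x 0ₘ y (≡⇒T (≡ᵇ-true {c x} refl)) (≡⇒T (≡ᵇ-true (sym e)))) (conv y))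
    where
    conv : ∀ x → SM.count p (λ γ → basis col 0ₘ a 0ₘ γ ∧ basis col 0ₘ b γ x)
                 ≡ ∑ₑ (λ γ → ι ((c γ ℕ.≡ᵇ c a) ∧ (c (x - γ) ℕ.≡ᵇ c b)))
    conv x = trans (count-∑ₑ p (λ γ → basis col 0ₘ a 0ₘ γ ∧ basis col 0ₘ b γ x))
      (∑-cong elements λ γ → cong (λ k → ι ((c γ ℕ.≡ᵇ c a) ∧ (k ℕ.≡ᵇ c b))) (col-c γ x))

  -- A number that is not a colour makes both sums vanish. This form is needed because `sum-coh`
  -- runs over all numbers below a bound.
  coh-ℕ : ∀ x y → c x ≡ c y → ∀ k l →
        ∑ₑ (λ γ → ι ((c γ ℕ.≡ᵇ k) ∧ (c (x - γ) ℕ.≡ᵇ l))) ≡ ∑ₑ (λ γ → ι ((c γ ℕ.≡ᵇ k) ∧ (c (y - γ) ℕ.≡ᵇ l)))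
  coh-ℕ x y e k l with search (λ γ → c γ ℕ.≡ᵇ k) | search (λ γ → c γ ℕ.≡ᵇ l)
  ... | inj₂ none | _ = trans (∑-zero elements λ γ → cong (λ b → ι (b ∧ (c (x - γ) ℕ.≡ᵇ l))) (none γ))
      (sym (∑-zero elements λ γ → cong (λ b → ι (b ∧ (c (y - γ) ℕ.≡ᵇ l))) (none γ)))
  ... | inj₁ _ | inj₂ none = trans (∑-zero elements λ γ → lem (c γ ℕ.≡ᵇ k) (none (x - γ))) (sym (∑-zero elements λ γ → lem (c γ ℕ.≡ᵇ k) (none (y - γ))))
    where
    lem : ∀ a {b} → b ≡ false → ι (a ∧ b) ≡ 0
    lem true refl = refl
    lem false _ = refl
  ... | inj₁ (a , ca) | inj₁ (b , cb) = subst₂ (λ k l →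
        ∑ₑ (λ γ → ι ((c γ ℕ.≡ᵇ k) ∧ (c (x - γ) ℕ.≡ᵇ l))) ≡ ∑ₑ (λ γ → ι ((c γ ℕ.≡ᵇ k) ∧ (c (y - γ) ℕ.≡ᵇ l))))
        (≡ᵇ-≡ ca) (≡ᵇ-≡ cb) (coh x y e a b)

  -- Group the γ by the colours of γ and x - γ: the values of F then get intersection numbers as
  -- coefficients, and these depend on the class of x only.
  sum-coh : ∀ (F : ℕ → ℕ → ℕ) → Cls (λ x → ∑ₑ (λ γ → F (c γ) (c (x - γ))))
  sum-coh F x y e = trans (expand x) (trans (∑-cong (elements′ K) λ k → ∑-cong (elements′ K) λ l →
      cong (ℕ._* F (toℕ k) (toℕ l)) (coh-ℕ x y e (toℕ k) (toℕ l))) (sym (expand y)))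
    where
    -- Every colour is a term of the sum, hence smaller than K.
    K = suc (∑ₑ c)
    elements′ = λ m → Enumeration.elements (fin-enum m)
    c<K : ∀ γ → c γ < K
    c<K γ = s≤s (term≤∑ c γ)
    pick : ∀ a → a < K → (f : ℕ → ℕ) → ∑ (elements′ K) (λ k → ι (a ℕ.≡ᵇ toℕ k) ℕ.* f (toℕ k)) ≡ f a
    pick a a<K f = trans (Enumeration.single (fin-enum K) _ (fromℕ< a<K) λ k ne →
        cong (λ b → ι b ℕ.* f (toℕ k)) (≢true λ e → ne (toℕ-injective (sym (trans (toℕ-fromℕ< a<K) (≡ᵇ-≡ e))))))
      (subst (λ m → ι (a ℕ.≡ᵇ m) ℕ.* f m ≡ f a) (sym (toℕ-fromℕ< a<K))
        (trans (cong (λ b → ι b ℕ.* f a) (≡ᵇ-true {a} refl)) (ℕ.+-identityʳ (f a))))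
    expand : ∀ x → ∑ₑ (λ γ → F (c γ) (c (x - γ))) ≡
      ∑ (elements′ K) (λ k → ∑ (elements′ K) λ l → ∑ₑ (λ γ → ι ((c γ ℕ.≡ᵇ toℕ k) ∧ (c (x - γ) ℕ.≡ᵇ toℕ l))) ℕ.* F (toℕ k) (toℕ l))
    expand x = begin
      ∑ₑ (λ γ → F (c γ) (c (x - γ)))
        ≡⟨ ∑-cong elements (λ γ → trans (sym (pick (c γ) (c<K γ) (λ k → F k (c (x - γ)))))
             (∑-cong (elements′ K) λ k → cong (ι (c γ ℕ.≡ᵇ toℕ k) ℕ.*_) (sym (pick (c (x - γ)) (c<K (x - γ)) (F (toℕ k)))))) ⟩
      ∑ₑ (λ γ → ∑ (elements′ K) λ k → ι (c γ ℕ.≡ᵇ toℕ k) ℕ.* ∑ (elements′ K) λ l → ι (c (x - γ) ℕ.≡ᵇ toℕ l) ℕ.* F (toℕ k) (toℕ l))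
        ≡⟨ ∑-cong elements (λ γ → ∑-cong (elements′ K) λ k → trans (sym (∑-*ˡ (elements′ K) (ι (c γ ℕ.≡ᵇ toℕ k)) _))
             (∑-cong (elements′ K) λ l → trans (sym (ℕ.*-assoc (ι (c γ ℕ.≡ᵇ toℕ k)) _ _)) (cong (ℕ._* F (toℕ k) (toℕ l)) (sym (ι-∧ (c γ ℕ.≡ᵇ toℕ k) _))))) ⟩
      ∑ₑ (λ γ → ∑ (elements′ K) λ k → ∑ (elements′ K) λ l → ι ((c γ ℕ.≡ᵇ toℕ k) ∧ (c (x - γ) ℕ.≡ᵇ toℕ l)) ℕ.* F (toℕ k) (toℕ l))
        ≡⟨ ∑-swap elements (elements′ K) _ ⟩
      ∑ (elements′ K) (λ k → ∑ₑ λ γ → ∑ (elements′ K) λ l → ι ((c γ ℕ.≡ᵇ toℕ k) ∧ (c (x - γ) ℕ.≡ᵇ toℕ l)) ℕ.* F (toℕ k) (toℕ l))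
        ≡⟨ ∑-cong (elements′ K) (λ k → trans (∑-swap elements (elements′ K) _) (∑-cong (elements′ K) λ l → ∑-*ʳ elements (F (toℕ k) (toℕ l)) _)) ⟩
      ∑ (elements′ K) (λ k → ∑ (elements′ K) λ l → ∑ₑ (λ γ → ι ((c γ ℕ.≡ᵇ toℕ k) ∧ (c (x - γ) ℕ.≡ᵇ toℕ l))) ℕ.* F (toℕ k) (toℕ l)) ∎
      where open ≡-Reasoning

  -- Reads a class function as a function of the colour, which is the form that `sum-coh` accepts; 0
  -- is a default at numbers that are not colours.
  valueAt : (M p → ℕ) → ℕ → ℕ
  valueAt f k with search (λ γ → c γ ℕ.≡ᵇ k)
  ... | inj₁ (γ , _) = f γ
  ... | inj₂ _ = 0

  valueAt-c : ∀ {f} → Cls f → ∀ x → valueAt f (c x) ≡ f x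
  valueAt-c {f} cls x with search (λ γ → c γ ℕ.≡ᵇ c x)
  ... | inj₁ (γ , e) = cls γ x (≡ᵇ-≡ e)
  ... | inj₂ none = true≢false (≡ᵇ-true {c x} refl) (none x)

  ⊛-cls : ∀ {f g} → Cls f → Cls g → Cls (f ⊛ g)
  ⊛-cls {f} {g} cf cg x y e = trans (expand x) (trans (sum-coh (λ k l → valueAt f k ℕ.* valueAt g l) x y e) (sym (expand y)))
    where
    expand : ∀ x → (f ⊛ g) x ≡ ∑ₑ (λ γ → valueAt f (c γ) ℕ.* valueAt g (c (x - γ)))
    expand x = ∑-cong elements λ γ → sym (cong₂ ℕ._*_ (valueAt-c cf γ) (valueAt-c cg (x - γ)))

  private
    sums : M p → M p → M p → M p → Bool
    sums a b x γ = (c γ ℕ.≡ᵇ c a) ∧ (c (x - γ) ℕ.≡ᵇ c b)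

  abstract
    -- The decomposition x = a + (x - a) makes an intersection number positive at x; the number is
    -- the same at y, which yields a decomposition of y into the same two classes.
    split : ∀ {x y} → c x ≡ c y → ∀ a → ∃ λ a' → c a' ≡ c a × c (y - a') ≡ c (x - a)
    split {x} {y} e a = found (∑-witness (sums a (x - a) y) λ z →
      witness-∑ (sums a (x - a) x) a (true-∧ (≡ᵇ-true {c a} refl) (≡ᵇ-true {c (x - a)} refl)) (trans (coh x y e a (x - a)) z))
      where
      found : (∃ λ γ → sums a (x - a) y γ ≡ true) → ∃ λ a' → c a' ≡ c a × c (y - a') ≡ c (x - a)
      found (a' , h) = a' , ≡ᵇ-≡ (proj₁ (∧-true h)) , ≡ᵇ-≡ (proj₂ (∧-true {c a' ℕ.≡ᵇ c a} h))

-- Schur's theorem on multipliers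

module Multipliers (n : ℕ) (pr : Prime (suc n)) (5≤p : 5 ≤ suc n)
                   (col : Coloring (M (suc n))) (cay : IsCayleyM (suc n) col) where
  open SRing n pr 5≤p col cay public

  Odd : ℕ → Set
  Odd m = ∃ λ k → m ≡ suc (2 ℕ.* k)

  odd-· : ∀ {m} → Odd m → ∀ a → m · a ≡ μ ⟦ m ⟧ a
  odd-· {m} (k , refl) a = cong₂ el (vpart-· k a) (ppart-· m a)

  module _ (q : ℕ) .{{_ : NonZero q}} (q-prime : Prime q) where
    open CommutativeSemiring (groupAlgebra-mod q) using (semiring)
    open import Algebra.Properties.Semiring.Exp semiring using (_^_)

    ^-cls : ∀ {f} → Cls f → ∀ k → Cls (f ^ k)
    ^-cls cf zero x y e = cong ι (bool-ext (at-zero x y e) (at-zero y x (sym e)))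
      where
      at-zero : ∀ x y → c x ≡ c y → ⌊ x ≟ 0ₘ ⌋ ≡ true → ⌊ y ≟ 0ₘ ⌋ ≡ true
      at-zero x y e h = ⌊≟⌋-true _≟_ (c-zero y (trans (sym e) (cong c (⌊≟⌋-≡ _≟_ h))))
    ^-cls {f} cf (suc k) = ⊛-cls {f} {f ^ k} cf (^-cls cf k)

    private
      only : (b : Bool) (z z' : M p) → (z ≡ z') → ι b ℕ.* δ z z' ≡ ι b
      only b z z' refl = trans (cong (ι b ℕ.*_) (δ-same z)) (ℕ.*-identityʳ (ι b))

      restrict-value : ∀ X (φ ψ : M p → M p) → (∀ a → ψ (φ a) ≡ a) → (∀ x → φ (ψ x) ≡ x) → ∀ x → restrict q X φ elements x ≡ ι (X (ψ x))
      restrict-value X φ ψ ψφ φψ x = trans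
        (single _ (ψ x) λ a ne → trans (cong (ι (X a) ℕ.*_) (δ-diff λ e → ne (sym (trans (cong ψ e) (ψφ a))))) (ℕ.*-zeroʳ (ι (X a))))
        (only (X (ψ x)) (φ (ψ x)) x (φψ x))

      ι-injective-% : ∀ a b → ι a % q ≡ ι b % q → a ≡ b
      ι-injective-% a b e = ι-injective a b (trans (sym (m<n⇒m%n≡m (ι<q a))) (trans e (m<n⇒m%n≡m (ι<q b))))
        where
        ι<q : ∀ a → ι a < q
        ι<q a = ℕ.<-≤-trans (s≤s (ι≤1 a)) (ℕ.nonTrivial⇒n>1 q {{prime⇒nonTrivial q-prime}})
          where
          ι≤1 : ∀ a → ι a ≤ 1
          ι≤1 true = ℕ.≤-refl
          ι≤1 false = z≤n
        ι-injective : ∀ a b → ι a ≡ ι b → a ≡ b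
        ι-injective true true _ = refl
        ι-injective false false _ = refl

    -- The q-th power of the indicator of X is, modulo q, the indicator of q · X.
    prime-multiplier-set : Odd q → ∀ {v} → v *ₚ ⟦ q ⟧ ≡ 1ₚ → ∀ X → Cls X → Cls (X ∘ μ v)
    prime-multiplier-set odd {v} vq X cX x y e = ι-injective-% _ _ (begin
      ι (X (μ v x)) % q                     ≡⟨ value x ⟩
      (indicator ^ q) x % q                 ≡⟨ cong (_% q) (^-cls {indicator} indicator-cls q x y e) ⟩
      (indicator ^ q) y % q                 ≡⟨ value y ⟨
      ι (X (μ v y)) % q                     ∎)
      where
      open ≡-Reasoning
      indicator = restrict q X id elements
      indicator-cls : Cls indicator
      indicator-cls x y e = trans (restrict-value X id id (λ _ → refl) (λ _ → refl) x)
        (trans (cong ι (cX x y e)) (sym (restrict-value X id id (λ _ → refl) (λ _ → refl) y)))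
      value : ∀ x → ι (X (μ v x)) % q ≡ (indicator ^ q) x % q
      value x = sym (trans (restrict-^ q q-prime X elements x) (cong (_% q)
        (restrict-value X (q ·_) (μ v) (λ a → trans (cong (μ v) (odd-· odd a)) (μ-inverse vq a))
          (λ a → trans (odd-· odd (μ v a)) (μ-inverse (trans (*ₚ-comm ⟦ q ⟧ v) vq) a)) x)))

  Multiplier : Fin p → Set
  Multiplier u = ∀ x y → c x ≡ c y → c (μ u x) ≡ c (μ u y)

  -- The union of classes to use is the single class of μ v x.
  prime-multiplier : ∀ {q} → Prime q → Odd q → ∀ {v} → v *ₚ ⟦ q ⟧ ≡ 1ₚ → Multiplier v
  prime-multiplier {q} q-prime odd {v} vq x y e = sym (≡ᵇ-≡ (trans
    (sym (prime-multiplier-set q {{prime⇒nonZero q-prime}} q-prime odd vq (λ z → c z ℕ.≡ᵇ c (μ v x)) (λ _ _ e → cong (ℕ._≡ᵇ c (μ v x)) e) x y e))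
    (≡ᵇ-true {c (μ v x)} refl)))

  odd-factor : ∀ a b → Odd (a ℕ.* b) → Odd a
  odd-factor a b o = parity a o
    where
    parity : ∀ a → Odd (a ℕ.* b) → Odd a
    parity a (k , e) with a % 2 in r | m≡m%n+[m/n]*n a 2 | m%n<n a 2
    ... | suc zero | eq | _ = a / 2 , trans eq (cong suc (ℕ.*-comm (a / 2) 2))
    ... | suc (suc _) | _ | s≤s (s≤s ())
    ... | zero | eq | _ = ⊥-elim (ℕ.even≢odd (a / 2 ℕ.* b) k (trans (sym (trans (cong (ℕ._* b) (trans eq (ℕ.*-comm (a / 2) 2))) (ℕ.*-assoc 2 (a / 2) b))) e))

  product-multiplier : ∀ {qs} → All Prime qs → Odd (product qs) → ∀ v → v *ₚ ⟦ product qs ⟧ ≡ 1ₚ → Multiplier v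
  product-multiplier {[]} _ _ v e x y h = subst (λ w → c (μ w x) ≡ c (μ w y)) (sym (trans (sym (*-identityʳ v)) e))
    (trans (cong c (μ-1 x)) (trans h (sym (cong c (μ-1 y)))))
  product-multiplier {q ∷ qs} (q-prime ∷ primes) odd v e x y h = subst (λ w → c (μ w x) ≡ c (μ w y)) v₁v₂
    (subst₂ (λ a b → c a ≡ c b) (μ-μ v₁ v₂ x) (μ-μ v₁ v₂ y)
      (prime-multiplier q-prime (odd-factor q (product qs) odd) v₁q _ _
        (product-multiplier primes (odd-factor (product qs) q (subst Odd (ℕ.*-comm q (product qs)) odd)) v₂ v₂m x y h)))
    where
    open ≡-Reasoning
    m = ⟦ product qs ⟧
    -- If v inverts q m, then v m inverts q, v q inverts m, and (v m) (v q) = v (v q m) = v.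
    v₁ = v *ₚ m
    v₂ = v *ₚ ⟦ q ⟧
    vqm : v *ₚ (⟦ q ⟧ *ₚ m) ≡ 1ₚ
    vqm = trans (cong (v *ₚ_) (⟦⟧-* q (product qs))) e
    v₁q : v₁ *ₚ ⟦ q ⟧ ≡ 1ₚ
    v₁q = trans (*ₚ-assoc v m ⟦ q ⟧) (trans (cong (v *ₚ_) (*ₚ-comm m ⟦ q ⟧)) vqm)
    v₂m : v₂ *ₚ m ≡ 1ₚ
    v₂m = trans (*ₚ-assoc v ⟦ q ⟧ m) vqm
    v₁v₂ : v₁ *ₚ v₂ ≡ v
    v₁v₂ = begin
      v *ₚ m *ₚ (v *ₚ ⟦ q ⟧)     ≡⟨ *ₚ-assoc v m v₂ ⟩
      v *ₚ (m *ₚ (v *ₚ ⟦ q ⟧))   ≡⟨ cong (v *ₚ_) (trans (*ₚ-comm m v₂) v₂m) ⟩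
      v *ₚ 1ₚ                    ≡⟨ *-identityʳ v ⟩
      v                          ∎

  -- p is odd, so adding it repairs the parity of an even representative.
  odd-representative : ∀ (w : Fin p) → ∃ λ m → Odd m × ⟦ m ⟧ ≡ w
  odd-representative w with parity (toℕ w)
    where
    parity : ∀ a → (∃ λ k → a ≡ 2 ℕ.* k) ⊎ Odd a
    parity zero = inj₁ (0 , refl)
    parity (suc a) with parity a
    ... | inj₁ (k , e) = inj₂ (k , cong suc e)
    ... | inj₂ (k , e) = inj₁ (suc k , trans (cong suc e) (sym (ℕ.*-suc 2 k)))
  ... | inj₂ odd = toℕ w , odd , ⟦toℕ⟧ w
  ... | inj₁ (k , e) = toℕ w ℕ.+ p , (k ℕ.+ proj₁ podd , trans (cong₂ ℕ._+_ e (proj₂ podd))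
        (trans (ℕ.+-suc (2 ℕ.* k) (2 ℕ.* proj₁ podd)) (cong suc (sym (ℕ.*-distribˡ-+ 2 k (proj₁ podd)))))) ,
      trans (⟦⟧-cong {toℕ w ℕ.+ p} {toℕ w} (trans (cong (λ z → (toℕ w ℕ.+ z) % p) (sym (ℕ.*-identityˡ p))) ([m+kn]%n≡m%n (toℕ w) 1 p))) (⟦toℕ⟧ w)
    where
    podd : Odd p
    podd = p-odd
      where
      p-odd : Odd p
      p-odd with p % 2 in r | m≡m%n+[m/n]*n p 2 | m%n<n p 2
      ... | suc zero | eq | _ = p / 2 , trans eq (cong suc (ℕ.*-comm (p / 2) 2))
      ... | suc (suc _) | _ | s≤s (s≤s ())
      ... | zero | _ | _ = ⊥-elim (Prime.notComposite pr (composite {2} (ℕ.≤-trans (s≤s (s≤s (s≤s z≤n))) 5≤p) (m%n≡0⇒n∣m p 2 r)))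

  -- μ u undoes multiplication by an odd m that represents the inverse of u. Since u m = 1 modulo p,
  -- each prime factor of m is invertible modulo p, and the factors are undone one at a time.
  multiplier : ∀ u → u ≢ 0ₚ → Multiplier u
  multiplier u u≢0 = go (odd-representative (proj₁ (inverse u u≢0)))
    where
    go : (∃ λ m → Odd m × ⟦ m ⟧ ≡ proj₁ (inverse u u≢0)) → Multiplier u
    go (m , odd@(k , refl) , e) = let f = factorise m in
      product-multiplier (PrimeFactorisation.factorsPrime f) (subst Odd (PrimeFactorisation.isFactorisation f) odd) u
        (trans (cong (λ z → u *ₚ ⟦ z ⟧) (sym (PrimeFactorisation.isFactorisation f)))
          (trans (cong (u *ₚ_) e) (trans (*ₚ-comm u _) (proj₂ (inverse u u≢0)))))

-- Exhaustive verification over the subsets of V = C₂ × C₂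

infixr 4 _⇒_
_⇒_ : Bool → Bool → Bool
true ⇒ b = b
false ⇒ b = true

mp : ∀ {a b} → (a ⇒ b) ≡ true → a ≡ true → b ≡ true
mp h refl = h

infix 5 _⇔ᵇ_
_⇔ᵇ_ : Bool → Bool → Bool
true ⇔ᵇ b = b
false ⇔ᵇ b = not b

⇔ᵇ-≡ : ∀ {a b} → (a ⇔ᵇ b) ≡ true → a ≡ b
⇔ᵇ-≡ {true} h = sym h
⇔ᵇ-≡ {false} {false} h = refl

≡-⇔ᵇ : ∀ {a b} → a ≡ b → (a ⇔ᵇ b) ≡ true
≡-⇔ᵇ {true} refl = refl
≡-⇔ᵇ {false} refl = refl

module Klein where
  pattern e₀ = (zero , zero)
  pattern e₁ = (zero , suc zero)
  pattern e₂ = (suc zero , zero)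
  pattern e₃ = (suc zero , suc zero)

  infix 5 _==_
  _==_ : V → V → Bool
  e₀ == e₀ = true
  e₁ == e₁ = true
  e₂ == e₂ = true
  e₃ == e₃ = true
  _ == _ = false

  ==-≡ : ∀ {u v} → (u == v) ≡ true → u ≡ v
  ==-≡ {e₀} {e₀} _ = refl
  ==-≡ {e₁} {e₁} _ = refl
  ==-≡ {e₂} {e₂} _ = refl
  ==-≡ {e₃} {e₃} _ = refl

  ==-refl : ∀ u → (u == u) ≡ true
  ==-refl e₀ = refl
  ==-refl e₁ = refl
  ==-refl e₂ = refl
  ==-refl e₃ = refl

  allV : (V → Bool) → Bool
  allV φ = φ e₀ ∧ φ e₁ ∧ φ e₂ ∧ φ e₃

  allV-elim : ∀ φ → allV φ ≡ true → ∀ v → φ v ≡ true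
  allV-elim φ h v with φ e₀ in h₀ | φ e₁ in h₁ | φ e₂ in h₂ | φ e₃ in h₃
  allV-elim φ h e₀ | true | true | true | true = h₀
  allV-elim φ h e₁ | true | true | true | true = h₁
  allV-elim φ h e₂ | true | true | true | true = h₂
  allV-elim φ h e₃ | true | true | true | true = h₃

  allV-intro : ∀ φ → (∀ v → φ v ≡ true) → allV φ ≡ true
  allV-intro φ h rewrite h e₀ | h e₁ | h e₂ | h e₃ = refl

  anyV : (V → Bool) → Bool
  anyV φ = φ e₀ ∨ φ e₁ ∨ φ e₂ ∨ φ e₃

  anyV-elim : ∀ φ → anyV φ ≡ true → ∃ λ v → φ v ≡ true
  anyV-elim φ h with φ e₀ in h₀ | φ e₁ in h₁ | φ e₂ in h₂ | φ e₃ in h₃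
  ... | true | _ | _ | _ = e₀ , h₀
  ... | false | true | _ | _ = e₁ , h₁
  ... | false | false | true | _ = e₂ , h₂
  ... | false | false | false | true = e₃ , h₃

  anyV-intro : ∀ φ v → φ v ≡ true → anyV φ ≡ true
  anyV-intro φ e₀ h rewrite h = refl
  anyV-intro φ e₁ h with φ e₀
  ... | true = refl
  ... | false rewrite h = refl
  anyV-intro φ e₂ h with φ e₀ | φ e₁
  ... | true | _ = refl
  ... | false | true = refl
  ... | false | false rewrite h = refl
  anyV-intro φ e₃ h with φ e₀ | φ e₁ | φ e₂
  ... | true | _ | _ = refl
  ... | false | true | _ = refl
  ... | false | false | true = refl
  ... | false | false | false = h

  subset : Bool → Bool → Bool → Bool → V → Bool
  subset a b c d e₀ = a
  subset a b c d e₁ = b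
  subset a b c d e₂ = c
  subset a b c d e₃ = d

  -- The same subset, in a form on which statements mentioning values at the four elements only compute.
  table : (V → Bool) → V → Bool
  table S = subset (S e₀) (S e₁) (S e₂) (S e₃)

  allB : (Bool → Bool) → Bool
  allB φ = φ true ∧ φ false

  allB-elim : ∀ φ → allB φ ≡ true → ∀ b → φ b ≡ true
  allB-elim φ h true = proj₁ (∧-true h)
  allB-elim φ h false = proj₂ (∧-true {φ true} h)

  allS : ((V → Bool) → Bool) → Bool
  allS φ = allB λ a → allB λ b → allB λ c → allB λ d → φ (subset a b c d)

  allS-elim : ∀ φ → allS φ ≡ true → ∀ S → φ (table S) ≡ true
  allS-elim φ h S =
    allB-elim (λ d → φ (subset (S e₀) (S e₁) (S e₂) d))
      (allB-elim (λ c → allB λ d → φ (subset (S e₀) (S e₁) c d))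
        (allB-elim (λ b → allB λ c → allB λ d → φ (subset (S e₀) b c d))
          (allB-elim (λ a → allB λ b → allB λ c → allB λ d → φ (subset a b c d)) h (S e₀)) (S e₁)) (S e₂)) (S e₃)

  odd : (V → Bool) → Bool
  odd S = S e₀ xor S e₁ xor S e₂ xor S e₃

  sumV : (V → ℕ) → ℕ
  sumV f = ∑ (allFin 2) λ a → ∑ (allFin 2) λ b → f (a , b)

  -- As v + u = v - u in V, this is the coefficient at v of the product of the two indicators in the
  -- group algebra of V.
  corr : (V → Bool) → (V → Bool) → V → ℕ
  corr S T v = sumV λ u → ι (S u) ℕ.* ι (T (v +ᵥ u))

  inv : V → (V → Bool) → Bool
  inv t S = allV λ u → S u ⇔ᵇ S (u +ᵥ t)

  parity : ℕ → Bool
  parity m = m % 2 ℕ.≡ᵇ 1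

  corr-comm : ∀ S T v → corr S T v ≡ corr T S v
  corr-comm S T v = ≡ᵇ-≡ (allV-elim (λ v → corr S T v ℕ.≡ᵇ corr T S v)
    (allS-elim (λ T → allV λ v → corr (table S) T v ℕ.≡ᵇ corr T (table S) v)
      (allS-elim (λ S → allS λ T → allV λ v → corr S T v ℕ.≡ᵇ corr T S v) refl S) T) v)

  -- For v ≠ 0 the solutions come in pairs u, v + u; for v = 0 they are the elements of S.
  corr-parity : ∀ S v → parity (corr S S v) ≡ ((v == e₀) ∧ odd S)
  corr-parity S v = ⇔ᵇ-≡ (allV-elim (λ v → parity (corr S S v) ⇔ᵇ ((v == e₀) ∧ odd S))
    (allS-elim (λ S → allV λ v → parity (corr S S v) ⇔ᵇ ((v == e₀) ∧ odd S)) refl S) v)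

  line : V → V → Bool
  line t v = (v == e₀) ∨ (v == t)

  pair : (V → Bool) → Bool
  pair S = sumV (ι ∘ S) ℕ.≡ᵇ 2

  -- Translation by t permutes the solutions without fixed points.
  corr-even : ∀ S T t → (t == e₀) ≡ false → inv t S ≡ true → inv t T ≡ true →
              ∀ v → corr S T v ≡ 2 ℕ.* ⌊ corr S T v /2⌋
  corr-even S T t t≢0 iS iT v = ≡ᵇ-≡ (allV-elim (λ v → corr S T v ℕ.≡ᵇ 2 ℕ.* ⌊ corr S T v /2⌋)
    (mp (mp (mp (allV-elim (λ t → not (t == e₀) ⇒ inv t S ⇒ inv t T ⇒ (allV λ v → corr S T v ℕ.≡ᵇ 2 ℕ.* ⌊ corr S T v /2⌋))
      (allS-elim (φ (table S)) (allS-elim (λ S → allS (φ S)) refl S) T) t) (cong not t≢0)) iS) iT) v)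
    where
    φ : (V → Bool) → (V → Bool) → Bool
    φ S T = allV λ t → not (t == e₀) ⇒ inv t S ⇒ inv t T ⇒ (allV λ v → corr S T v ℕ.≡ᵇ 2 ℕ.* ⌊ corr S T v /2⌋)

  -- An invariant S is empty, a coset of the line, or V. Its correlations are 0; or 2 on the line
  -- and 0 off it; or 4.
  corr-mod4 : ∀ S t → (t == e₀) ≡ false → inv t S ≡ true → ∀ v → (corr S S v % 4 ℕ.≡ᵇ 2) ≡ (line t v ∧ pair S)
  corr-mod4 S t t≢0 iS v = ⇔ᵇ-≡ (allV-elim (λ v → (corr S S v % 4 ℕ.≡ᵇ 2) ⇔ᵇ (line t v ∧ pair S))
    (mp (mp (allV-elim (λ t → not (t == e₀) ⇒ inv t S ⇒ (allV λ v → (corr S S v % 4 ℕ.≡ᵇ 2) ⇔ᵇ (line t v ∧ pair S)))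
      (allS-elim (λ S → allV λ t → not (t == e₀) ⇒ inv t S ⇒ (allV λ v → (corr S S v % 4 ℕ.≡ᵇ 2) ⇔ᵇ (line t v ∧ pair S))) refl S) t)
      (cong not t≢0)) iS) v)

-- An involution σ with the single fixed point h pairs off the other summands.
pairing : ∀ {A : Set} (E : Enumeration A) (key : A → ℕ) → (∀ {x y} → key x ≡ key y → x ≡ y) →
  (σ : A → A) → (∀ x → σ (σ x) ≡ x) → (h : A) → (∀ x → σ x ≡ x → x ≡ h) → σ h ≡ h →
  ∀ f → (∀ x → f (σ x) ≡ f x) → ∃ λ k → Enumeration.∑ₑ E f ≡ f h ℕ.+ 2 ℕ.* k
pairing E key key-inj σ σσ h fix σh f fσ = ∑ₑ below , (begin
    ∑ₑ f                                                            ≡⟨ ∑-cong elements partition ⟩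
    ∑ₑ (λ x → δ h x ℕ.* f x ℕ.+ (below x ℕ.+ below (σ x)))          ≡⟨ ∑-+ elements _ _ ⟩
    ∑ₑ (λ x → δ h x ℕ.* f x) ℕ.+ ∑ₑ (λ x → below x ℕ.+ below (σ x)) ≡⟨ cong₂ ℕ._+_ (∑-δ h f) (∑-+ elements _ _) ⟩
    f h ℕ.+ (∑ₑ below ℕ.+ ∑ₑ (below ∘ σ))                           ≡⟨ cong (λ s → f h ℕ.+ (∑ₑ below ℕ.+ s)) (∑-reindex σ σ σσ σσ below) ⟩
    f h ℕ.+ (∑ₑ below ℕ.+ ∑ₑ below)                                 ≡⟨ cong (λ s → f h ℕ.+ (∑ₑ below ℕ.+ s)) (ℕ.+-identityʳ _) ⟨
    f h ℕ.+ 2 ℕ.* ∑ₑ below                                          ∎)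
  where
  open Enumeration E
  open ≡-Reasoning
  -- The key picks out one element of each pair x, σ x, so `below` counts every pair once.
  below = λ x → ι (key x <ᵇ key (σ x)) ℕ.* f x
  <ᵇ-true : ∀ {m n} → m < n → (m <ᵇ n) ≡ true
  <ᵇ-true lt = T⇒≡ (ℕ.<⇒<ᵇ lt)
  <ᵇ-false : ∀ {m n} → ¬ m < n → (m <ᵇ n) ≡ false
  <ᵇ-false {m} {n} nlt = ≢true λ e → nlt (ℕ.<ᵇ⇒< m n (≡⇒T e))
  below-σ : ∀ x → below (σ x) ≡ ι (key (σ x) <ᵇ key x) ℕ.* f x
  below-σ x = cong₂ (λ y z → ι (key (σ x) <ᵇ key y) ℕ.* z) (σσ x) (fσ x)
  partition : ∀ x → f x ≡ δ h x ℕ.* f x ℕ.+ (below x ℕ.+ below (σ x))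
  partition x rewrite below-σ x with ℕ.<-cmp (key x) (key (σ x))
  ... | tri< lt ne ngt rewrite <ᵇ-true lt | <ᵇ-false ngt | δ-diff {h} {x} (λ { refl → ne (cong key (sym σh)) })
      = sym (trans (ℕ.+-identityʳ _) (ℕ.+-identityʳ _))
  ... | tri> nlt ne gt rewrite <ᵇ-true gt | <ᵇ-false nlt | δ-diff {h} {x} (λ { refl → ne (cong key (sym σh)) })
      = sym (ℕ.+-identityʳ _)
  ... | tri≈ nlt e ngt rewrite <ᵇ-false nlt | <ᵇ-false ngt | fix x (sym (key-inj e)) | δ-same h
      = sym (trans (ℕ.+-identityʳ _) (ℕ.+-identityʳ _))

∑-triples : ∀ {A B C : Set} (xs : List A) (ys : List B) (zs : List C) (f : A × B × C → ℕ) →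
  ∑ (cartesianProduct xs (cartesianProduct ys zs)) f ≡ ∑ zs (λ z → ∑ xs λ x → ∑ ys λ y → f (x , y , z))
∑-triples xs ys zs f = begin
  ∑ (cartesianProduct xs (cartesianProduct ys zs)) f            ≡⟨ ∑-product xs (cartesianProduct ys zs) f ⟩
  ∑ xs (λ x → ∑ (cartesianProduct ys zs) λ y → f (x , y))       ≡⟨ ∑-cong xs (λ x → ∑-product ys zs (λ y → f (x , y))) ⟩
  ∑ xs (λ x → ∑ ys λ y → ∑ zs λ z → f (x , y , z))              ≡⟨ ∑-cong xs (λ x → ∑-swap ys zs (λ y z → f (x , y , z))) ⟩
  ∑ xs (λ x → ∑ zs λ z → ∑ ys λ y → f (x , y , z))              ≡⟨ ∑-swap xs zs (λ x z → ∑ ys λ y → f (x , y , z)) ⟩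
  ∑ zs (λ z → ∑ xs λ x → ∑ ys λ y → f (x , y , z))              ∎
  where open ≡-Reasoning

-- Layers and convolution squares of unions of classes

module Layers (n : ℕ) (pr : Prime (suc n)) (5≤p : 5 ≤ suc n)
              (col : Coloring (M (suc n))) (cay : IsCayleyM (suc n) col) where
  open Multipliers n pr 5≤p col cay public
  open Klein public

  abstract
    enumₚ : Enumeration (Fin p)
    enumₚ = fin-enum p

    ∑ₚ-const : ∀ k → Enumeration.∑ₑ enumₚ (λ _ → k) ≡ p ℕ.* k
    ∑ₚ-const k = ∑-const p k

    ∑-layers : ∀ f → ∑ₑ f ≡ Enumeration.∑ₑ enumₚ (λ w → sumV λ v → f (el v w))
    ∑-layers f = trans (cong (λ xs → ∑ xs f) (elem-enum-elements p)) (∑-triples (allFin 2) (allFin 2) (allFin p) f)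

  module Eₚ = Enumeration enumₚ

  layer : (M p → Bool) → Fin p → V → Bool
  layer X w v = X (el v w)

  self-conv : (M p → Bool) → M p → ℕ
  self-conv X = (ι ∘ X) ⊛ (ι ∘ X)

  self-conv-cls : ∀ {X} → Cls X → Cls (self-conv X)
  self-conv-cls cX = ⊛-cls (λ x y e → cong ι (cX x y e)) (λ x y e → cong ι (cX x y e))

  layer-term : (M p → Bool) → M p → Fin p → ℕ
  layer-term X g w = corr (layer X w) (layer X (ppart g +ₚ (-ₚ w))) (vpart g)

  self-conv-layers : ∀ X g → self-conv X g ≡ Eₚ.∑ₑ (layer-term X g)
  self-conv-layers X g = ∑-layers (λ γ → ι (X γ) ℕ.* ι (X (g - γ)))

  layer-term-sym : ∀ X g w → layer-term X g (ppart g +ₚ (-ₚ w)) ≡ layer-term X g w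
  layer-term-sym X g w = trans
    (cong (λ z → corr (layer X (ppart g +ₚ (-ₚ w))) (layer X z) (vpart g))
      (SolveP.abel (SolveP._⊖_ SolveP.x₀ (SolveP._⊖_ SolveP.x₀ SolveP.x₁)) SolveP.x₁ refl (ppart g ∷ w ∷ [])))
    (corr-comm (layer X (ppart g +ₚ (-ₚ w))) (layer X w) (vpart g))

  halve-fixed : ∀ z → z +ₚ (-ₚ halve z) ≡ halve z
  halve-fixed z = trans (cong (_+ₚ (-ₚ halve z)) (sym (halve-+ z)))
    (SolveP.abel (SolveP._⊖_ (SolveP._⊕_ SolveP.x₀ SolveP.x₀) SolveP.x₀) SolveP.x₀ refl (halve z ∷ []))

  double-injective : ∀ {w w'} → w +ₚ w ≡ w' +ₚ w' → w ≡ w'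
  double-injective {w} {w'} e = begin
    w                           ≡⟨ halves w ⟨
    halve (w +ₚ w)              ≡⟨ cong halve e ⟩
    halve (w' +ₚ w')            ≡⟨ halves w' ⟩
    w'                          ∎
    where
    open ≡-Reasoning
    halves : ∀ w → halve (w +ₚ w) ≡ w
    halves w = trans (*ₚ-distribˡ _ w w) (halve-+ w)

  only-halve : ∀ z w → z +ₚ (-ₚ w) ≡ w → w ≡ halve z
  only-halve z w e = double-injective (trans (cong (_+ₚ w) (sym e)) (trans
    (SolveP.abel (SolveP._⊕_ (SolveP._⊖_ SolveP.x₀ SolveP.x₁) SolveP.x₁) SolveP.x₀ refl (z ∷ w ∷ [])) (sym (halve-+ z))))

  reflect-pairing : ∀ z f → (∀ w → f (z +ₚ (-ₚ w)) ≡ f w) → ∃ λ k → Eₚ.∑ₑ f ≡ f (halve z) ℕ.+ 2 ℕ.* k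
  reflect-pairing z f = pairing enumₚ toℕ toℕ-injective (λ w → z +ₚ (-ₚ w))
    (λ w → SolveP.abel (SolveP._⊖_ SolveP.x₀ (SolveP._⊖_ SolveP.x₀ SolveP.x₁)) SolveP.x₁ refl (z ∷ w ∷ []))
    (halve z) (only-halve z) (halve-fixed z) f

  middle-term : ∀ X g → layer-term X g (halve (ppart g)) ≡ corr (layer X (halve (ppart g))) (layer X (halve (ppart g))) (vpart g)
  middle-term X g = cong (λ z → corr (layer X (halve (ppart g))) (layer X z) (vpart g)) (halve-fixed (ppart g))

  -- Only the term at the fixed point of the reflection survives, and there the two correlated
  -- layers are the same.
  self-conv-parity : ∀ X g → parity (self-conv X g) ≡ ((vpart g == e₀) ∧ odd (layer X (halve (ppart g))))
  self-conv-parity X g = let (k , e) = reflect-pairing (ppart g) (layer-term X g) (layer-term-sym X g) in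
    trans (cong parity (trans (self-conv-layers X g) e))
      (trans (cong (ℕ._≡ᵇ 1) (trans (cong (λ s → (layer-term X g (halve (ppart g)) ℕ.+ s) % 2) (ℕ.*-comm 2 k))
          ([m+kn]%n≡m%n (layer-term X g (halve (ppart g))) k 2)))
        (trans (cong parity (middle-term X g)) (corr-parity (layer X (halve (ppart g))) (vpart g))))

  -- Invariance makes all terms even, so the pairing can be applied to their halves; doubling turns
  -- its error 2 k into 4 k.
  self-conv-mod4 : ∀ X t → (t == e₀) ≡ false → (∀ w → inv t (layer X w) ≡ true) →
    ∀ g → (self-conv X g % 4 ℕ.≡ᵇ 2) ≡ (line t (vpart g) ∧ pair (layer X (halve (ppart g))))
  self-conv-mod4 X t t≢0 iX g =
    let (k , e) = reflect-pairing (ppart g) half (λ w → cong ⌊_/2⌋ (layer-term-sym X g w)) in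
    trans (cong (λ m → m % 4 ℕ.≡ᵇ 2) (trans (self-conv-layers X g) (total k e)))
      (trans (cong (ℕ._≡ᵇ 2) ([m+kn]%n≡m%n (layer-term X g h) k 4))
        (trans (cong (λ m → m % 4 ℕ.≡ᵇ 2) (middle-term X g)) (corr-mod4 (layer X h) t t≢0 (iX h) (vpart g))))
    where
    h = halve (ppart g)
    half : Fin p → ℕ
    half w = ⌊ layer-term X g w /2⌋
    double : ∀ w → layer-term X g w ≡ 2 ℕ.* half w
    double w = corr-even (layer X w) (layer X (ppart g +ₚ (-ₚ w))) t t≢0 (iX w) (iX (ppart g +ₚ (-ₚ w))) (vpart g)
    total : ∀ k → Eₚ.∑ₑ half ≡ half h ℕ.+ 2 ℕ.* k → Eₚ.∑ₑ (layer-term X g) ≡ layer-term X g h ℕ.+ k ℕ.* 4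
    total k e = begin
      Eₚ.∑ₑ (layer-term X g)               ≡⟨ ∑-cong Eₚ.elements double ⟩
      Eₚ.∑ₑ (λ w → 2 ℕ.* half w)           ≡⟨ ∑-*ˡ Eₚ.elements 2 half ⟩
      2 ℕ.* Eₚ.∑ₑ half                     ≡⟨ cong (2 ℕ.*_) e ⟩
      2 ℕ.* (half h ℕ.+ 2 ℕ.* k)           ≡⟨ ℕ.*-distribˡ-+ 2 (half h) (2 ℕ.* k) ⟩
      2 ℕ.* half h ℕ.+ 2 ℕ.* (2 ℕ.* k)     ≡⟨ cong₂ ℕ._+_ (sym (double h)) (trans (sym (ℕ.*-assoc 2 2 k)) (ℕ.*-comm 4 k)) ⟩
      layer-term X g h ℕ.+ k ℕ.* 4         ∎
      where open ≡-Reasoning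

  -- The closure under multipliers. A union of classes stays one, and a single point (v , w) with w
  -- ≠ 0 brings in all points (v , w') with w' ≠ 0.
  hull : (M p → Bool) → M p → Bool
  hull X x = any (λ u → not ⌊ u ≟F 0ₚ ⌋ ∧ X (μ u x)) Eₚ.elements

  hull-intro : ∀ X x u → u ≢ 0ₚ → X (μ u x) ≡ true → hull X x ≡ true
  hull-intro X x u u≢0 h = Eₚ.true-any _ u (true-∧ (cong not (⌊≟⌋-false _≟F_ u≢0)) h)

  hull-elim : ∀ X x → hull X x ≡ true → ∃ λ u → u ≢ 0ₚ × X (μ u x) ≡ true
  hull-elim X x h = let (u , e) = Eₚ.any-true _ h ; (nz , Xu) = ∧-true {not ⌊ u ≟F 0ₚ ⌋} e in
    u , (λ u≡0 → true≢false nz (cong not (⌊≟⌋-true _≟F_ u≡0))) , Xu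

  hull-cls : ∀ {X} → Cls X → Cls (hull X)
  hull-cls {X} cX x y e = bool-ext (go x y e) (go y x (sym e))
    where
    go : ∀ x y → c x ≡ c y → hull X x ≡ true → hull X y ≡ true
    go x y e h = let (u , u≢0 , Xu) = hull-elim X x h in
      hull-intro X y u u≢0 (trans (sym (cX (μ u x) (μ u y) (multiplier u u≢0 x y e))) Xu)

  isZero : M p → Bool
  isZero x = ⌊ x ≟ 0ₘ ⌋

  isZero-cls : Cls isZero
  isZero-cls x y e = bool-ext (go x y e) (go y x (sym e))
    where
    go : ∀ x y → c x ≡ c y → isZero x ≡ true → isZero y ≡ true
    go x y e h = ⌊≟⌋-true _≟_ (c-zero y (trans (sym e) (cong c (⌊≟⌋-≡ _≟_ h))))

  class-of : M p → M p → Bool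
  class-of a x = c x ℕ.≡ᵇ c a

  class-of-cls : ∀ a → Cls (class-of a)
  class-of-cls a x y e = cong (ℕ._≡ᵇ c a) e

  isP : M p → Bool
  isP x = vpart x == e₀

  isL : V → M p → Bool
  isL t x = line t (vpart x)

  cls-≗ : ∀ {X Y : M p → Bool} → (∀ x → X x ≡ Y x) → Cls Y → Cls X
  cls-≗ h cY x y e = trans (h x) (trans (cY x y e) (sym (h y)))

  -- If the layer at w is odd, the elements with odd convolution square lie in P and include (0 , 2
  -- w). Their closure under multipliers, together with 0, is then exactly P.
  even-layers : ¬ Cls isP → ∀ {X} → Cls X → ∀ {w} → w ≢ 0ₚ → odd (layer X w) ≡ false
  even-layers notP {X} cX {w} w≢0 = ≢true λ o → notP (cls-≗ (isP-hull o)
      (λ x y e → cong₂ _∨_ (hull-cls {D} (λ x y e → cong parity (self-conv-cls cX x y e)) x y e) (isZero-cls x y e)))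
    where
    D : M p → Bool
    D g = parity (self-conv X g)
    isP-hull : odd (layer X w) ≡ true → ∀ x → isP x ≡ (hull D x ∨ isZero x)
    isP-hull o x = bool-ext into outof
      where
      into : isP x ≡ true → (hull D x ∨ isZero x) ≡ true
      into h with ppart x ≟F 0ₚ
      ... | yes z≡0 = ∨-true₂ (⌊≟⌋-true _≟_ (cong₂ el (==-≡ h) z≡0))
        where
        ∨-true₂ : ∀ {a b} → b ≡ true → a ∨ b ≡ true
        ∨-true₂ {true} _ = refl
        ∨-true₂ {false} h = h
      ... | no z≢0 = cong (_∨ isZero x) (hull-intro D x (proj₁ r) (proj₁ (proj₂ r))
            (trans (self-conv-parity X (μ (proj₁ r) x)) (true-∧ h (trans (cong (odd ∘ layer X) hw) o))))
        where
        2w≢0 : w +ₚ w ≢ 0ₚ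
        2w≢0 e = w≢0 (double-injective (trans e (sym (+ₚ-identityˡ 0ₚ))))
        r : ∃ λ u → u ≢ 0ₚ × u *ₚ ppart x ≡ w +ₚ w
        r = ratio 2w≢0 z≢0
        hw : halve (proj₁ r *ₚ ppart x) ≡ w
        hw = double-injective (trans (halve-+ _) (proj₂ (proj₂ r)))
      outof : (hull D x ∨ isZero x) ≡ true → isP x ≡ true
      outof h with hull D x in hD
      ... | true = let (u , _ , Du) = hull-elim D x hD in proj₁ (∧-true (trans (sym (self-conv-parity X (μ u x))) Du))
      ... | false = cong (λ y → vpart y == e₀) (⌊≟⌋-≡ _≟_ h)

  -- Suppose x is in X and x + g is not. Transporting g = (x + g) + (- x) to t gives an element a in
  -- the class of x + g, outside X, with a - t in the class of x, inside X; this contradicts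
  -- stability under t.
  translate-cls : ∀ {X} → Cls X → ∀ {t g} → c g ≡ c t → (∀ x → X x ≡ true → X (x + t) ≡ true) →
                  ∀ x → X x ≡ true → X (x + g) ≡ true
  translate-cls {X} cX {t} {g} e stable x Xx with decide (X (x + g))
  ... | inj₁ h = h
  ... | inj₂ h = let (a , ca , cb) = split e (x + g) in
    true≢false (trans (cong X (sym (abel (x₀ ⊖ x₁ ⊕ x₁) x₀ refl (a ∷ t ∷ []))))
        (stable (a - t) (trans (cX (a - t) x (trans (cong c (abel (x₀ ⊖ x₁) (⊝ (x₁ ⊖ x₀)) refl (a ∷ t ∷ [])))
           (trans (c-neg _ _ cb) (cong c (abel (⊝ (x₀ ⊖ (x₁ ⊕ x₀))) x₁ refl (g ∷ x ∷ [])))))) Xx)))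
      (trans (cX a (x + g) ca) h)
    where open SolveM

∨-true : ∀ {a b} → a ∨ b ≡ true → a ≡ true ⊎ b ≡ true
∨-true {true} _ = inj₁ refl
∨-true {false} h = inj₂ h

∨-introʳ : ∀ a {b} → b ≡ true → a ∨ b ≡ true
∨-introʳ true _ = refl
∨-introʳ false h = h

∨-introˡ : ∀ {a} b → a ≡ true → a ∨ b ≡ true
∨-introˡ b refl = refl

imp : ∀ {a b} → (a ≡ true → b ≡ true) → (a ⇒ b) ≡ true
imp {true} h = h refl
imp {false} h = refl

not-true : ∀ {b} → not b ≡ true → b ≡ false
not-true {false} _ = refl

-- Subgroups of V

data Subspace (S : V → Bool) : Set where
  trivial : (∀ v → S v ≡ (v Klein.== Klein.e₀)) → Subspace S
  a-line : ∀ t → (t Klein.== Klein.e₀) ≡ false → (∀ v → S v ≡ Klein.line t v) → Subspace S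
  everything : (∀ v → S v ≡ true) → Subspace S

module _ where
  open Klein

  subspace : ∀ S → S e₀ ≡ true → (∀ u v → S u ≡ true → S v ≡ true → S (u +ᵥ v) ≡ true) → Subspace S
  subspace S S0 S+ = classify (∨-true (mp (mp (allS-elim φ refl S) S0) closed))
    where
    φ : (V → Bool) → Bool
    φ S = S e₀ ⇒ (allV λ u → allV λ v → S u ⇒ S v ⇒ S (u +ᵥ v)) ⇒
      (allV λ v → S v ⇔ᵇ (v == e₀)) ∨ (anyV λ t → not (t == e₀) ∧ (allV λ v → S v ⇔ᵇ line t v)) ∨ (allV λ v → S v)
    closed : (allV λ u → allV λ v → S u ⇒ S v ⇒ S (u +ᵥ v)) ≡ true
    closed = allV-intro (λ u → allV λ v → S u ⇒ S v ⇒ S (u +ᵥ v)) λ u →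
      allV-intro (λ v → S u ⇒ S v ⇒ S (u +ᵥ v)) λ v → imp λ a → imp λ b → S+ u v a b
    classify : (allV λ v → S v ⇔ᵇ (v == e₀)) ≡ true ⊎
      ((anyV λ t → not (t == e₀) ∧ (allV λ v → S v ⇔ᵇ line t v)) ∨ (allV λ v → S v)) ≡ true → Subspace S
    classify (inj₁ h) = trivial λ v → ⇔ᵇ-≡ (allV-elim (λ v → S v ⇔ᵇ (v == e₀)) h v)
    classify (inj₂ h) with ∨-true {anyV λ t → not (t == e₀) ∧ (allV λ v → S v ⇔ᵇ line t v)} h
    ... | inj₁ a = let (t , e) = anyV-elim (λ t → not (t == e₀) ∧ (allV λ v → S v ⇔ᵇ line t v)) a in
      a-line t (not-true (proj₁ (∧-true e))) λ v → ⇔ᵇ-≡ (allV-elim (λ v → S v ⇔ᵇ line t v) (proj₂ (∧-true {not (t == e₀)} e)) v)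
    ... | inj₂ b = everything (allV-elim S b)

-- Subgroups of M that are unions of classes

module Subgroups (n : ℕ) (pr : Prime (suc n)) (5≤p : 5 ≤ suc n)
                 (col : Coloring (M (suc n))) (cay : IsCayleyM (suc n) col) where
  open Layers n pr 5≤p col cay public

  Stable : (M p → Bool) → M p → Set
  Stable X g = ∀ x → X x ≡ true → X (x + g) ≡ true

  +-zeroʳ : ∀ x → x + 0ₘ ≡ x
  +-zeroʳ x = SolveM.abel (SolveM._⊕_ SolveM.x₀ SolveM.𝟘) SolveM.x₀ refl (x ∷ [])

  +ₚ-zeroʳ : ∀ z → z +ₚ 0ₚ ≡ z
  +ₚ-zeroʳ z = trans (+ₚ-comm z 0ₚ) (+ₚ-identityˡ z)

  stable-+ : ∀ {X g h} → Stable X g → Stable X h → Stable X (g + h)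
  stable-+ {X} {g} {h} sg sh x Xx = trans (cong X (abel (x₀ ⊕ (x₁ ⊕ x₂)) (x₀ ⊕ x₁ ⊕ x₂) refl (x ∷ g ∷ h ∷ []))) (sh _ (sg x Xx))
    where open SolveM

  stable-· : ∀ {X g} → Stable X g → ∀ k → Stable X (k · g)
  stable-· {X} sg zero x Xx = trans (cong X (+-zeroʳ x)) Xx
  stable-· {X} {g} sg (suc k) = stable-+ {X} {g} {k · g} sg (stable-· {X} sg k)

  multiple : ∀ g → ppart g ≢ 0ₚ → ∀ z → ∃ λ k → ppart (k · g) ≡ z
  multiple g g≢0 z with z ≟F 0ₚ
  ... | yes refl = 0 , refl
  ... | no z≢0 = let (u , _ , e) = ratio z≢0 g≢0 in
    toℕ u , trans (ppart-· (toℕ u) g) (trans (cong (_*ₚ ppart g) (⟦toℕ⟧ u)) e)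

  -- The multiples of g take every P-part, in particular the one that cancels that of x.
  reach-V : ∀ {X g x} → Stable X g → ppart g ≢ 0ₚ → X x ≡ true → ∃ λ v → X (el v 0ₚ) ≡ true
  reach-V {X} {g} {x} sg g≢0 Xx = let (k , e) = multiple g g≢0 (-ₚ ppart x) in
    vpart (x + k · g) , subst (λ z → X (el (vpart (x + k · g)) z) ≡ true)
      (trans (cong (ppart x +ₚ_) e) (-ₚ-inverseʳ (ppart x))) (stable-· {X} sg k x Xx)

  nonzero-t : ∀ {t} → (t == e₀) ≡ false → el t 0ₚ ≢ 0ₘ
  nonzero-t h e = true≢false (subst (λ t → (t == e₀) ≡ true) (sym (cong vpart e)) refl) h

  inv-stable : ∀ {X} t → (∀ w → inv t (layer X w) ≡ true) → Stable X (el t 0ₚ)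
  inv-stable {X} t iX x Xx = trans (cong (λ z → X (el (vpart x +ᵥ t) z)) (+ₚ-zeroʳ (ppart x)))
    (trans (sym (⇔ᵇ-≡ (allV-elim (λ u → X (el u (ppart x)) ⇔ᵇ X (el (u +ᵥ t) (ppart x))) (iX (ppart x)) (vpart x)))) Xx)

  -- The convolution square of the indicator of X is 2 modulo 4 exactly on those (v , z) for which v lies
  -- on the line and the layer at z / 2 has two elements.
  line-cls : ∀ {X} → Cls X → (∀ v → X (el v 0ₚ) ≡ false) → ∀ t → (t == e₀) ≡ false →
             (∀ w → inv t (layer X w) ≡ true) → ∀ z₀ → pair (layer X z₀) ≡ true → Cls (isL t)
  line-cls {X} cX X∩V t t≢0 iX z₀ two = cls-≗ isL-hull λ x y e → cong₂ _∨_
      (hull-cls {D} (λ x y e → cong (λ m → m % 4 ℕ.≡ᵇ 2) (self-conv-cls cX x y e)) x y e)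
      (cong₂ _∨_ (isZero-cls x y e) (class-of-cls (el t 0ₚ) x y e))
    where
    D : M p → Bool
    D g = self-conv X g % 4 ℕ.≡ᵇ 2
    D-eq = self-conv-mod4 X t t≢0 iX
    S = layer X z₀
    member : ∃ λ v → S v ≡ true
    member = anyV-elim S (mp (allS-elim (λ S → pair S ⇒ anyV S) refl S) two)
    z₀≢0 : z₀ ≢ 0ₚ
    z₀≢0 e = true≢false (subst (λ z → X (el (proj₁ member) z) ≡ true) e (proj₂ member)) (X∩V _)
    -- The hull misses (t , 0) because X has no points in V, so the class of (t , 0) is added as a
    -- whole and must be kept inside the line times P. Its elements stabilize X: with a nonzero
    -- P-part they would carry X into V, and otherwise their V-part stabilizes a coset of the line.
    translation-on-line : ∀ x → Stable X x → line t (vpart x) ≡ true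
    translation-on-line x sx with ppart x ≟F 0ₚ
    ... | no z≢0 = let (v , h) = reach-V {X} sx z≢0 (proj₂ member) in true≢false h (X∩V v)
    ... | yes z≡0 = mp (mp (mp (mp (allV-elim (λ v → φ S t v) (allV-elim (λ t → allV (φ S t))
            (allS-elim (λ S → allV λ t → allV (φ S t)) refl S) t) (vpart x)) (cong not t≢0)) two) (iX z₀))
          (allV-intro (λ u → S u ⇒ S (u +ᵥ vpart x)) λ u → imp λ Su →
            subst (λ z → X (el (u +ᵥ vpart x) z) ≡ true) (trans (cong (z₀ +ₚ_) z≡0) (+ₚ-zeroʳ z₀)) (sx (el u z₀) Su))
      where
      φ : (V → Bool) → V → V → Bool
      φ S t v = not (t == e₀) ⇒ pair S ⇒ inv t S ⇒ (allV λ u → S u ⇒ S (u +ᵥ v)) ⇒ line t v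
    isL-hull : ∀ x → isL t x ≡ (hull D x ∨ (isZero x ∨ class-of (el t 0ₚ) x))
    isL-hull x = bool-ext into outof
      where
      into : isL t x ≡ true → (hull D x ∨ (isZero x ∨ class-of (el t 0ₚ) x)) ≡ true
      into h with ppart x ≟F 0ₚ
      ... | yes z≡0 = ∨-introʳ (hull D x) (zero-or-t (∨-true h))
        where
        zero-or-t : (vpart x == e₀) ≡ true ⊎ (vpart x == t) ≡ true → (isZero x ∨ class-of (el t 0ₚ) x) ≡ true
        zero-or-t (inj₁ e) = ∨-introˡ _ (⌊≟⌋-true _≟_ (cong₂ el (==-≡ e) z≡0))
        zero-or-t (inj₂ e) = ∨-introʳ (isZero x) (≡ᵇ-true (cong c (cong₂ el (==-≡ e) z≡0)))
      ... | no z≢0 = ∨-introˡ _ (hull-intro D x (proj₁ r) (proj₁ (proj₂ r))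
            (trans (D-eq (μ (proj₁ r) x)) (true-∧ h (trans (cong (pair ∘ layer X) hw) two))))
        where
        2z≢0 : z₀ +ₚ z₀ ≢ 0ₚ
        2z≢0 e = z₀≢0 (double-injective (trans e (sym (+ₚ-identityˡ 0ₚ))))
        r : ∃ λ u → u ≢ 0ₚ × u *ₚ ppart x ≡ z₀ +ₚ z₀
        r = ratio 2z≢0 z≢0
        hw : halve (proj₁ r *ₚ ppart x) ≡ z₀
        hw = double-injective (trans (halve-+ _) (proj₂ (proj₂ r)))
      outof : (hull D x ∨ (isZero x ∨ class-of (el t 0ₚ) x)) ≡ true → isL t x ≡ true
      outof h with ∨-true {hull D x} h
      ... | inj₁ hD = let (u , _ , Du) = hull-elim D x hD in proj₁ (∧-true (trans (sym (D-eq (μ u x))) Du))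
      ... | inj₂ h' with ∨-true {isZero x} h'
      ... | inj₁ hz = cong (line t ∘ vpart) (⌊≟⌋-≡ _≟_ hz)
      ... | inj₂ ht = translation-on-line x (translate-cls cX (≡ᵇ-≡ ht) (inv-stable {X} t iX))

  record IsSub (K : M p → Bool) : Set where
    field
      has-0 : K 0ₘ ≡ true
      has-+ : ∀ x y → K x ≡ true → K y ≡ true → K (x + y) ≡ true

    has-· : ∀ k x → K x ≡ true → K (k · x) ≡ true
    has-· zero x Kx = has-0
    has-· (suc k) x Kx = has-+ x (k · x) Kx (has-· k x Kx)

  -- M has exponent 2 p, and 2 p - 1 = 2 n + 1. Hence a set containing 0 and closed under addition
  -- is closed under negation.
  neg-multiple : ∀ x → suc (2 ℕ.* n) · x ≡ - x
  neg-multiple x = cong₂ el (vpart-· n x) (trans (ppart-· (suc (2 ℕ.* n)) x) (begin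
      ⟦ m ⟧ *ₚ z                            ≡⟨ SolveP.abel SolveP.x₀ (SolveP._⊖_ (SolveP._⊕_ SolveP.x₁ SolveP.x₀) SolveP.x₁) refl (⟦ m ⟧ *ₚ z ∷ z ∷ []) ⟩
      z +ₚ ⟦ m ⟧ *ₚ z +ₚ (-ₚ z)             ≡⟨ cong (_+ₚ (-ₚ z)) vanish ⟩
      0ₚ +ₚ (-ₚ z)                          ≡⟨ +ₚ-identityˡ (-ₚ z) ⟩
      -ₚ z                                  ∎))
    where
    open ≡-Reasoning
    z = ppart x
    m = suc (2 ℕ.* n)
    vanish : z +ₚ ⟦ m ⟧ *ₚ z ≡ 0ₚ
    vanish = begin
      z +ₚ ⟦ m ⟧ *ₚ z              ≡⟨ cong (_+ₚ ⟦ m ⟧ *ₚ z) (*ₚ-identityˡ z) ⟨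
      1ₚ *ₚ z +ₚ ⟦ m ⟧ *ₚ z        ≡⟨ *ₚ-distribʳ z 1ₚ ⟦ m ⟧ ⟨
      (1ₚ +ₚ ⟦ m ⟧) *ₚ z           ≡⟨ cong (_*ₚ z) (⟦⟧-+ 1 m) ⟩
      ⟦ suc m ⟧ *ₚ z               ≡⟨ cong (_*ₚ z) (trans (cong ⟦_⟧ (sym (ℕ.*-suc 2 n))) (⟦⟧-cong {2 ℕ.* p} {0} (m*n%n≡0 2 p))) ⟩
      0ₚ *ₚ z                      ≡⟨ *-zeroˡ z ⟩
      0ₚ                           ∎

  sub-neg : ∀ {K} → IsSub K → ∀ x → K x ≡ true → K (- x) ≡ true
  sub-neg {K} sK x Kx = subst (λ y → K y ≡ true) (neg-multiple x) (IsSub.has-· sK (suc (2 ℕ.* n)) x Kx)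

  cosets : (M p → Bool) → BRel (M p)
  cosets K x y = K (y - x)

  cosets-InE : ∀ {K} → Cls K → IsSub K → SM.InE p col (cosets K)
  cosets-InE {K} cK sK = (λ x y x' y' e → cK _ _ (trans (sym (col-c x y)) (trans e (col-c x' y')))) , record
    { refl' = λ x → ≡⇒T (trans (cong K (abel (x₀ ⊖ x₀) 𝟘 refl (x ∷ []))) (IsSub.has-0 sK))
    ; sym' = λ x y h → ≡⇒T (trans (cong K (abel (x₀ ⊖ x₁) (⊝ (x₁ ⊖ x₀)) refl (x ∷ y ∷ []))) (sub-neg sK (y - x) (T⇒≡ h)))
    ; trans' = λ x y z h h' → ≡⇒T (trans (cong K (abel (x₂ ⊖ x₀) (x₁ ⊖ x₀ ⊕ (x₂ ⊖ x₁)) refl (x ∷ y ∷ z ∷ [])))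
        (IsSub.has-+ sK (y - x) (z - y) (T⇒≡ h) (T⇒≡ h'))) }
    where open SolveM

  module FromE (E : BRel (M p)) (inE : SM.InE p col E) where
    H : M p → Bool
    H = E 0ₘ

    E-H : ∀ x y → E x y ≡ H (y - x)
    E-H x y = proj₁ inE x y 0ₘ (y - x) (col-c x y)

    H-cls : Cls H
    H-cls x y e = proj₁ inE 0ₘ x 0ₘ y e

    H-sub : IsSub H
    H-sub = record
      { has-0 = T⇒≡ (refl' 0ₘ)
      ; has-+ = λ x y Hx Hy → T⇒≡ (trans' 0ₘ x (x + y) (≡⇒T Hx) (≡⇒T (trans (E-H x (x + y)) (trans (cong H (abel (x₀ ⊕ x₁ ⊖ x₀) x₁ refl (x ∷ y ∷ []))) Hy)))) }
      where
      open SM.IsEquiv p (proj₂ inE)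
      open SolveM

  Minimal : (M p → Bool) → Set
  Minimal H = ∀ K → Cls K → IsSub K → (∀ x → K x ≡ true → H x ≡ true) → (∃ λ x → x ≢ 0ₘ × K x ≡ true) →
              ∀ x → H x ≡ true → K x ≡ true

  minus-0 : ∀ y → y - 0ₘ ≡ y
  minus-0 y = SolveM.abel (SolveM._⊖_ SolveM.x₀ SolveM.𝟘) SolveM.x₀ refl (y ∷ [])

  E1-minimal : ∀ {E} → SM.InE p col E → SM.E1 p p col E → Minimal (E 0ₘ)
  E1-minimal {E} inE (_ , _ , min) K cK sK K⊆H (x , x≢0 , Kx) y Hy =
    trans (cong K (sym (minus-0 y))) (trans (min (cosets K) (cosets-InE cK sK) notDiag sub 0ₘ y) Hy)
    where
    notDiag : SM.NotDiag p (cosets K)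
    notDiag same = x≢0 (sym (⌊≟⌋-≡ _≟M_ (trans (sym (same 0ₘ x)) (trans (cong K (minus-0 x)) Kx))))
    sub : SM.Sub p (cosets K) E
    sub x y h = ≡⇒T (trans (FromE.E-H E inE x y) (K⊆H (y - x) (T⇒≡ h)))

  private
    stabilizes : (M p → Bool) → M p → Bool
    stabilizes U g = not (any (λ x → U x ∧ not (U (x + g))) elements)

    stabilizes-elim : ∀ U g → stabilizes U g ≡ true → Stable U g
    stabilizes-elim U g h x Ux with decide (U (x + g))
    ... | inj₁ e = e
    ... | inj₂ e = true≢false (true-any _ x (true-∧ Ux (cong not e))) (not-true h)

    stabilizes-intro : ∀ U g → Stable U g → stabilizes U g ≡ true
    stabilizes-intro U g s = cong not (≢true λ h → let (x , e) = any-true _ h ; (Ux , ne) = ∧-true {U x} e in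
      true≢false (s x Ux) (not-true ne))

  -- The elements of H stabilizing a union U of classes form a union of classes.
  minimal-stable : ∀ {H} → Cls H → IsSub H → Minimal H → ∀ {U} → Cls U →
    ∀ {t} → H t ≡ true → t ≢ 0ₘ → Stable U t → ∀ g → H g ≡ true → Stable U g
  minimal-stable {H} cH sH min {U} cU {t} Ht t≢0 st g Hg = stabilizes-elim U g (proj₂ (∧-true {H g}
      (min K cK sK (λ x → proj₁ ∘ ∧-true) (t , t≢0 , true-∧ Ht (stabilizes-intro U t st)) g Hg)))
    where
    K : M p → Bool
    K x = H x ∧ stabilizes U x
    cK : Cls K
    cK x y e = cong₂ _∧_ (cH x y e) (bool-ext (transfer x y e) (transfer y x (sym e)))
      where
      transfer : ∀ x y → c x ≡ c y → stabilizes U x ≡ true → stabilizes U y ≡ true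
      transfer x y e h = stabilizes-intro U y (translate-cls cU (sym e) (stabilizes-elim U x h))
    sK : IsSub K
    sK = record
      { has-0 = true-∧ (IsSub.has-0 sH) (stabilizes-intro U 0ₘ (λ x Ux → trans (cong U (+-zeroʳ x)) Ux))
      ; has-+ = λ x y Kx Ky → true-∧ (IsSub.has-+ sH x y (proj₁ (∧-true Kx)) (proj₁ (∧-true Ky)))
          (stabilizes-intro U (x + y) (stable-+ {U} (stabilizes-elim U x (proj₂ (∧-true {H x} Kx))) (stabilizes-elim U y (proj₂ (∧-true {H y} Ky))))) }

  vpart-multiple : ∀ {a} → vpart a ≡ e₀ → ∀ k → vpart (k · a) ≡ e₀
  vpart-multiple e zero = refl
  vpart-multiple e (suc k) = cong₂ _+ᵥ_ e (vpart-multiple e k)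

  self-inverseᵥ : ∀ v → v +ᵥ v ≡ e₀
  self-inverseᵥ (a , b) = cong₂ _,_ (self-inverse a) (self-inverse b)

  +ᵥ-zeroʳ : ∀ v → v +ᵥ e₀ ≡ v
  +ᵥ-zeroʳ v = cong vpart (+-zeroʳ (el v 0ₚ))

  -- Doubling x kills its V-part but not its P-part, and the multiples of x + x exhaust P.
  contains-P : ∀ {K} → IsSub K → ∀ {x} → K x ≡ true → ppart x ≢ 0ₚ → ∀ d → K (el e₀ d) ≡ true
  contains-P {K} sK {x} Kx x≢0 d =
    let (k , e) = multiple (x + x) (λ e → x≢0 (double-injective (trans e (sym (+ₚ-identityˡ 0ₚ))))) d in
    subst (λ y → K y ≡ true) (cong₂ el (vpart-multiple (self-inverseᵥ (vpart x)) k) e)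
      (IsSub.has-· sK k (x + x) (IsSub.has-+ sK x x Kx Kx))

  count-layers : ∀ X → SM.count p X ≡ Eₚ.∑ₑ (λ w → sumV (ι ∘ layer X w))
  count-layers X = trans (count-∑ₑ p X) (∑-layers (ι ∘ X))

  V-bound : ∀ X → (∀ x → X x ≡ true → ppart x ≡ 0ₚ) → SM.count p X ≤ 4
  V-bound X h = ℕ.≤-trans (ℕ.≤-reflexive (trans (count-layers X) (Eₚ.single _ 0ₚ off))) (at-most-4 (layer X 0ₚ))
    where
    off : ∀ w → w ≢ 0ₚ → sumV (ι ∘ layer X w) ≡ 0
    off w w≢0 = ∑-zero (allFin 2) λ a → ∑-zero (allFin 2) λ b → cong ι (≢true λ e → w≢0 (h (el (a , b) w) e))
    at-most-4 : ∀ S → sumV (ι ∘ S) ≤ 4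
    at-most-4 S = ℕ.≤ᵇ⇒≤ _ _ (≡⇒T (allS-elim (λ S → sumV (ι ∘ S) ℕ.≤ᵇ 4) refl S))

  P-bound : ∀ X → (∀ d → X (el e₀ d) ≡ true) → p ≤ SM.count p X
  P-bound X h = ℕ.≤-trans (ℕ.≤-reflexive (trans (sym (ℕ.*-identityʳ p)) (sym (∑ₚ-const 1))))
    (ℕ.≤-trans (∑-mono Eₚ.elements λ w → one (layer X w) (h w)) (ℕ.≤-reflexive (sym (count-layers X))))
    where
    one : ∀ S → S e₀ ≡ true → 1 ≤ sumV (ι ∘ S)
    one S S0 = ℕ.≤ᵇ⇒≤ _ _ (≡⇒T (mp (allS-elim (λ S → S e₀ ⇒ (1 ℕ.≤ᵇ sumV (ι ∘ S))) refl S) S0))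

  isP-sub : IsSub isP
  isP-sub = record { has-0 = refl ; has-+ = λ x y hx hy → subst (λ v → (v == e₀) ≡ true) (sym (cong₂ _+ᵥ_ (==-≡ hx) (==-≡ hy))) refl }

  count-cosets : ∀ {E} → SM.InE p col E → ∀ x → SM.count p (E x) ≡ SM.count p (E 0ₘ)
  count-cosets {E} inE x = trans (count-∑ₑ p (E x)) (trans (∑-cong elements λ y → cong ι (FromE.E-H E inE x y))
    (trans (∑-reindex (_- x) (_+ x) (λ y → abel (x₁ ⊕ x₀ ⊖ x₀) x₁ refl (x ∷ y ∷ [])) (λ y → abel (x₁ ⊖ x₀ ⊕ x₀) x₁ refl (x ∷ y ∷ []))
      (ι ∘ E 0ₘ)) (sym (count-∑ₑ p (E 0ₘ)))))
    where open SolveM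

  -- P has prime order, so every nontrivial subgroup of it is P. This is used contrapositively: when
  -- no relation satisfies (E1), P is not a union of classes.
  isP-E1 : Cls isP → SM.E1 p p col (cosets isP)
  isP-E1 cP = (λ x → ℕ.≤-trans (P-bound (cosets isP 0ₘ) (λ d → cong isP (minus-0 (el e₀ d))))
      (ℕ.≤-reflexive (sym (count-cosets (cosets-InE cP isP-sub) x)))) , notDiag , minimal
    where
    notDiag : SM.NotDiag p (cosets isP)
    notDiag same = 1≢0 (cong ppart (sym (⌊≟⌋-≡ _≟M_ (trans (sym (same 0ₘ (el e₀ 1ₚ))) (cong isP (minus-0 (el e₀ 1ₚ)))))))
    minimal : ∀ F → SM.InE p col F → SM.NotDiag p F → SM.Sub p F (cosets isP) → SM.SameRel p F (cosets isP)
    minimal F inF nd sub with search (λ x → F 0ₘ x ∧ not (isZero x))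
    ... | inj₂ none = ⊥-elim (nd λ x y → trans (FromE.E-H F inF x y) (bool-ext
          (λ h → ⌊≟⌋-true _≟M_ (sym (difference-zero x y (zero-only (y - x) h))))
          (λ h → trans (cong (λ z → F 0ₘ (y - z)) (⌊≟⌋-≡ _≟M_ h)) (trans (cong (F 0ₘ) (SolveM.abel (SolveM._⊖_ SolveM.x₀ SolveM.x₀) SolveM.𝟘 refl (y ∷ []))) (IsSub.has-0 (FromE.H-sub F inF))))))
      where
      zero-only : ∀ x → F 0ₘ x ≡ true → x ≡ 0ₘ
      zero-only x h with x ≟ 0ₘ | none x
      ... | yes e | _ = e
      ... | no ne | nx = true≢false (true-∧ h refl) nx
      difference-zero : ∀ x y → y - x ≡ 0ₘ → y ≡ x
      difference-zero x y e = trans (SolveM.abel SolveM.x₁ (SolveM._⊕_ (SolveM._⊖_ SolveM.x₁ SolveM.x₀) SolveM.x₀) refl (x ∷ y ∷ []))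
        (trans (cong (_+ x) e) (SolveM.abel (SolveM._⊕_ SolveM.𝟘 SolveM.x₀) SolveM.x₀ refl (x ∷ [])))
    ... | inj₁ (g , h) = λ x y → trans (FromE.E-H F inF x y) (bool-ext
          (λ Fz → in-P (y - x) Fz) (λ Pz → subst (λ v → F 0ₘ (el v (ppart (y - x))) ≡ true) (sym (==-≡ Pz)) (all-P (ppart (y - x)))))
      where
      in-P : ∀ z → F 0ₘ z ≡ true → isP z ≡ true
      in-P z Fz = trans (cong isP (sym (minus-0 z))) (T⇒≡ (sub 0ₘ z (≡⇒T Fz)))
      g≢0 : g ≢ 0ₘ
      g≢0 e = true≢false (⌊≟⌋-true _≟_ e) (not-true (proj₂ (∧-true {F 0ₘ g} h)))
      all-P : ∀ d → F 0ₘ (el e₀ d) ≡ true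
      all-P = contains-P (FromE.H-sub F inF) (proj₁ (∧-true h)) λ z≡0 → g≢0 (cong₂ el (==-≡ (in-P g (proj₁ (∧-true h)))) z≡0)

  -- Split along (0 , 1) = (0 , 1/2) + (0 , 1/2).
  halves : ∀ {X} → Cls X → (∀ x y → X x ≡ true → X y ≡ true → c x ≡ c y) → (∀ {w} → w ≢ 0ₚ → X (el e₀ w) ≡ true) →
           ∀ u → X (el u 0ₚ) ≡ true → ∃ λ y → X y ≡ true × X (el u 0ₚ - y) ≡ true
  halves {X} cX one-class X₀ u Xu =
    let (y , cy , cy') = split (one-class (el e₀ 1ₚ) (el u 0ₚ) (X₀ 1≢0) Xu) (el e₀ hf) in
    y , trans (cX y (el e₀ hf) cy) (X₀ hf≢0) , trans (cX _ _ cy') (trans (cong (λ w → X (el e₀ w)) (halve-fixed 1ₚ)) (X₀ hf≢0))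
    where
    hf = halve 1ₚ
    hf≢0 : hf ≢ 0ₚ
    hf≢0 e = 1≢0 (trans (sym (halve-+ 1ₚ)) (trans (cong₂ _+ₚ_ e e) (+ₚ-identityˡ 0ₚ)))

  0-y≢0 : ∀ {y} → y ≢ 0ₚ → 0ₚ +ₚ (-ₚ y) ≢ 0ₚ
  0-y≢0 {y} y≢0 e = y≢0 (trans (SolveP.abel SolveP.x₀ (SolveP.⊝_ (SolveP._⊖_ SolveP.𝟘 SolveP.x₀)) refl (y ∷ []))
    (trans (cong -ₚ_ e) (SolveP.abel (SolveP.⊝_ SolveP.𝟘) SolveP.𝟘 refl [])))

  -- X together with 0 is exactly the line times P.
  isL-cls : ∀ {X} → Cls X → ∀ t → (∀ {w} → w ≢ 0ₚ → ∀ v → X (el v w) ≡ line t v) →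
            (∀ u → X (el u 0ₚ) ≡ true → u ≡ t) → X (el t 0ₚ) ≡ true → Cls (isL t)
  isL-cls {X} cX t layers only-t Xt = cls-≗ {isL t} {λ x → isZero x ∨ X x} (λ x → by-layer x (ppart x ≟F 0ₚ))
      (λ x y e → cong₂ _∨_ (isZero-cls x y e) (cX x y e))
    where
    by-layer : ∀ x → Dec (ppart x ≡ 0ₚ) → isL t x ≡ (isZero x ∨ X x)
    by-layer x (no nz) = trans (sym (layers nz (vpart x))) (sym (cong (_∨ X x) (⌊≟⌋-false _≟_ λ e → nz (cong ppart e))))
    by-layer x (yes z≡0) = bool-ext (λ l → into (∨-true {vpart x == e₀} l)) (λ l → outof (∨-true {isZero x} l))
      where
      x-eq : ∀ {u} → vpart x ≡ u → x ≡ el u 0ₚ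
      x-eq e = cong₂ el e z≡0
      into : (vpart x == e₀) ≡ true ⊎ (vpart x == t) ≡ true → (isZero x ∨ X x) ≡ true
      into (inj₁ e) = ∨-introˡ (X x) (⌊≟⌋-true _≟_ (x-eq (==-≡ e)))
      into (inj₂ e) = ∨-introʳ (isZero x) (trans (cong X (x-eq (==-≡ e))) Xt)
      outof : isZero x ≡ true ⊎ X x ≡ true → isL t x ≡ true
      outof (inj₁ e) = cong (isL t) (⌊≟⌋-≡ _≟_ e)
      outof (inj₂ e) = ∨-introʳ (vpart x == e₀) (trans (cong (_== t) (only-t (vpart x) (trans (cong X (sym (x-eq refl))) e))) (==-refl t))

-- The quotient by E and the lifting of its automorphisms

module Quotients (n : ℕ) (pr : Prime (suc n)) (5≤p : 5 ≤ suc n)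
                 (col : Coloring (M (suc n))) (cay : IsCayleyM (suc n) col)
                 (E : BRel (M (suc n))) (inE : SM.InE (suc n) col E) where
  open Subgroups n pr 5≤p col cay public
  open FromE E inE public
  open Inverse using (to; from; strictlyInverseˡ; strictlyInverseʳ)

  private
    first : (M p → Bool) → List (M p) → Maybe (M p)
    first = SM.firstSat p

    Q : Set
    Q = SM.Quot p E

  E-refl : ∀ x → E x x ≡ true
  E-refl x = T⇒≡ (SM.IsEquiv.refl' {p} (proj₂ inE) x)
  E-sym : ∀ {x y} → E x y ≡ true → E y x ≡ true
  E-sym {x} {y} e = T⇒≡ (SM.IsEquiv.sym' {p} (proj₂ inE) x y (≡⇒T e))
  E-trans : ∀ {x y z} → E x y ≡ true → E y z ≡ true → E x z ≡ true
  E-trans {x} {y} {z} e e' = T⇒≡ (SM.IsEquiv.trans' {p} (proj₂ inE) x y z (≡⇒T e) (≡⇒T e'))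

  private
    first-sat : ∀ P xs {y} → first P xs ≡ just y → P y ≡ true
    first-sat P (x ∷ xs) e with P x in eq
    first-sat P (x ∷ xs) refl | true = eq
    ... | false = first-sat P xs e

    first-none : ∀ P xs → first P xs ≡ nothing → ∑ xs (ι ∘ P) ≡ 0
    first-none P [] e = refl
    first-none P (x ∷ xs) e with P x
    ... | false = first-none P xs e

    first-cong : ∀ {P P'} → (∀ x → P x ≡ P' x) → ∀ xs → first P xs ≡ first P' xs
    first-cong h [] = refl
    first-cong {P} {P'} h (x ∷ xs) with P x | P' x | h x
    ... | true | .true | refl = refl
    ... | false | .false | refl = first-cong h xs

    E-first : ∀ {x y} → E x y ≡ true → first (E x) (elsM p) ≡ first (E y) (elsM p)
    E-first e = first-cong (λ z → bool-ext (E-trans (E-sym e)) (E-trans e)) (elsM p)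

    first-exists : ∀ x → ∃ λ y → first (E x) (elsM p) ≡ just y
    first-exists x = go (first (E x) (elsM p)) refl
      where
      go : ∀ m → first (E x) (elsM p) ≡ m → ∃ λ y → first (E x) (elsM p) ≡ just y
      go (just y) e = y , e
      go nothing e = ⊥-elim (witness-∑ (E x) x (E-refl x)
        (trans (sym (trans (sym (count≡∑ (elsM p) (E x))) (count-∑ₑ p (E x)))) (first-none (E x) (elsM p) e)))

    is-rep : ∀ {x} → first (E x) (elsM p) ≡ just x → T (SM.isRep p E x)
    is-rep {x} e with SM.firstSat p (E x) (elsM p) | e
    ... | just .x | refl = ≡⇒T (⌊≟⌋-true _≟M_ refl)

    rep-first : ∀ x → T (SM.isRep p E x) → first (E x) (elsM p) ≡ just x
    rep-first x h with SM.firstSat p (E x) (elsM p)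
    ... | just y = cong just (⌊≟⌋-≡ _≟M_ (T⇒≡ h))

  Quot-≡ : ∀ {Λ Δ : Q} → proj₁ Λ ≡ proj₁ Δ → Λ ≡ Δ
  Quot-≡ {x , h} {.x , h'} refl = cong (x ,_) (T-irrelevant h h')

  E-rep : ∀ x → E x (proj₁ (first-exists x)) ≡ true
  E-rep x = first-sat (E x) (elsM p) (proj₂ (first-exists x))

  rep : M p → Q
  rep x = proj₁ (first-exists x) , is-rep (trans (sym (E-first (E-rep x))) (proj₂ (first-exists x)))

  rep-unique : ∀ {x} (Λ : Q) → E x (proj₁ Λ) ≡ true → rep x ≡ Λ
  rep-unique {x} Λ e = Quot-≡ (just-injective (trans (sym (proj₂ (first-exists x))) (trans (E-first e) (rep-first _ (proj₂ Λ)))))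

  qrel-elim : ∀ ab (Λ Δ : Q) → SM.qrel p col E ab Λ Δ ≡ true →
    ∃ λ x → ∃ λ y → E x (proj₁ Λ) ≡ true × E y (proj₁ Δ) ≡ true × col x y ≡ col (proj₁ ab) (proj₂ ab)
  qrel-elim ab Λ Δ h =
    let (x , hx) = any-elim _ h ; (y , hy) = any-elim _ hx
        (ex , h') = ∧-true {E x (proj₁ Λ)} hy ; (ey , e) = ∧-true {E y (proj₁ Δ)} h' in
    x , y , ex , ey , ≡ᵇ-≡ e
    where
    any-elim : ∀ P → SM.anyΩ p P ≡ true → ∃ λ x → P x ≡ true
    any-elim P h = any-true P (trans (cong (Data.Bool.ListAction.any P) (elem-enum-elements p)) h)
      where import Data.Bool.ListAction

  qrel-intro : ∀ ab (Λ Δ : Q) x y → E x (proj₁ Λ) ≡ true → E y (proj₁ Δ) ≡ true → col x y ≡ col (proj₁ ab) (proj₂ ab) →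
    SM.qrel p col E ab Λ Δ ≡ true
  qrel-intro ab Λ Δ x y ex ey e = any-intro _ x (any-intro _ y (true-∧ ex (true-∧ ey (≡ᵇ-true e))))
    where
    any-intro : ∀ P x → P x ≡ true → SM.anyΩ p P ≡ true
    any-intro P x h = trans (cong (Data.Bool.ListAction.any P) (sym (elem-enum-elements p))) (true-any P x h)
      where import Data.Bool.ListAction

  aut-col : ∀ {g} → SM.Aut p col g → ∀ x y → col (to g x) (to g y) ≡ col x y
  aut-col aut x y = ≡ᵇ-≡ (trans (aut (x , y) x y) (≡ᵇ-true {col x y} refl))

  module Induced (g : M p ↔ M p) (aut : SM.Aut p col g) where
    g-E : ∀ x y → E (to g x) (to g y) ≡ E x y
    g-E x y = proj₁ inE _ _ _ _ (aut-col {g} aut x y)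

    to-E : ∀ {x y} → E x y ≡ true → E (to g x) (to g y) ≡ true
    to-E e = trans (g-E _ _) e

    from-E : ∀ {x y} → E x y ≡ true → E (from g x) (from g y) ≡ true
    from-E {x} {y} e = trans (sym (g-E _ _)) (trans (cong₂ E (strictlyInverseˡ g x) (strictlyInverseˡ g y)) e)

    φ : Q ↔ Q
    φ = mk↔ₛ′ (λ Λ → rep (to g (proj₁ Λ))) (λ Λ → rep (from g (proj₁ Λ)))
      (λ Λ → rep-unique Λ (E-trans (to-E (E-sym (E-rep _))) (subst (λ z → E z (proj₁ Λ) ≡ true) (sym (strictlyInverseˡ g _)) (E-refl _))))
      (λ Λ → rep-unique Λ (E-trans (from-E (E-sym (E-rep _))) (subst (λ z → E z (proj₁ Λ) ≡ true) (sym (strictlyInverseʳ g _)) (E-refl _))))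

    φ-aut : AutFam (SM.qrel p col E) φ
    φ-aut ab Λ Δ = bool-ext forward backward
      where
      forward : SM.qrel p col E ab (to φ Λ) (to φ Δ) ≡ true → SM.qrel p col E ab Λ Δ ≡ true
      forward h = let (x , y , ex , ey , e) = qrel-elim ab (to φ Λ) (to φ Δ) h in
        qrel-intro ab Λ Δ (from g x) (from g y) (back Λ x ex) (back Δ y ey)
          (trans (sym (aut-col {g} aut _ _)) (trans (cong₂ col (strictlyInverseˡ g x) (strictlyInverseˡ g y)) e))
        where
        back : ∀ (Λ : Q) x → E x (proj₁ (to φ Λ)) ≡ true → E (from g x) (proj₁ Λ) ≡ true
        back Λ x ex = subst (λ z → E (from g x) z ≡ true) (strictlyInverseʳ g (proj₁ Λ)) (from-E (E-trans ex (E-sym (E-rep (to g (proj₁ Λ))))))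
      backward : SM.qrel p col E ab Λ Δ ≡ true → SM.qrel p col E ab (to φ Λ) (to φ Δ) ≡ true
      backward h = let (x , y , ex , ey , e) = qrel-elim ab Λ Δ h in
        qrel-intro ab (to φ Λ) (to φ Δ) (to g x) (to g y) (E-trans (to-E ex) (E-rep _)) (E-trans (to-E ey) (E-rep _)) (trans (aut-col {g} aut x y) e)

    induces : SM.Induces p E g φ
    induces Λ x e = ≡⇒T (E-trans (to-E (T⇒≡ e)) (E-rep _))

  -- π is the projection of M onto a complement of H along H: the fields `π-H` and `π-diff` say that
  -- its kernel is H. By `π-cls` the class of x determines the class of π x + k for every k in H.
  record Splitting : Set where
    field
      π : M p → M p
      π-+ : ∀ x y → π (x + y) ≡ π x + π y
      π-H : ∀ k → H k ≡ true → π k ≡ 0ₘ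
      π-diff : ∀ x → H (x - π x) ≡ true
      π-cls : ∀ x y → c x ≡ c y → ∀ k → H k ≡ true → c (π x + k) ≡ c (π y + k)

  module Lifting (s : Splitting) where
    open Splitting s
    open SolveM

    π-- : ∀ x y → π (x - y) ≡ π x - π y
    π-- x y = trans (abel x₀ (x₀ ⊕ x₁ ⊖ x₁) refl (π (x - y) ∷ π y ∷ []))
      (cong (_- π y) (trans (sym (π-+ (x - y) y)) (cong π (abel (x₀ ⊖ x₁ ⊕ x₁) x₀ refl (x ∷ y ∷ [])))))

    -≡0 : ∀ {x y} → x - y ≡ 0ₘ → x ≡ y
    -≡0 {x} {y} e = trans (abel x₀ (x₀ ⊖ x₁ ⊕ x₁) refl (x ∷ y ∷ [])) (trans (cong (_+ y) e) (abel (𝟘 ⊕ x₀) x₀ refl (y ∷ [])))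

    π-E : ∀ {x y} → E x y ≡ true → π x ≡ π y
    π-E {x} {y} e = sym (-≡0 (trans (sym (π-- y x)) (π-H (y - x) (trans (sym (E-H x y)) e))))

    π-π : ∀ x → π (π x) ≡ π x
    π-π x = sym (-≡0 (trans (sym (π-- x (π x))) (π-H _ (π-diff x))))

    hat : (Q → Q) → M p → M p
    hat f x = proj₁ (f (rep x))

    -- Moves the component in the complement as f prescribes and keeps the component in H.
    lift : (Q → Q) → M p → M p
    lift f x = π (hat f x) + (x - π x)

    π-lift : ∀ f x → π (lift f x) ≡ π (hat f x)
    π-lift f x = trans (π-+ _ _) (trans (cong₂ _+_ (π-π _) (π-H _ (π-diff x))) (+-zeroʳ _))

    lift-E : ∀ f x → E (lift f x) (hat f x) ≡ true
    lift-E f x = trans (E-H _ _) (subst (λ z → H z ≡ true)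
      (abel ((x₀ ⊖ x₁) ⊕ ⊝ (x₂ ⊖ x₃)) (x₀ ⊖ (x₁ ⊕ (x₂ ⊖ x₃))) refl (hat f x ∷ π (hat f x) ∷ x ∷ π x ∷ []))
      (IsSub.has-+ H-sub _ _ (π-diff (hat f x)) (sub-neg H-sub _ (π-diff x))))

    lift-inverse : ∀ f f' → (∀ Λ → f' (f Λ) ≡ Λ) → ∀ x → lift f' (lift f x) ≡ x
    lift-inverse f f' inv x = begin
      π (proj₁ (f' (rep (lift f x)))) + (lift f x - π (lift f x))
        ≡⟨ cong₂ (λ Λ z → π (proj₁ (f' Λ)) + (lift f x - z)) (rep-unique (f (rep x)) (lift-E f x)) (π-lift f x) ⟩
      π (proj₁ (f' (f (rep x)))) + (lift f x - π (hat f x))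
        ≡⟨ cong (λ Λ → π (proj₁ Λ) + (lift f x - π (hat f x))) (inv (rep x)) ⟩
      π (proj₁ (rep x)) + (lift f x - π (hat f x))
        ≡⟨ cong (_+ (lift f x - π (hat f x))) (sym (π-E (E-rep x))) ⟩
      π x + (π (hat f x) + (x - π x) - π (hat f x))
        ≡⟨ abel (x₁ ⊕ (x₂ ⊕ (x₀ ⊖ x₁) ⊖ x₂)) x₀ refl (x ∷ π x ∷ π (hat f x) ∷ []) ⟩
      x ∎
      where open ≡-Reasoning

    module _ (φ : Q ↔ Q) (aut : AutFam (SM.qrel p col E) φ) where
      g : M p ↔ M p
      g = mk↔ₛ′ (lift (to φ)) (lift (from φ)) (lift-inverse (from φ) (to φ) (strictlyInverseˡ φ)) (lift-inverse (to φ) (from φ) (strictlyInverseʳ φ))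

      g-induces : SM.Induces p E g φ
      g-induces Λ x e = ≡⇒T (subst (λ Δ → E (lift (to φ) x) (proj₁ (to φ Δ)) ≡ true) (rep-unique Λ (T⇒≡ e)) (lift-E (to φ) x))

      -- Since φ preserves the quotient relations, the images of the E-classes of x and y contain a
      -- pair x', y' of the same colour. By `π-cls` the component of y' - x' in H may be replaced by
      -- that of y - x.
      g-col : ∀ x y → col (lift (to φ) x) (lift (to φ) y) ≡ col x y
      g-col x y =
        let (x' , y' , ex , ey , e) = qrel-elim (x , y) (to φ (rep x)) (to φ (rep y))
              (trans (aut (x , y) (rep x) (rep y)) (qrel-intro (x , y) (rep x) (rep y) x y (E-rep x) (E-rep y) refl)) in
        begin
          col (lift (to φ) x) (lift (to φ) y)         ≡⟨ col-c _ _ ⟩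
          c (lift (to φ) y - lift (to φ) x)           ≡⟨ cong c (trans (abel (x₁ ⊕ (x₂ ⊖ x₃) ⊖ (x₀ ⊕ (x₄ ⊖ x₅))) ((x₁ ⊖ x₀) ⊕ (x₂ ⊖ x₄ ⊖ (x₃ ⊖ x₅))) refl
                                                           (π (hat (to φ) x) ∷ π (hat (to φ) y) ∷ y ∷ π y ∷ x ∷ π x ∷ []))
                                                           (cong₂ (λ a b → a + (y - x - b))
                                                              (trans (cong₂ _-_ (sym (π-E ey)) (sym (π-E ex))) (sym (π-- y' x'))) (sym (π-- y x)))) ⟩
          c (π (y' - x') + (y - x - π (y - x)))       ≡⟨ π-cls (y' - x') (y - x) (trans (sym (col-c x' y')) (trans e (col-c x y))) _ (π-diff (y - x)) ⟩
          c (π (y - x) + (y - x - π (y - x)))         ≡⟨ cong c (abel (x₀ ⊕ (x₁ ⊖ x₀)) x₁ refl (π (y - x) ∷ y - x ∷ [])) ⟩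
          c (y - x)                                   ≡⟨ col-c x y ⟨
          col x y                                     ∎
        where
        open ≡-Reasoning
        x₅ : ∀ {n} → Exp (6 ℕ.+ n)
        x₅ = var (suc (suc (suc (suc (suc zero)))))

      g-aut : SM.Aut p col g
      g-aut ab x y = cong (ℕ._≡ᵇ col (proj₁ ab) (proj₂ ab)) (g-col x y)

    quotAutEq : SM.QuotAutEq p col E
    quotAutEq = (λ g aut → Induced.φ g aut , Induced.φ-aut g aut , Induced.induces g aut) ,
                (λ φ aut → g φ aut , g-aut φ aut , g-induces φ aut)

-- Even subsets, lines and projections in V

module KleinFacts where
  open Klein

  disjoint : (V → Bool) → (V → Bool) → Bool
  disjoint S S' = allV λ v → S v ⇒ not (S' v)

  disjoint-intro : ∀ S S' → (∀ v → S v ≡ true → S' v ≡ true → ⊥) → disjoint S S' ≡ true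
  disjoint-intro S S' h = allV-intro (λ v → S v ⇒ not (S' v)) λ v → imp λ Sv → cong not (≢true (h v Sv))

  private
    V₁ : (φ : V → Bool) → allV φ ≡ true → ∀ v → φ v ≡ true
    V₁ = allV-elim
    V₂ : (φ : V → V → Bool) → allV (λ u → allV (φ u)) ≡ true → ∀ u v → φ u v ≡ true
    V₂ φ h u = V₁ (φ u) (V₁ (λ u → allV (φ u)) h u)
    V₃ : (φ : V → V → V → Bool) → allV (λ u → allV λ v → allV (φ u v)) ≡ true → ∀ u v w → φ u v w ≡ true
    V₃ φ h u = V₂ (φ u) (V₁ (λ u → allV λ v → allV (φ u v)) h u)
    V₄ : (φ : V → V → V → V → Bool) → allV (λ t → allV λ u → allV λ v → allV (φ t u v)) ≡ true → ∀ t u v w → φ t u v w ≡ true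
    V₄ φ h t = V₃ (φ t) (V₁ (λ t → allV λ u → allV λ v → allV (φ t u v)) h t)

  -- Says that S is a coset of the line of t, where t ≠ 0.
  Direction : (V → Bool) → V → Bool
  Direction S t = not (t == e₀) ∧ pair S ∧ inv t S

  direction-elim : ∀ {S t} → Direction S t ≡ true → (t == e₀) ≡ false × pair S ≡ true × inv t S ≡ true
  direction-elim {S} {t} h = let (a , r) = ∧-true {not (t == e₀)} h ; (b , d) = ∧-true {pair S} r in not-true a , b , d

  abstract
    -- Disjoint nonempty even subsets of V have two elements each, and a two-element set is a coset
    -- of the line of its difference.
    even-disjoint : ∀ S S' a b → odd S ≡ false → odd S' ≡ false → S a ≡ true → S' b ≡ true → disjoint S S' ≡ true →
                    ∃ λ t → Direction S t ≡ true
    even-disjoint S S' a b oS oS' Sa S'b d = anyV-elim (Direction S)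
      (mp (mp (mp (mp (mp (V₂ (φ S S') (allS-elim (λ S' → allV λ a → allV (φ (table S) S' a))
        (allS-elim (λ S → allS λ S' → allV λ a → allV (φ S S' a)) refl S) S') a b)
          (cong not oS)) (cong not oS')) Sa) S'b) d)
      where
      φ : (V → Bool) → (V → Bool) → V → V → Bool
      φ S S' a b = not (odd S) ⇒ not (odd S') ⇒ S a ⇒ S' b ⇒ disjoint S S' ⇒ anyV (Direction S)

  -- S' is empty or the other coset of the line.
  even-complement : ∀ S S' t → Direction S t ≡ true → odd S' ≡ false → disjoint S S' ≡ true → inv t S' ≡ true
  even-complement S S' t D oS' d = mp (mp (mp (V₁ (φ S S')
      (allS-elim (λ S' → allV (φ (table S) S')) (allS-elim (λ S → allS λ S' → allV (φ S S')) refl S) S') t) D) (cong not oS')) d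
    where
    φ : (V → Bool) → (V → Bool) → V → Bool
    φ S S' t = Direction S t ⇒ not (odd S') ⇒ disjoint S S' ⇒ inv t S'

  line-separates : ∀ S t a b → Direction S t ≡ true → S a ≡ true → S b ≡ false → (line t a ⇔ᵇ line t b) ≡ false
  line-separates S t a b D Sa Sb = not-true (mp (mp (mp (V₃ (φ S) (allS-elim (λ S → allV λ t → allV λ a → allV (φ S t a)) refl S) t a b) D) Sa) (cong not Sb))
    where
    φ : (V → Bool) → V → V → V → Bool
    φ S t a b = Direction S t ⇒ S a ⇒ not (S b) ⇒ not (line t a ⇔ᵇ line t b)

  outside : V → V → Bool
  outside h t = not (line h t)

  translate : V → (V → Bool) → V → Bool
  translate h S v = S (v +ᵥ h)

  abstract
    -- S has exactly two elements, and their difference t is not h, as S + h would otherwise be S.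
    disjoint-translate : ∀ S h a → odd S ≡ false → S a ≡ true → disjoint S (translate h S) ≡ true →
                         ∃ λ t → Direction S t ≡ true × outside h t ≡ true
    disjoint-translate S h a oS Sa d = let (t , e) = anyV-elim (λ t → Direction S t ∧ outside h t) found in t , ∧-true e
      where
      φ : (V → Bool) → V → V → Bool
      φ S h a = not (odd S) ⇒ S a ⇒ disjoint S (translate h S) ⇒ anyV (λ t → Direction S t ∧ outside h t)
      found : anyV (λ t → Direction S t ∧ outside h t) ≡ true
      found = mp (mp (mp (V₂ (φ S) (allS-elim (λ S → allV λ h → allV (φ S h)) refl S) h a) (cong not oS)) Sa) d

  covers : ∀ S h v a → odd S ≡ false → S a ≡ true → disjoint S (translate h S) ≡ true → S v ∨ S (v +ᵥ h) ≡ true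
  covers S h v a oS Sa d = mp (mp (mp (V₃ (φ S) (allS-elim (λ S → allV λ h → allV λ v → allV (φ S h v)) refl S) h v a) (cong not oS)) Sa) d
    where
    φ : (V → Bool) → V → V → V → Bool
    φ S h v a = not (odd S) ⇒ S a ⇒ disjoint S (translate h S) ⇒ S v ∨ S (v +ᵥ h)

  inv-translate : ∀ S t h → inv t S ≡ true → inv t (translate h S) ≡ true
  inv-translate S t h i = mp (V₂ (φ S) (allS-elim (λ S → allV λ t → allV (φ S t)) refl S) t h) i
    where
    φ : (V → Bool) → V → V → Bool
    φ S t h = inv t S ⇒ inv t (translate h S)

  direction-line : ∀ S t v → Direction S t ≡ true → S e₀ ≡ true → S v ≡ line t v
  direction-line S t v D S0 = ⇔ᵇ-≡ (mp (mp (V₂ (φ S) (allS-elim (λ S → allV λ t → allV (φ S t)) refl S) t v) D) S0)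
    where
    φ : (V → Bool) → V → V → Bool
    φ S t v = Direction S t ⇒ S e₀ ⇒ (S v ⇔ᵇ line t v)

  line-+ : ∀ t u v → line t (u +ᵥ v) ≡ true → line t v ≡ true → line t u ≡ true
  line-+ t u v a b = mp (mp (V₃ (λ t u v → line t (u +ᵥ v) ⇒ line t v ⇒ line t u) refl t u v) a) b

  cosets-of-line : ∀ h u v → (h == e₀) ≡ false → outside h u ≡ true → outside h v ≡ true → outside h (u +ᵥ v) ≡ true → ⊥
  cosets-of-line h u v h≢0 a b d = true≢false d (cong not (mp (mp (mp
    (V₃ (λ h u v → not (h == e₀) ⇒ outside h u ⇒ outside h v ⇒ line h (u +ᵥ v)) refl h u v) (cong not h≢0)) a) b))

  -- For t off the line of h, the projection of V onto the line of t along the line of h.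
  project : V → V → V → V
  project h t v = if line h v then e₀ else t
    where open import Data.Bool using (if_then_else_)

  project-+ : ∀ h t u v → (h == e₀) ≡ false → outside h t ≡ true → project h t (u +ᵥ v) ≡ project h t u +ᵥ project h t v
  project-+ h t u v h≢0 o = ==-≡ (mp (mp (V₄ (λ h t u v → not (h == e₀) ⇒ outside h t ⇒ (project h t (u +ᵥ v) == (project h t u +ᵥ project h t v)))
    refl h t u v) (cong not h≢0)) o)

  project-diff : ∀ h t v → (h == e₀) ≡ false → outside h t ≡ true → line h (v +ᵥ project h t v) ≡ true
  project-diff h t v h≢0 o = mp (mp (V₃ (λ h t v → not (h == e₀) ⇒ outside h t ⇒ line h (v +ᵥ project h t v)) refl h t v) (cong not h≢0)) o

  project-shift : ∀ h t v → (h == e₀) ≡ false → outside h t ≡ true → (project h t v == v) ∨ (project h t v == (v +ᵥ h)) ≡ true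
  project-shift h t v h≢0 o = mp (mp (V₃ (λ h t v → not (h == e₀) ⇒ outside h t ⇒ (project h t v == v) ∨ (project h t v == (v +ᵥ h)))
    refl h t v) (cong not h≢0)) o

  project-line : ∀ h t v → (h == e₀) ≡ false → outside h t ≡ true → line t v ≡ true → project h t v ≡ v
  project-line h t v h≢0 o l = ==-≡ (mp (mp (mp (V₃ (λ h t v → not (h == e₀) ⇒ outside h t ⇒ line t v ⇒ (project h t v == v)) refl h t v) (cong not h≢0)) o) l)

  project-off-line : ∀ h t v → (h == e₀) ≡ false → outside h t ≡ true → line t v ≡ false → project h t v ≡ v +ᵥ h
  project-off-line h t v h≢0 o l = ==-≡ (mp (mp (mp
    (V₃ (λ h t v → not (h == e₀) ⇒ outside h t ⇒ not (line t v) ⇒ (project h t v == (v +ᵥ h))) refl h t v) (cong not h≢0)) o) (cong not l))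

  abstract
    exists-outside : ∀ h → ∃ λ t → outside h t ≡ true
    exists-outside h = anyV-elim (outside h) (V₁ (λ h → anyV (outside h)) refl h)

  +ᵥ-cancel : ∀ u v → (u +ᵥ v) +ᵥ v ≡ u
  +ᵥ-cancel u v = ==-≡ (V₂ (λ u v → ((u +ᵥ v) +ᵥ v) == u) refl u v)

  +ᵥ-comm : ∀ u v → u +ᵥ v ≡ v +ᵥ u
  +ᵥ-comm u v = ==-≡ (V₂ (λ u v → (u +ᵥ v) == (v +ᵥ u)) refl u v)

  inv-empty : ∀ S t → (∀ v → S v ≡ false) → inv t S ≡ true
  inv-empty S t h = allV-intro (λ u → S u ⇔ᵇ S (u +ᵥ t)) λ u → ≡-⇔ᵇ (trans (h u) (sym (h (u +ᵥ t))))

  inv-cong : ∀ {S S'} t → (∀ v → S' v ≡ S v) → inv t S ≡ true → inv t S' ≡ true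
  inv-cong {S} {S'} t h i = allV-intro (λ u → S' u ⇔ᵇ S' (u +ᵥ t)) λ u →
    ≡-⇔ᵇ (trans (h u) (trans (⇔ᵇ-≡ (V₁ (λ u → S u ⇔ᵇ S (u +ᵥ t)) i u)) (sym (h (u +ᵥ t)))))

  abstract
    even-invariant : ∀ S a → odd S ≡ false → S a ≡ true → ∃ λ t → (t == e₀) ≡ false × inv t S ≡ true
    even-invariant S a oS Sa = let (t , e) = anyV-elim (λ t → not (t == e₀) ∧ inv t S)
                                     (mp (mp (V₁ (φ S) (allS-elim (λ S → allV (φ S)) refl S) a) (cong not oS)) Sa) in
        t , not-true (proj₁ (∧-true e)) , proj₂ (∧-true {not (t == e₀)} e)
      where
      φ : (V → Bool) → V → Bool
      φ S a = not (odd S) ⇒ S a ⇒ anyV (λ t → not (t == e₀) ∧ inv t S)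

    -- Every subset of V of even size is invariant under some nonzero element; if S has one or three
    -- elements, adding 0 makes its size even.
    punctured-invariant : ∀ S → S e₀ ≡ false →
      ∃ λ t → (t == e₀) ≡ false × (inv t S ≡ true ⊎ inv t (λ v → (v == e₀) ∨ S v) ≡ true)
    punctured-invariant S S0 = let (t , e) = anyV-elim (λ t → not (t == e₀) ∧ (inv t S ∨ inv t (λ v → (v == e₀) ∨ S v)))
                                     (mp (allS-elim φ refl S) (cong not S0)) in
        t , not-true (proj₁ (∧-true e)) , ∨-true (proj₂ (∧-true {not (t == e₀)} e))
      where
      φ : (V → Bool) → Bool
      φ S = not (S e₀) ⇒ anyV (λ t → not (t == e₀) ∧ (inv t S ∨ inv t (λ v → (v == e₀) ∨ S v)))

    even-containing-0 : ∀ S → odd S ≡ false → S e₀ ≡ true →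
      (∀ v → S v ≡ true) ⊎ ∃ λ t → (t == e₀) ≡ false × (∀ v → S v ≡ line t v)
    even-containing-0 S oS S0 = classify (∨-true (mp (mp (allS-elim φ refl S) (cong not oS)) S0))
      where
      φ : (V → Bool) → Bool
      φ S = not (odd S) ⇒ S e₀ ⇒ allV S ∨ anyV (λ t → not (t == e₀) ∧ (allV λ v → S v ⇔ᵇ line t v))
      classify : allV S ≡ true ⊎ anyV (λ t → not (t == e₀) ∧ (allV λ v → S v ⇔ᵇ line t v)) ≡ true →
        (∀ v → S v ≡ true) ⊎ ∃ λ t → (t == e₀) ≡ false × (∀ v → S v ≡ line t v)
      classify (inj₁ a) = inj₁ (allV-elim S a)
      classify (inj₂ a) = let (t , e) = anyV-elim (λ t → not (t == e₀) ∧ (allV λ v → S v ⇔ᵇ line t v)) a in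
        inj₂ (t , not-true (proj₁ (∧-true e)) , λ v → ⇔ᵇ-≡ (allV-elim (λ v → S v ⇔ᵇ line t v) (proj₂ (∧-true {not (t == e₀)} e)) v))

  three-elements : ∀ S u v w → S e₀ ≡ false → S u ≡ true → S v ≡ true → S (u +ᵥ v) ≡ true → (w == e₀) ≡ false → S w ≡ true
  three-elements S u v w S0 Su Sv Suv w≢0 = mp (mp (mp (mp (mp
      (V₃ (φ S) (allS-elim (λ S → allV λ u → allV λ v → allV (φ S u v)) refl S) u v w) (cong not S0)) Su) Sv) Suv) (cong not w≢0)
    where
    φ : (V → Bool) → V → V → V → Bool
    φ S u v w = not (S e₀) ⇒ S u ⇒ S v ⇒ S (u +ᵥ v) ⇒ not (w == e₀) ⇒ S w

  even-off-line : ∀ S t → odd S ≡ false → disjoint S (line t) ≡ true → inv t S ≡ true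
  even-off-line S t oS d = mp (mp (V₁ (φ S) (allS-elim (λ S → allV (φ S)) refl S) t) (cong not oS)) d
    where
    φ : (V → Bool) → V → Bool
    φ S t = not (odd S) ⇒ disjoint S (line t) ⇒ inv t S

  even-on-line : ∀ S t → odd S ≡ false → disjoint S (outside t) ≡ true → inv t S ≡ true
  even-on-line S t oS d = mp (mp (V₁ (φ S) (allS-elim (λ S → allV (φ S)) refl S) t) (cong not oS)) d
    where
    φ : (V → Bool) → V → Bool
    φ S t = not (odd S) ⇒ disjoint S (outside t) ⇒ inv t S

  same-coset : ∀ t u v → (t == e₀) ≡ false → outside t u ≡ true → outside t v ≡ true → u ≡ v ⊎ u ≡ v +ᵥ t
  same-coset t u v t≢0 a b = classify (∨-true (mp (mp (mp
      (V₃ (λ t u v → not (t == e₀) ⇒ outside t u ⇒ outside t v ⇒ (u == v) ∨ (u == (v +ᵥ t))) refl t u v) (cong not t≢0)) a) b))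
    where
    classify : (u == v) ≡ true ⊎ (u == (v +ᵥ t)) ≡ true → u ≡ v ⊎ u ≡ v +ᵥ t
    classify (inj₁ e) = inj₁ (==-≡ e)
    classify (inj₂ e) = inj₂ (==-≡ e)

  line-coset : ∀ t u v → (t == e₀) ≡ false → outside t v ≡ true → line t (u +ᵥ v) ≡ not (line t u)
  line-coset t u v t≢0 o = ⇔ᵇ-≡ (mp (mp (V₃ (λ t u v → not (t == e₀) ⇒ outside t v ⇒ (line t (u +ᵥ v) ⇔ᵇ not (line t u))) refl t u v) (cong not t≢0)) o)

  line-translate : ∀ t u v → line t v ≡ true → line t (u +ᵥ v) ≡ line t u
  line-translate t u v o = ⇔ᵇ-≡ (mp (V₃ (λ t u v → line t v ⇒ (line t (u +ᵥ v) ⇔ᵇ line t u)) refl t u v) o)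

-- H inside V: the cases H = 0 and H = V

module SmallClasses (n : ℕ) (pr : Prime (suc n)) (5≤p : 5 ≤ suc n)
                    (col : Coloring (M (suc n))) (cay : IsCayleyM (suc n) col)
                    (E : BRel (M (suc n))) (inE : SM.InE (suc n) col E) where
  open Quotients n pr 5≤p col cay E inE public
  open KleinFacts
  open SolveM

  scale : ∀ {w w'} → w ≢ 0ₚ → w' ≢ 0ₚ → ∀ u v → c (el u w) ≡ c (el v w) → c (el u w') ≡ c (el v w')
  scale w≢0 w'≢0 u v e = let (r , r≢0 , rw) = ratio w'≢0 w≢0 in
    subst (λ z → c (el u z) ≡ c (el v z)) rw (multiplier r r≢0 _ _ e)

  S₀ : V → Bool
  S₀ v = H (el v 0ₚ)

  module _ (notP : ¬ Cls isP) (H⊆V : ∀ x → H x ≡ true → ppart x ≡ 0ₚ) where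
    in-V : ∀ {x} → H x ≡ true → x ≡ el (vpart x) 0ₚ
    in-V h = cong (el _) (H⊆V _ h)

    H-S₀ : ∀ {x} → H x ≡ true → S₀ (vpart x) ≡ true
    H-S₀ {x} h = trans (cong H (sym (in-V h))) h

    H-from : ∀ x → ppart x ≡ 0ₚ → S₀ (vpart x) ≡ true → H x ≡ true
    H-from x e h = trans (cong (λ z → H (el (vpart x) z)) e) h

    split-trivial : (∀ v → S₀ v ≡ (v == e₀)) → Splitting
    split-trivial h = record
      { π = id
      ; π-+ = λ _ _ → refl
      ; π-H = zero-only
      ; π-diff = λ x → trans (cong H (abel (x₀ ⊖ x₀) 𝟘 refl (x ∷ []))) (IsSub.has-0 H-sub)
      ; π-cls = λ x y e k Hk → trans (cong c (trans (cong (x +_) (zero-only k Hk)) (+-zeroʳ x)))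
          (trans e (sym (cong c (trans (cong (y +_) (zero-only k Hk)) (+-zeroʳ y))))) }
      where
      zero-only : ∀ k → H k ≡ true → k ≡ 0ₘ
      zero-only k Hk = cong₂ el (==-≡ (trans (sym (h (vpart k))) (H-S₀ Hk))) (H⊆V k Hk)

    module _ (full : ∀ v → S₀ v ≡ true) where
      private
        outside-V : ∀ {z} → z ≢ 0ₚ → ∀ h v → class-of (el h z) (el v 0ₚ) ≡ false
        outside-V z≢0 h v = ≢true λ e → z≢0 (H⊆V _ (trans (sym (H-cls _ _ (≡ᵇ-≡ e))) (full v)))

      -- If the class X of (h , z) missed (h , z'), its layers at z and z' would be disjoint,
      -- nonempty and even, hence cosets of one line. All layers would be invariant under that line,
      -- so the line times P would be a union of classes; but it separates h from h'.
      same-layer-pattern : ∀ {z z'} → z ≢ 0ₚ → z' ≢ 0ₚ → ∀ h h' → c (el h z) ≡ c (el h' z') → c (el h z) ≡ c (el h z')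
      same-layer-pattern {z} {z'} z≢0 z'≢0 h h' e = by-cases (decide (class-of (el h z) (el h z')))
        where
        X : M p → Bool
        X = class-of (el h z)
        cX : Cls X
        cX = class-of-cls (el h z)
        S : V → Bool
        S = layer X z
        Sh : S h ≡ true
        Sh = ≡ᵇ-true {c (el h z)} refl
        Th' : layer X z' h' ≡ true
        Th' = ≡ᵇ-true (sym e)
        -- Off V, whether two V-parts give the same class does not depend on the P-part (`scale`);
        -- so a common element of the two layers would put (h , w) into X.
        disj : ∀ w → w ≢ 0ₚ → X (el h w) ≡ false → ∀ v → S v ≡ true → layer X w v ≡ true → ⊥
        disj w w≢0 Xhw v Sv Tv = true≢false (≡ᵇ-true (trans (sym (scale z≢0 w≢0 v h (≡ᵇ-≡ Sv))) (≡ᵇ-≡ Tv))) Xhw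
        module Clash (no′ : X (el h z') ≡ false) where
          found : ∃ λ t → Direction S t ≡ true
          found = even-disjoint S (layer X z') h h' (even-layers notP {X} cX {z} z≢0) (even-layers notP {X} cX {z'} z'≢0) Sh Th'
                    (disjoint-intro S (layer X z') (disj z' z'≢0 no′))
          t : V
          t = proj₁ found
          D : Direction S t ≡ true
          D = proj₂ found
          D′ : (t == e₀) ≡ false × pair S ≡ true × inv t S ≡ true
          D′ = direction-elim {S} {t} D
          invariant-class : ∀ {w} → w ≢ 0ₚ → X (el h w) ≡ true ⊎ X (el h w) ≡ false → inv t (layer X w) ≡ true
          invariant-class {w} w≢0 (inj₁ Xhw) = inv-cong {S} {layer X w} t same (proj₂ (proj₂ D′))
            where
            same : ∀ v → layer X w v ≡ S v
            same v = bool-ext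
              (λ Tv → ≡ᵇ-true {c (el v z)} {c (el h z)} (scale w≢0 z≢0 v h (trans (≡ᵇ-≡ {c (el v w)} {c (el h z)} Tv) (sym (≡ᵇ-≡ {c (el h w)} {c (el h z)} Xhw)))))
              (λ Sv → ≡ᵇ-true {c (el v w)} {c (el h z)} (trans (scale z≢0 w≢0 v h (≡ᵇ-≡ {c (el v z)} {c (el h z)} Sv)) (≡ᵇ-≡ {c (el h w)} {c (el h z)} Xhw)))
          invariant-class {w} w≢0 (inj₂ Xhw) =
            even-complement S (layer X w) t D (even-layers notP {X} cX {w} w≢0) (disjoint-intro S (layer X w) (disj w w≢0 Xhw))
          invariant : ∀ w → inv t (layer X w) ≡ true
          invariant w = by-layer (w ≟F 0ₚ)
            where
            by-layer : Dec (w ≡ 0ₚ) → inv t (layer X w) ≡ true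
            by-layer (yes w≡0) = inv-empty (layer X w) t (λ v → trans (cong (λ w → X (el v w)) w≡0) (outside-V z≢0 h v))
            by-layer (no w≢0) = invariant-class w≢0 (decide (X (el h w)))
          lines-agree : Cls (isL t)
          lines-agree = line-cls {X} cX (outside-V z≢0 h) t (proj₁ D′) invariant z (proj₁ (proj₂ D′))
          clash : ⊥
          clash = true≢false (≡-⇔ᵇ {line t h} {line t h'} (lines-agree (el h z) (el h' z') e))
              (line-separates S t h h' D Sh (≢true λ Sh' → disj z' z'≢0 no′ h' Sh' Th'))
        by-cases : class-of (el h z) (el h z') ≡ true ⊎ class-of (el h z) (el h z') ≡ false → c (el h z) ≡ c (el h z')
        by-cases (inj₁ yes′) = sym (≡ᵇ-≡ yes′)
        by-cases (inj₂ no′) = ⊥-elim (Clash.clash no′)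

      split-full : Splitting
      split-full = record
        { π = λ x → el e₀ (ppart x)
        ; π-+ = λ _ _ → refl
        ; π-H = λ k Hk → cong (el e₀) (H⊆V k Hk)
        ; π-diff = λ x → H-from _ (-ₚ-inverseʳ (ppart x)) (full _)
        ; π-cls = λ x y e k Hk → subst₂ (λ a b → c a ≡ c b) (recombine x k Hk) (recombine y k Hk) (levels x y e (vpart k)) }
        where
        recombine : ∀ x k → H k ≡ true → el (vpart k) (ppart x) ≡ el e₀ (ppart x) + k
        recombine x k Hk = sym (trans (cong (el e₀ (ppart x) +_) (in-V Hk)) (cong₂ el (trans (+ᵥ-comm e₀ (vpart k)) (+ᵥ-zeroʳ (vpart k))) (+ₚ-zeroʳ (ppart x))))
        levels : ∀ x y → c x ≡ c y → ∀ v → c (el v (ppart x)) ≡ c (el v (ppart y))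
        levels x y e v with ppart x ≟F 0ₚ | ppart y ≟F 0ₚ
        ... | yes ex | yes ey = cong (c ∘ el v) (trans ex (sym ey))
        ... | yes ex | no ny = ⊥-elim (ny (H⊆V y (trans (sym (H-cls x y e)) (H-from x ex (full _)))))
        ... | no nx | yes ey = ⊥-elim (nx (H⊆V x (trans (H-cls x y e) (H-from y ey (full _)))))
        -- Write x as (v , z) plus an element of V. The matching decomposition of y also has its
        -- second summand in V, as V is a union of classes, so its first summand has the P-part of
        -- y.
        ... | no nx | no ny = let (a , ca , cb) = split e (el v (ppart x)) in
          trans (same-layer-pattern nx (λ z → ny (trans (y-level a cb) z)) v (vpart a) (sym ca))
            (cong (c ∘ el v) (sym (y-level a cb)))
          where
          y-level : ∀ a → c (y - a) ≡ c (x - el v (ppart x)) → ppart y ≡ ppart a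
          y-level a cb = trans (SolveP.abel SolveP.x₀ (SolveP._⊕_ (SolveP._⊖_ SolveP.x₀ SolveP.x₁) SolveP.x₁) refl (ppart y ∷ ppart a ∷ []))
            (trans (cong (_+ₚ ppart a) (H⊆V _ (trans (H-cls _ _ cb) (H-from _ (-ₚ-inverseʳ (ppart x)) (full _))))) (+ₚ-identityˡ (ppart a)))

-- H a line of V

module LineCase (n : ℕ) (pr : Prime (suc n)) (5≤p : 5 ≤ suc n)
                (col : Coloring (M (suc n))) (cay : IsCayleyM (suc n) col)
                (E : BRel (M (suc n))) (inE : SM.InE (suc n) col E) where
  open SmallClasses n pr 5≤p col cay E inE public
  open KleinFacts
  open SolveM

  module _ (notP : ¬ Cls isP) (H⊆V : ∀ x → H x ≡ true → ppart x ≡ 0ₚ)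
           (h : V) (h≢0 : (h == e₀) ≡ false) (S₀-line : ∀ v → S₀ v ≡ line h v) where
    b : M p
    b = el h 0ₚ

    +b : ∀ x → x + b ≡ el (vpart x +ᵥ h) (ppart x)
    +b x = cong (el (vpart x +ᵥ h)) (+ₚ-zeroʳ (ppart x))

    b-neg : - b ≡ b
    b-neg = cong (el h) (SolveP.abel (SolveP.⊝_ SolveP.𝟘) SolveP.𝟘 refl [])

    e₀-or-h : ∀ v → line h v ≡ true → v ≡ e₀ ⊎ v ≡ h
    e₀-or-h v l = classify (∨-true {v == e₀} l)
      where
      classify : (v == e₀) ≡ true ⊎ (v == h) ≡ true → v ≡ e₀ ⊎ v ≡ h
      classify (inj₁ e) = inj₁ (==-≡ e)
      classify (inj₂ e) = inj₂ (==-≡ e)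

    H-elements : ∀ k → H k ≡ true → k ≡ 0ₘ ⊎ k ≡ b
    H-elements k Hk = classify (e₀-or-h (vpart k) (trans (sym (S₀-line (vpart k))) (H-S₀ notP H⊆V Hk)))
      where
      classify : vpart k ≡ e₀ ⊎ vpart k ≡ h → k ≡ 0ₘ ⊎ k ≡ b
      classify (inj₁ e) = inj₁ (cong₂ el e (H⊆V k Hk))
      classify (inj₂ e) = inj₂ (cong₂ el e (H⊆V k Hk))

    Hb : H b ≡ true
    Hb = trans (S₀-line h) (∨-introʳ (h == e₀) (==-refl h))

    b-class : ∀ g → c g ≡ c b → g ≡ b
    b-class g e = classify (H-elements g (trans (H-cls g b e) Hb))
      where
      classify : g ≡ 0ₘ ⊎ g ≡ b → g ≡ b
      classify (inj₁ refl) = ⊥-elim (nonzero-t {h} h≢0 (c-zero b (sym e)))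
      classify (inj₂ e) = e

    -- As b is alone in its class, transporting x = b + (x - b) to y uses the same summand b;
    -- moreover - b = b.
    shift : ∀ x y → c x ≡ c y → c (x + b) ≡ c (y + b)
    shift x y e = let (a , ca , cb) = split e b in sym (subst₂ (λ u v → c (y + u) ≡ c (x + v))
      (trans (cong -_ (b-class a ca)) b-neg) b-neg cb)

    unshift : ∀ x → (x + b) + b ≡ x
    unshift x = trans (cong ((x + b) +_) (sym b-neg)) (abel (x₀ ⊕ x₁ ⊖ x₁) x₀ refl (x ∷ b ∷ []))

    module _ (t : V) (out : outside h t ≡ true) where
      proj : M p → M p
      proj x = el (project h t (vpart x)) (ppart x)

      line-splitting : (∀ x y → c x ≡ c y → c (proj x) ≡ c (proj y)) → Splitting
      line-splitting proj-cls = record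
        { π = proj
        ; π-+ = λ x y → cong (λ v → el v (ppart x +ₚ ppart y)) (project-+ h t (vpart x) (vpart y) h≢0 out)
        ; π-H = λ k Hk → cong₂ el (kills (vpart k) (trans (sym (S₀-line (vpart k))) (H-S₀ notP H⊆V Hk))) (H⊆V k Hk)
        ; π-diff = λ x → H-from notP H⊆V (x - proj x) (-ₚ-inverseʳ (ppart x)) (trans (S₀-line _) (project-diff h t (vpart x) h≢0 out))
        ; π-cls = λ x y e k Hk → add x y (proj-cls x y e) k (H-elements k Hk) }
        where
        kills : ∀ v → line h v ≡ true → project h t v ≡ e₀
        kills v l rewrite l = refl
        add : ∀ x y → c (proj x) ≡ c (proj y) → ∀ k → k ≡ 0ₘ ⊎ k ≡ b → c (proj x + k) ≡ c (proj y + k)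
        add x y e k (inj₁ refl) = trans (cong c (+-zeroʳ (proj x))) (trans e (cong c (sym (+-zeroʳ (proj y)))))
        add x y e k (inj₂ refl) = shift (proj x) (proj y) e

      proj-shift : ∀ x → proj x ≡ x ⊎ proj x ≡ x + b
      proj-shift x = classify (∨-true {project h t (vpart x) == vpart x} (project-shift h t (vpart x) h≢0 out))
        where
        classify : (project h t (vpart x) == vpart x) ≡ true ⊎ (project h t (vpart x) == (vpart x +ᵥ h)) ≡ true → proj x ≡ x ⊎ proj x ≡ x + b
        classify (inj₁ e) = inj₁ (cong (λ v → el v (ppart x)) (==-≡ e))
        classify (inj₂ e) = inj₂ (trans (cong (λ v → el v (ppart x)) (==-≡ e)) (sym (+b x)))

      -- Off V the projection changes x by an element that does not affect its class; on V it only
      -- depends on whether x lies in H.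
      splitting-stable : (∀ x → ppart x ≢ 0ₚ → c (x + b) ≡ c x) → Splitting
      splitting-stable fixed = line-splitting λ x y e → cases x y e (ppart x ≟F 0ₚ) (ppart y ≟F 0ₚ)
        where
        stay : ∀ x → c (x + b) ≡ c x → c (proj x) ≡ c x
        stay x e = classify (proj-shift x)
          where
          classify : proj x ≡ x ⊎ proj x ≡ x + b → c (proj x) ≡ c x
          classify (inj₁ eq) = cong c eq
          classify (inj₂ eq) = trans (cong c eq) e
        both : ∀ x y → c x ≡ c y → c (x + b) ≡ c x → c (proj x) ≡ c (proj y)
        both x y e ex = trans (stay x ex) (trans e (sym (stay y (trans (shift y x (sym e)) (trans ex e)))))
        line-H : ∀ x → ppart x ≡ 0ₚ → line h (vpart x) ≡ H x
        line-H x z = trans (sym (S₀-line (vpart x))) (cong (λ z → H (el (vpart x) z)) (sym z))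
        same-project : ∀ {u v} → line h u ≡ line h v → project h t u ≡ project h t v
        same-project {u} {v} e rewrite e = refl
        cases : ∀ x y → c x ≡ c y → Dec (ppart x ≡ 0ₚ) → Dec (ppart y ≡ 0ₚ) → c (proj x) ≡ c (proj y)
        cases x y e (no nx) _ = both x y e (fixed x nx)
        cases x y e (yes _) (no ny) = sym (both y x (sym e) (fixed y ny))
        cases x y e (yes zx) (yes zy) = cong c (cong₂ el
          (same-project {vpart x} {vpart y} (trans (line-H x zx) (trans (H-cls x y e) (sym (line-H y zy))))) (trans zx (sym zy)))

      -- The projection is the identity on the line times P and adds b elsewhere. Each class lies on
      -- one side, and adding b respects classes.
      splitting-complement : Cls (isL t) → Splitting
      splitting-complement cL = line-splitting λ x y e → cases x y e (decide (isL t x))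
        where
        off : ∀ x → isL t x ≡ false → proj x ≡ x + b
        off x f = trans (cong (λ v → el v (ppart x)) (project-off-line h t (vpart x) h≢0 out f)) (sym (+b x))
        on : ∀ x → isL t x ≡ true → proj x ≡ x
        on x f = cong (λ v → el v (ppart x)) (project-line h t (vpart x) h≢0 out f)
        cases : ∀ x y → c x ≡ c y → isL t x ≡ true ⊎ isL t x ≡ false → c (proj x) ≡ c (proj y)
        cases x y e (inj₁ l) = subst₂ (λ u v → c u ≡ c v) (sym (on x l)) (sym (on y (trans (sym (cL x y e)) l))) e
        cases x y e (inj₂ l) = subst₂ (λ u v → c u ≡ c v) (sym (off x l)) (sym (off y (trans (sym (cL x y e)) l))) (shift x y e)

    -- A class moved by translation by `b`

    module Moved (x′ : M p) (z≢0 : ppart x′ ≢ 0ₚ) (moved : c (x′ + b) ≢ c x′) where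
      v₁ : V
      v₁ = vpart x′
      z : Fin p
      z = ppart x′
      X : M p → Bool
      X = class-of x′
      cX : Cls X
      cX = class-of-cls x′
      S : V → Bool
      S = layer X z
      Sv₁ : S v₁ ≡ true
      Sv₁ = ≡ᵇ-true {c x′} refl

      X-c : ∀ {x} → X x ≡ true → c x ≡ c x′
      X-c {x} h = ≡ᵇ-≡ {c x} {c x′} h

      -- Translation by b permutes the classes, so if X met X + b, the two would be equal.
      not-both : ∀ w v → X (el v w) ≡ true → X (el (v +ᵥ h) w) ≡ true → ⊥
      not-both w v a d = moved (trans (shift x′ (el v w) (sym (X-c a))) (trans (cong c (+b (el v w))) (X-c d)))

      disj : ∀ w → disjoint (layer X w) (translate h (layer X w)) ≡ true
      disj w = disjoint-intro (layer X w) (translate h (layer X w)) (not-both w)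

      even : ∀ {w} → w ≢ 0ₚ → odd (layer X w) ≡ false
      even {w} = even-layers notP {X} cX {w}

      abstract
        t : V
        t = proj₁ (disjoint-translate S h v₁ (even z≢0) Sv₁ (disj z))
        D : Direction S t ≡ true
        D = proj₁ (proj₂ (disjoint-translate S h v₁ (even z≢0) Sv₁ (disj z)))
        t-outside : outside h t ≡ true
        t-outside = proj₂ (proj₂ (disjoint-translate S h v₁ (even z≢0) Sv₁ (disj z)))

      D′ : (t == e₀) ≡ false × pair S ≡ true × inv t S ≡ true
      D′ = direction-elim {S} {t} D

      -- A nonempty layer contains v₁ or v₁ + h, because it and its translate by h cover V. So it
      -- equals S or S + h, and both are cosets of the line of t.
      line-cls-disjoint : (∀ v → X (el v 0ₚ) ≡ false) → Cls (isL t)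
      line-cls-disjoint X∩V = line-cls {X} cX X∩V t (proj₁ D′) invariant z (proj₁ (proj₂ D′))
        where
        same : ∀ {w} → w ≢ 0ₚ → X (el v₁ w) ≡ true → ∀ v → layer X w v ≡ S v
        same {w} w≢0 Xw v = bool-ext
          (λ Tv → ≡ᵇ-true {c (el v z)} {c x′} (scale w≢0 z≢0 v v₁ (trans (X-c Tv) (sym (X-c Xw)))))
          (λ Sv → ≡ᵇ-true {c (el v w)} {c x′} (trans (scale z≢0 w≢0 v v₁ (X-c Sv)) (X-c Xw)))
        shifted : ∀ {w} → w ≢ 0ₚ → X (el (v₁ +ᵥ h) w) ≡ true → ∀ v → layer X w v ≡ translate h S v
        shifted {w} w≢0 Xw v = bool-ext
          (λ Tv → ≡ᵇ-true {c (el (v +ᵥ h) z)} {c x′}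
            (subst (λ u → c (el (v +ᵥ h) z) ≡ c (el u z)) (+ᵥ-cancel v₁ h)
              (scale w≢0 z≢0 (v +ᵥ h) ((v₁ +ᵥ h) +ᵥ h)
                (subst₂ (λ x y → c x ≡ c y) (+b (el v w)) (+b (el (v₁ +ᵥ h) w))
                  (shift (el v w) (el (v₁ +ᵥ h) w) (trans (X-c Tv) (sym (X-c Xw))))))))
          (λ Sv → ≡ᵇ-true {c (el v w)} {c x′} (trans
            (subst (λ u → c (el u w) ≡ c (el (v₁ +ᵥ h) w)) (+ᵥ-cancel v h)
              (subst₂ (λ x y → c x ≡ c y) (+b (el (v +ᵥ h) w)) (+b (el v₁ w))
                (shift (el (v +ᵥ h) w) (el v₁ w) (scale z≢0 w≢0 (v +ᵥ h) v₁ (X-c Sv)))))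
            (X-c Xw)))
        cover : ∀ {w} → w ≢ 0ₚ → anyV (layer X w) ≡ true → X (el v₁ w) ≡ true ⊎ X (el (v₁ +ᵥ h) w) ≡ true
        cover {w} w≢0 a = let (u , Xu) = anyV-elim (layer X w) a in
          ∨-true (covers (layer X w) h v₁ u (even w≢0) Xu (disj w))
        invariant-layer : ∀ w → w ≢ 0ₚ → anyV (layer X w) ≡ true ⊎ anyV (layer X w) ≡ false → inv t (layer X w) ≡ true
        invariant-layer w w≢0 (inj₂ none) = inv-empty (layer X w) t λ v → ≢true λ e → true≢false (anyV-intro (layer X w) v e) none
        invariant-layer w w≢0 (inj₁ a) = pick (cover w≢0 a)
          where
          pick : X (el v₁ w) ≡ true ⊎ X (el (v₁ +ᵥ h) w) ≡ true → inv t (layer X w) ≡ true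
          pick (inj₁ e) = inv-cong {S} {layer X w} t (same w≢0 e) (proj₂ (proj₂ D′))
          pick (inj₂ e) = inv-cong {translate h S} {layer X w} t (shifted w≢0 e) (inv-translate S t h (proj₂ (proj₂ D′)))
        invariant : ∀ w → inv t (layer X w) ≡ true
        invariant w = by-layer (w ≟F 0ₚ)
          where
          by-layer : Dec (w ≡ 0ₚ) → inv t (layer X w) ≡ true
          by-layer (yes w≡0) = inv-empty (layer X w) t (λ v → trans (cong (λ w → X (el v w)) w≡0) (X∩V v))
          by-layer (no w≢0) = invariant-layer w w≢0 (decide (anyV (layer X w)))

      -- The multipliers fix (a , 0) and hence preserve X, so every layer off V equals S, which is
      -- the line of t as it contains 0. It remains to see that (t , 0) is the only point of X in V.
      line-cls-meeting : ∀ a → X (el a 0ₚ) ≡ true → S e₀ ≡ true → Cls (isL t)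
      line-cls-meeting a Xa S0 = isL-cls {X} cX t layers only-t Xt
        where
        multiplier-fixes : ∀ {w w'} → w ≢ 0ₚ → w' ≢ 0ₚ → ∀ v → X (el v w) ≡ true → X (el v w') ≡ true
        multiplier-fixes {w} {w'} w≢0 w'≢0 v Xv = let (r , r≢0 , rw) = ratio w'≢0 w≢0 in
          ≡ᵇ-true {c (el v w')} {c x′} (trans (subst₂ (λ y y' → c (el v y) ≡ c (el a y')) rw (*-zeroʳ r)
            (multiplier r r≢0 (el v w) (el a 0ₚ) (trans (X-c Xv) (sym (X-c Xa))))) (X-c Xa))
        layers : ∀ {w} → w ≢ 0ₚ → ∀ v → X (el v w) ≡ line t v
        layers w≢0 v = trans (bool-ext (multiplier-fixes w≢0 z≢0 v) (multiplier-fixes z≢0 w≢0 v)) (direction-line S t v D S0)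
        off-H : ∀ {u} → X (el u 0ₚ) ≡ true → outside h u ≡ true
        off-H {u} Xu = cong not (≢true λ l → z≢0 (H⊆V x′ (trans (sym (H-cls (el u 0ₚ) x′ (X-c Xu))) (trans (S₀-line u) l))))
        only-t : ∀ u → X (el u 0ₚ) ≡ true → u ≡ t
        only-t u Xu = let (y , Xy , Xu-y) = halves {X} cX (λ x y a d → trans (X-c a) (sym (X-c d))) (λ w≢0 → layers w≢0 e₀) u Xu in
          analyse y Xy Xu-y (ppart y ≟F 0ₚ)
          where
          analyse : ∀ y → X y ≡ true → X (el u 0ₚ - y) ≡ true → Dec (ppart y ≡ 0ₚ) → u ≡ t
          -- In this case u, the V-part of y and their sum are all off the line of h, which has
          -- index 2.
          analyse y Xy Xu-y (yes y≡0) = ⊥-elim (cosets-of-line h u (vpart y) h≢0 (off-H Xu)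
            (off-H (subst (λ w → X (el (vpart y) w) ≡ true) y≡0 Xy))
            (off-H (subst (λ w → X (el (u +ᵥ vpart y) w) ≡ true) (trans (cong (λ w → 0ₚ +ₚ (-ₚ w)) y≡0) (-ₚ-inverseʳ 0ₚ)) Xu-y)))
          analyse y Xy Xu-y (no y≢0) = nonzero (∨-true {u == e₀} (line-+ t u (vpart y)
              (trans (sym (layers (0-y≢0 y≢0) (u +ᵥ vpart y))) Xu-y) (trans (sym (layers y≢0 (vpart y))) Xy)))
            where
            nonzero : (u == e₀) ≡ true ⊎ (u == t) ≡ true → u ≡ t
            nonzero (inj₂ e) = ==-≡ e
            nonzero (inj₁ e) = true≢false (off-H Xu) (cong not (∨-introˡ (u == h) e))
        Xt : X (el t 0ₚ) ≡ true
        Xt = subst (λ u → X (el u 0ₚ) ≡ true) (only-t a Xa) Xa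

    splitting-moved : ∀ x → ppart x ≢ 0ₚ → c (x + b) ≢ c x → Splitting
    splitting-moved x z≢0 moved = by-V (decide (anyV (layer X 0ₚ)))
      where
      open Moved x z≢0 moved
      z'≢0 : ppart (x + b) ≢ 0ₚ
      z'≢0 e = z≢0 (trans (sym (+ₚ-zeroʳ (ppart x))) e)
      moved' : c ((x + b) + b) ≢ c (x + b)
      moved' e = moved (trans (sym e) (cong c (unshift x)))
      module N = Moved (x + b) z'≢0 moved'
      shifted-in : ∀ {y} → c y ≡ c x → N.X (y + b) ≡ true
      shifted-in {y} e = ≡ᵇ-true {c (y + b)} {c (x + b)} (shift y x e)
      by-V : anyV (layer X 0ₚ) ≡ true ⊎ anyV (layer X 0ₚ) ≡ false → Splitting
      by-V (inj₂ none) = splitting-complement t t-outside (line-cls-disjoint λ v → ≢true λ e → true≢false (anyV-intro (layer X 0ₚ) v e) none)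
      by-V (inj₁ some) = by-zero (anyV-elim (layer X 0ₚ) some) (∨-true (covers S h e₀ v₁ (even z≢0) Sv₁ (disj z)))
        where
        by-zero : (∃ λ a → layer X 0ₚ a ≡ true) → S e₀ ≡ true ⊎ S (e₀ +ᵥ h) ≡ true → Splitting
        by-zero (a , Xa) (inj₁ S0) = splitting-complement t t-outside (line-cls-meeting a Xa S0)
        -- When the layer S contains h but perhaps not 0, pass to the class of x + b, whose layer
        -- contains 0.
        by-zero (a , Xa) (inj₂ Sh) = splitting-complement N.t N.t-outside (N.line-cls-meeting (a +ᵥ h)
          (subst (λ y → N.X y ≡ true) (+b (el a 0ₚ)) (shifted-in (X-c Xa)))
          (subst (λ y → N.X y ≡ true) (cong₂ el (+ᵥ-cancel e₀ h) refl) (shifted-in (X-c Sh))))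

    splitting-line : Splitting
    splitting-line = by-search (search (λ x → not ⌊ ppart x ≟F 0ₚ ⌋ ∧ not (c (x + b) ℕ.≡ᵇ c x)))
      where
      by-search : (∃ λ x → (not ⌊ ppart x ≟F 0ₚ ⌋ ∧ not (c (x + b) ℕ.≡ᵇ c x)) ≡ true) ⊎
                  (∀ x → (not ⌊ ppart x ≟F 0ₚ ⌋ ∧ not (c (x + b) ℕ.≡ᵇ c x)) ≡ false) → Splitting
      by-search (inj₁ (x , e)) = let (a , d) = ∧-true {not ⌊ ppart x ≟F 0ₚ ⌋} e in splitting-moved x
        (λ z≡0 → true≢false (⌊≟⌋-true _≟F_ z≡0) (not-true a)) (λ eq → true≢false (≡ᵇ-true eq) (not-true d))
      by-search (inj₂ none) = splitting-stable (proj₁ (exists-outside h)) (proj₂ (exists-outside h)) λ x z≢0 →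
        same x (cong not (⌊≟⌋-false _≟F_ z≢0)) (none x)
        where
        same : ∀ x → not ⌊ ppart x ≟F 0ₚ ⌋ ≡ true → (not ⌊ ppart x ≟F 0ₚ ⌋ ∧ not (c (x + b) ℕ.≡ᵇ c x)) ≡ false → c (x + b) ≡ c x
        same x a e = yes-or-no (decide (c (x + b) ℕ.≡ᵇ c x))
          where
          yes-or-no : (c (x + b) ℕ.≡ᵇ c x) ≡ true ⊎ (c (x + b) ℕ.≡ᵇ c x) ≡ false → c (x + b) ≡ c x
          yes-or-no (inj₁ h) = ≡ᵇ-≡ h
          yes-or-no (inj₂ h) = true≢false (true-∧ a (cong not h)) e

  splitting : ¬ Cls isP → (∀ x → H x ≡ true → ppart x ≡ 0ₚ) → Splitting
  splitting notP H⊆V = by-subspace (subspace S₀ (IsSub.has-0 H-sub) λ u v Hu Hv →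
      trans (cong (λ w → H (el (u +ᵥ v) w)) (sym (+ₚ-identityˡ 0ₚ))) (IsSub.has-+ H-sub (el u 0ₚ) (el v 0ₚ) Hu Hv))
    where
    by-subspace : Subspace S₀ → Splitting
    by-subspace (trivial h) = split-trivial notP H⊆V h
    by-subspace (a-line t t≢0 h) = splitting-line notP H⊆V t t≢0 h
    by-subspace (everything h) = split-full notP H⊆V h

  small-classes : (∀ F → SM.InE p col F → ¬ SM.E1 p p col F) → (∀ x → SM.count p (E x) ≤ 4) → SM.QuotAutEq p col E
  small-classes noE1 small = Lifting.quotAutEq (splitting (λ cP → noE1 (cosets isP) (cosets-InE cP isP-sub) (isP-E1 cP)) H⊆V)
    where
    H⊆V : ∀ x → H x ≡ true → ppart x ≡ 0ₚ
    H⊆V x Hx = by-layer (ppart x ≟F 0ₚ)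
      where
      by-layer : Dec (ppart x ≡ 0ₚ) → ppart x ≡ 0ₚ
      by-layer (yes e) = e
      -- A nonzero P-part would force P into H, which has at most 4 elements.
      by-layer (no z≢0) = ⊥-elim (ℕ.1+n≰n (ℕ.≤-trans 5≤p (ℕ.≤-trans (P-bound H (contains-P H-sub Hx z≢0)) (small 0ₘ))))

-- Minimal H that contains P properly

module LargeClasses (n : ℕ) (pr : Prime (suc n)) (5≤p : 5 ≤ suc n)
                    (col : Coloring (M (suc n))) (cay : IsCayleyM (suc n) col)
                    (E : BRel (M (suc n))) (inE : SM.InE (suc n) col E) where
  open SmallClasses n pr 5≤p col cay E inE public
  open KleinFacts
  open SolveM

  class-eq : ∀ {a x} → class-of a x ≡ true → c x ≡ c a
  class-eq {a} {x} h = ≡ᵇ-≡ {c x} {c a} h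

  eq-class : ∀ {a x} → c x ≡ c a → class-of a x ≡ true
  eq-class {a} {x} h = ≡ᵇ-true {c x} {c a} h

  -- Multipliers fix (u , 0), hence its class.
  multiplier-fixes : ∀ {a u} → c (el u 0ₚ) ≡ c a → ∀ {w w'} → w ≢ 0ₚ → w' ≢ 0ₚ → ∀ v → c (el v w) ≡ c a → c (el v w') ≡ c a
  multiplier-fixes {a} {u} eu {w} {w'} w≢0 w'≢0 v e = let (r , r≢0 , rw) = ratio w'≢0 w≢0 in
    trans (subst₂ (λ y y' → c (el v y) ≡ c (el u y')) rw (*-zeroʳ r) (multiplier r r≢0 (el v w) (el u 0ₚ) (trans e (sym eu)))) eu

  module _ (min : Minimal H) (HP : ∀ d → H (el e₀ d) ≡ true) where
    H-S : ∀ x → H x ≡ S₀ (vpart x)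
    H-S x = bool-ext
      (λ Hx → trans (cong H (trans (cong₂ el (sym (+ᵥ-zeroʳ (vpart x))) (sym (-ₚ-inverseʳ (ppart x)))) refl)) (IsSub.has-+ H-sub x _ Hx (HP (-ₚ ppart x))))
      (λ Hx → trans (cong H (cong₂ el (sym (+ᵥ-zeroʳ (vpart x))) (sym (+ₚ-identityˡ (ppart x))))) (IsSub.has-+ H-sub _ _ Hx (HP (ppart x))))

    -- P would be a nontrivial union of classes and a proper subgroup of the minimal H.
    P-not-class : ∀ {t} → (t == e₀) ≡ false → S₀ t ≡ true → ¬ Cls isP
    P-not-class {t} t≢0 St cP = true≢false
      (min isP cP isP-sub P⊆H (el e₀ 1ₚ , (λ e → 1≢0 (cong ppart e)) , refl) (el t 0ₚ) St) t≢0
      where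
      P⊆H : ∀ x → isP x ≡ true → H x ≡ true
      P⊆H x h = trans (H-S x) (trans (cong S₀ (==-≡ h)) (IsSub.has-0 H-sub))

    stable-all : ∀ {U} → Cls U → ∀ {t} → (t == e₀) ≡ false → S₀ t ≡ true → Stable U (el t 0ₚ) → ∀ g → H g ≡ true → Stable U g
    stable-all {U} cU {t} t≢0 St = minimal-stable H-cls H-sub min {U} cU {el t 0ₚ} St (nonzero-t {t} t≢0)

    -- H = M: all nonzero elements form one class

    module WholeGroup (full : ∀ v → S₀ v ≡ true) where
      notP : ¬ Cls isP
      notP = P-not-class {e₁} refl (full e₁)

      everything-stable : ∀ {U} → Cls U → ∀ {t} → (t == e₀) ≡ false → Stable U (el t 0ₚ) → ∀ {x} → U x ≡ true → ∀ y → U y ≡ true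
      everything-stable {U} cU {t} t≢0 st {x} Ux y = trans (cong U (abel x₁ (x₀ ⊕ (x₁ ⊖ x₀)) refl (x ∷ y ∷ [])))
        (stable-all {U} cU {t} t≢0 (full t) st (y - x) (trans (H-S (y - x)) (full _)) x Ux)

      -- If the class of a missed V, its hull would miss V too and have one and the same nonempty
      -- even layer everywhere else. It would be stable under some (t , 0) with t ≠ 0, hence, by
      -- minimality of H = M, be all of M.
      meets-V : ∀ a → a ≢ 0ₘ → ∃ λ v → c (el v 0ₚ) ≡ c a
      meets-V a a≢0 = by-layer (decide (anyV (layer X 0ₚ)))
        where
        X : M p → Bool
        X = class-of a
        by-layer : anyV (layer X 0ₚ) ≡ true ⊎ anyV (layer X 0ₚ) ≡ false → ∃ λ v → c (el v 0ₚ) ≡ c a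
        by-layer (inj₁ some) = let (v , h) = anyV-elim (layer X 0ₚ) some in v , class-eq h
        by-layer (inj₂ none) = true≢false (everything-stable {U} cU {t} t≢0 (inv-stable {U} t invariant) {a} Ua (el e₀ 0ₚ)) (U-empty e₀)
          where
          U : M p → Bool
          U = hull X
          cU : Cls U
          cU = hull-cls {X} (class-of-cls a)
          X-empty : ∀ v → X (el v 0ₚ) ≡ false
          X-empty v = ≢true λ h → true≢false (anyV-intro (layer X 0ₚ) v h) none
          U-empty : ∀ v → U (el v 0ₚ) ≡ false
          U-empty v = ≢true λ h → let (u , _ , Xu) = hull-elim X (el v 0ₚ) h in
            true≢false (subst (λ w → X (el v w) ≡ true) (*-zeroʳ u) Xu) (X-empty v)
          Ua : U a ≡ true
          Ua = hull-intro X a 1ₚ 1≢0 (trans (cong X (μ-1 a)) (eq-class refl))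
          spread : ∀ {w w'} → w ≢ 0ₚ → w' ≢ 0ₚ → ∀ v → U (el v w) ≡ true → U (el v w') ≡ true
          spread {w} {w'} w≢0 w'≢0 v h = let (u , u≢0 , Xu) = hull-elim X (el v w) h ; (r , r≢0 , rw) = ratio w≢0 w'≢0 in
            hull-intro X (el v w') (u *ₚ r) (λ e → r≢0 (*-cancel-0 u≢0 e))
              (subst (λ z → X (el v z) ≡ true) (trans (cong (u *ₚ_) (sym rw)) (sym (*ₚ-assoc u r w'))) Xu)
          Y : V → Bool
          Y = layer U 1ₚ
          a-layer : ppart a ≢ 0ₚ
          a-layer e = true≢false (subst (λ w → U (el (vpart a) w) ≡ true) e Ua) (U-empty (vpart a))
          found : ∃ λ t → (t == e₀) ≡ false × inv t Y ≡ true
          found = even-invariant Y (vpart a) (even-layers notP {U} cU {1ₚ} 1≢0) (spread a-layer 1≢0 (vpart a) Ua)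
          t : V
          t = proj₁ found
          t≢0 : (t == e₀) ≡ false
          t≢0 = proj₁ (proj₂ found)
          invariant : ∀ w → inv t (layer U w) ≡ true
          invariant w = cases (w ≟F 0ₚ)
            where
            cases : Dec (w ≡ 0ₚ) → inv t (layer U w) ≡ true
            cases (yes w≡0) = inv-empty (layer U w) t (λ v → trans (cong (λ w → U (el v w)) w≡0) (U-empty v))
            cases (no w≢0) = inv-cong {Y} {layer U w} t (λ v → bool-ext (spread w≢0 1≢0 v) (spread 1≢0 w≢0 v)) (proj₂ (proj₂ found))

      -- By `meets-V` the multipliers preserve the class, so without points of P-part 1 it lies in
      -- V. The class, or its union with 0, is then invariant under some t ≠ 0, and minimality
      -- enlarges it to M.
      leaves-V : ∀ a → a ≢ 0ₘ → ∃ λ v → c (el v 1ₚ) ≡ c a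
      leaves-V a a≢0 = by-layer (decide (anyV (layer X 1ₚ)))
        where
        X : M p → Bool
        X = class-of a
        b : V
        b = proj₁ (meets-V a a≢0)
        Xb : X (el b 0ₚ) ≡ true
        Xb = eq-class (proj₂ (meets-V a a≢0))
        by-layer : anyV (layer X 1ₚ) ≡ true ⊎ anyV (layer X 1ₚ) ≡ false → ∃ λ v → c (el v 1ₚ) ≡ c a
        by-layer (inj₁ some) = let (v , h) = anyV-elim (layer X 1ₚ) some in v , class-eq h
        by-layer (inj₂ none) = ⊥-elim (clash (proj₂ (proj₂ found)))
          where
          B : V → Bool
          B = layer X 0ₚ
          B₀ : V → Bool
          B₀ v = (v == e₀) ∨ B v
          X⊆V : ∀ x → X x ≡ true → ppart x ≡ 0ₚ
          X⊆V x Xx = cases (ppart x ≟F 0ₚ)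
            where
            cases : Dec (ppart x ≡ 0ₚ) → ppart x ≡ 0ₚ
            cases (yes e) = e
            cases (no ne) = true≢false (anyV-intro (layer X 1ₚ) (vpart x)
              (eq-class (multiplier-fixes {a} (class-eq Xb) ne 1≢0 (vpart x) (class-eq Xx)))) none
          found : ∃ λ t → (t == e₀) ≡ false × (inv t B ≡ true ⊎ inv t B₀ ≡ true)
          found = punctured-invariant B (≢true λ h → a≢0 (c-zero a (sym (class-eq h))))
          t : V
          t = proj₁ found
          t≢0 : (t == e₀) ≡ false
          t≢0 = proj₁ (proj₂ found)
          stable-layer : ∀ {U} → (∀ x → U x ≡ true → ppart x ≡ 0ₚ) → ∀ {S} → (∀ v → U (el v 0ₚ) ≡ S v) → inv t S ≡ true → Stable U (el t 0ₚ)
          stable-layer {U} U⊆V {S} US i = inv-stable {U} t λ w → cases w (w ≟F 0ₚ)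
            where
            cases : ∀ w → Dec (w ≡ 0ₚ) → inv t (layer U w) ≡ true
            cases w (yes w≡0) = inv-cong {S} {layer U w} t (λ v → trans (cong (λ w → U (el v w)) w≡0) (US v)) i
            cases w (no w≢0) = inv-empty (layer U w) t (λ v → ≢true λ h → w≢0 (U⊆V (el v w) h))
          U : M p → Bool
          U x = isZero x ∨ X x
          U⊆V : ∀ x → U x ≡ true → ppart x ≡ 0ₚ
          U⊆V x h = cases (∨-true {isZero x} h)
            where
            cases : isZero x ≡ true ⊎ X x ≡ true → ppart x ≡ 0ₚ
            cases (inj₁ e) = cong ppart (⌊≟⌋-≡ _≟_ e)
            cases (inj₂ e) = X⊆V x e
          U-layer : ∀ v → U (el v 0ₚ) ≡ B₀ v
          U-layer v = cong (_∨ B v) (bool-ext (λ h → subst (λ u → (u == e₀) ≡ true) (cong vpart (sym (⌊≟⌋-≡ _≟_ h))) refl)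
            (λ h → ⌊≟⌋-true _≟_ (cong (λ u → el u 0ₚ) (==-≡ h))))
          clash : inv t B ≡ true ⊎ inv t B₀ ≡ true → ⊥
          clash (inj₁ i) = 1≢0 (X⊆V (el e₀ 1ₚ) (everything-stable {X} (class-of-cls a) {t} t≢0
            (stable-layer {X} X⊆V {B} (λ _ → refl) i) {el b 0ₚ} Xb (el e₀ 1ₚ)))
          clash (inj₂ i) = 1≢0 (U⊆V (el e₀ 1ₚ) (everything-stable {U} (λ x y e → cong₂ _∨_ (isZero-cls x y e) (class-of-cls a x y e)) {t} t≢0
            (stable-layer {U} U⊆V {B₀} U-layer i) {el b 0ₚ} (∨-introʳ (isZero (el b 0ₚ)) Xb) (el e₀ 1ₚ)))

      a₁ : M p
      a₁ = el e₀ 1ₚ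

      a₁≢0 : a₁ ≢ 0ₘ
      a₁≢0 e = 1≢0 (cong ppart e)

      -- The layer at 1 of the class of (0 , 1) is even and contains 0. If it is V, `leaves-V` lets
      -- every nonzero class meet this class. If it is a line, the class and 0 form the line times
      -- P, which minimality of M excludes.
      one-class : ∀ x → x ≢ 0ₘ → c x ≡ c a₁
      one-class = by-layer (even-containing-0 (layer X 1ₚ) (even-layers notP {X} (class-of-cls a₁) {1ₚ} 1≢0) (eq-class refl))
        where
        X : M p → Bool
        X = class-of a₁
        by-layer : (∀ v → layer X 1ₚ v ≡ true) ⊎ (∃ λ t → (t == e₀) ≡ false × (∀ v → layer X 1ₚ v ≡ line t v)) → ∀ x → x ≢ 0ₘ → c x ≡ c a₁
        by-layer (inj₁ all) x x≢0 = let (v , e) = leaves-V x x≢0 in trans (sym e) (class-eq (all v))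
        by-layer (inj₂ (t , t≢0 , X-line)) = ⊥-elim (true≢false (everything-stable {isL t} (isL-cls {X} (class-of-cls a₁) t layers only-t Xt) {t} t≢0
              (inv-stable {isL t} t λ _ → line-inv t) {0ₘ} refl (el s 0ₚ)) (not-true (proj₂ (exists-outside t))))
          where
          s : V
          s = proj₁ (exists-outside t)
          line-inv : ∀ t → inv t (line t) ≡ true
          line-inv = allV-elim (λ t → inv t (line t)) refl
          b : V
          b = proj₁ (meets-V a₁ a₁≢0)
          eb : c (el b 0ₚ) ≡ c a₁
          eb = proj₂ (meets-V a₁ a₁≢0)
          layers : ∀ {w} → w ≢ 0ₚ → ∀ v → X (el v w) ≡ line t v
          layers w≢0 v = trans (bool-ext (λ h → eq-class (multiplier-fixes {a₁} eb w≢0 1≢0 v (class-eq h)))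
            (λ h → eq-class (multiplier-fixes {a₁} eb 1≢0 w≢0 v (class-eq h)))) (X-line v)
          X₀ : layer X 0ₚ e₀ ≡ false
          X₀ = ≢true λ h → a₁≢0 (c-zero a₁ (sym (class-eq h)))
          only-t : ∀ u → X (el u 0ₚ) ≡ true → u ≡ t
          only-t u Xu = let (y , Xy , Xu-y) = halves {X} (class-of-cls a₁) (λ x y d d' → trans (class-eq d) (sym (class-eq d'))) (λ w≢0 → layers w≢0 e₀) u Xu in
            analyse y Xy Xu-y (ppart y ≟F 0ₚ)
            where
            analyse : ∀ y → X y ≡ true → X (el u 0ₚ - y) ≡ true → Dec (ppart y ≡ 0ₚ) → u ≡ t
            analyse y Xy Xu-y (no y≢0) = nonzero (∨-true {u == e₀} (line-+ t u (vpart y)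
                (trans (sym (layers (0-y≢0 y≢0) (u +ᵥ vpart y))) Xu-y) (trans (sym (layers y≢0 (vpart y))) Xy)))
              where
              nonzero : (u == e₀) ≡ true ⊎ (u == t) ≡ true → u ≡ t
              nonzero (inj₂ e) = ==-≡ e
              nonzero (inj₁ e) = true≢false (subst (λ u → X (el u 0ₚ) ≡ true) (==-≡ e) Xu) X₀
            -- Now u, the V-part of y and their sum are the three nonzero elements of V, and X
            -- contains them all. The class of (s , 1) meets V in one of them, so (s , 1) is in X,
            -- although s is off the line.
            analyse y Xy Xu-y (yes y≡0) = true≢false (trans (sym (X-line s)) (eq-class (trans (sym es) ev))) (not-true (proj₂ (exists-outside t)))
              where
              v : V
              v = proj₁ (meets-V (el s 1ₚ) (λ e → 1≢0 (cong ppart e)))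
              es : c (el v 0ₚ) ≡ c (el s 1ₚ)
              es = proj₂ (meets-V (el s 1ₚ) (λ e → 1≢0 (cong ppart e)))
              v≢0 : (v == e₀) ≡ false
              v≢0 = ≢true λ h → 1≢0 (cong ppart (c-zero (el s 1ₚ) (trans (sym es) (cong (λ u → c (el u 0ₚ)) (==-≡ h)))))
              ev : c (el v 0ₚ) ≡ c a₁
              ev = class-eq (three-elements (layer X 0ₚ) u (vpart y) v X₀ Xu (subst (λ w → X (el (vpart y) w) ≡ true) y≡0 Xy)
                (subst (λ w → X (el (u +ᵥ vpart y) w) ≡ true) (trans (cong (λ w → 0ₚ +ₚ (-ₚ w)) y≡0) (-ₚ-inverseʳ 0ₚ)) Xu-y) v≢0)
          Xt : X (el t 0ₚ) ≡ true
          Xt = subst (λ u → X (el u 0ₚ) ≡ true) (only-t b (eq-class eb)) (eq-class eb)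

    -- H a line times P: the classes on H and on its other coset

    module LineCosets (t : V) (t≢0 : (t == e₀) ≡ false) (S-line : ∀ v → S₀ v ≡ line t v) where
      St : S₀ t ≡ true
      St = trans (S-line t) (∨-introʳ (t == e₀) (==-refl t))

      notP : ¬ Cls isP
      notP = P-not-class {t} t≢0 St

      H-line : ∀ x → H x ≡ line t (vpart x)
      H-line x = trans (H-S x) (S-line (vpart x))

      -- A class of nonzero elements of H that misses (t , 0) misses V. Its layers are even subsets
      -- of the line, so it is stable under (t , 0), hence under H, and would contain 0.
      one-class : ∀ x → H x ≡ true → x ≢ 0ₘ → c x ≡ c (el t 0ₚ)
      one-class x Hx x≢0 = by-t (decide (X (el t 0ₚ)))
        where
        X : M p → Bool
        X = class-of x
        in-line : ∀ w v → X (el v w) ≡ true → line t v ≡ true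
        in-line w v h = trans (sym (H-line (el v w))) (trans (H-cls (el v w) x (class-eq h)) Hx)
        by-t : X (el t 0ₚ) ≡ true ⊎ X (el t 0ₚ) ≡ false → c x ≡ c (el t 0ₚ)
        by-t (inj₁ h) = sym (class-eq h)
        by-t (inj₂ no′) = ⊥-elim (x≢0 (c-zero x (sym (class-eq (trans (cong X (abel 𝟘 (x₀ ⊕ ⊝ x₀) refl (x ∷ [])))
            (stable-all {X} (class-of-cls x) {t} t≢0 St (inv-stable {X} t invariant) (- x) (sub-neg H-sub x Hx) x (eq-class refl)))))))
          where
          empty : ∀ v → X (el v 0ₚ) ≡ false
          empty v = ≢true λ h → cases h (∨-true {v == e₀} (in-line 0ₚ v h))
            where
            cases : X (el v 0ₚ) ≡ true → (v == e₀) ≡ true ⊎ (v == t) ≡ true → ⊥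
            cases h (inj₁ e) = x≢0 (c-zero x (trans (sym (class-eq h)) (cong (λ u → c (el u 0ₚ)) (==-≡ e))))
            cases h (inj₂ e) = true≢false (subst (λ u → X (el u 0ₚ) ≡ true) (==-≡ e) h) no′
          invariant : ∀ w → inv t (layer X w) ≡ true
          invariant w = cases (w ≟F 0ₚ)
            where
            cases : Dec (w ≡ 0ₚ) → inv t (layer X w) ≡ true
            cases (yes w≡0) = inv-empty (layer X w) t (λ v → trans (cong (λ w → X (el v w)) w≡0) (empty v))
            cases (no w≢0) = even-on-line (layer X w) t (even-layers notP {X} (class-of-cls x) {w} w≢0)
              (disjoint-intro (layer X w) (outside t) λ v h o → true≢false (in-line w v h) (not-true o))

      v₀ : V
      v₀ = proj₁ (exists-outside t)

      a₀ : M p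
      a₀ = el v₀ 1ₚ

      off-line : ∀ w v → c (el v w) ≡ c a₀ → outside t v ≡ true
      off-line w v e = cong not (≢true λ l → true≢false
        (trans (sym (H-line a₀)) (trans (sym (H-cls (el v w) a₀ e)) (trans (H-line (el v w)) l))) (not-true (proj₂ (exists-outside t))))

      coset-inv : ∀ {w} → w ≢ 0ₚ → inv t (layer (class-of a₀) w) ≡ true
      coset-inv {w} w≢0 = even-off-line (layer (class-of a₀) w) t (even-layers notP {class-of a₀} (class-of-cls a₀) {w} w≢0)
        (disjoint-intro (layer (class-of a₀) w) (line t) λ v h l → true≢false l (not-true (off-line w v (class-eq h))))

      -- Otherwise the class of a₀ is stable under (t , 0), hence under H, which contains P; but
      -- translating a₀ by (0 , - 1) leads into V.
      coset-meets-V : ∃ λ v → c (el v 0ₚ) ≡ c a₀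
      coset-meets-V = by-layer (decide (anyV (layer X 0ₚ)))
        where
        X : M p → Bool
        X = class-of a₀
        by-layer : anyV (layer X 0ₚ) ≡ true ⊎ anyV (layer X 0ₚ) ≡ false → ∃ λ v → c (el v 0ₚ) ≡ c a₀
        by-layer (inj₁ some) = let (v , h) = anyV-elim (layer X 0ₚ) some in v , class-eq h
        by-layer (inj₂ none) = ⊥-elim (true≢false (anyV-intro (layer X 0ₚ) (v₀ +ᵥ e₀)
            (subst (λ w → X (el (v₀ +ᵥ e₀) w) ≡ true) (-ₚ-inverseʳ 1ₚ)
              (stable-all {X} (class-of-cls a₀) {t} t≢0 St (inv-stable {X} t invariant) (el e₀ (-ₚ 1ₚ)) (HP (-ₚ 1ₚ)) a₀ (eq-class refl)))) none)
          where
          invariant : ∀ w → inv t (layer X w) ≡ true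
          invariant w = cases (w ≟F 0ₚ)
            where
            cases : Dec (w ≡ 0ₚ) → inv t (layer X w) ≡ true
            cases (yes w≡0) = inv-empty (layer X w) t (λ v → trans (cong (λ w → X (el v w)) w≡0)
              (≢true λ h → true≢false (anyV-intro (layer X 0ₚ) v h) none))
            cases (no w≢0) = coset-inv w≢0

      u₀ : V
      u₀ = proj₁ coset-meets-V

      u₀-outside : outside t u₀ ≡ true
      u₀-outside = off-line 0ₚ u₀ (proj₂ coset-meets-V)

      -- The multipliers fix (u₀ , 0), hence preserve its class, and move (v₀ , 1) to every nonzero
      -- P-part. Invariance under t supplies the other V-part.
      coset-one-class : ∀ v w → outside t v ≡ true → w ≢ 0ₚ → c (el v w) ≡ c a₀
      coset-one-class v w o w≢0 = cases (same-coset t v v₀ t≢0 o (proj₂ (exists-outside t)))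
        where
        at-v₀ : c (el v₀ w) ≡ c a₀
        at-v₀ = multiplier-fixes {a₀} (proj₂ coset-meets-V) 1≢0 w≢0 v₀ refl
        cases : v ≡ v₀ ⊎ v ≡ v₀ +ᵥ t → c (el v w) ≡ c a₀
        cases (inj₁ e) = trans (cong (λ u → c (el u w)) e) at-v₀
        cases (inj₂ e) = class-eq (trans (cong (λ u → class-of a₀ (el u w)) e)
          (trans (sym (⇔ᵇ-≡ (allV-elim (λ u → layer (class-of a₀) w u ⇔ᵇ layer (class-of a₀) w (u +ᵥ t)) (coset-inv w≢0) v₀))) (eq-class at-v₀)))

      -- The coset of H other than H lies in one class, up to this point.
      base : M p
      base = el (u₀ +ᵥ t) 0ₚ

      base-line : ∀ u → line t (u +ᵥ (u₀ +ᵥ t)) ≡ not (line t u)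
      base-line u = line-coset t u (u₀ +ᵥ t) t≢0 (cong not (trans (line-translate t u₀ t (∨-introʳ (t == e₀) (==-refl t))) (not-true u₀-outside)))

      off-base : ∀ k → H k ≡ true → k ≢ 0ₘ → c (base + k) ≡ c a₀
      off-base k Hk k≢0 = cases (ppart k ≟F 0ₚ)
        where
        l : line t (vpart k) ≡ true
        l = trans (sym (H-line k)) Hk
        cases : Dec (ppart k ≡ 0ₚ) → c (base + k) ≡ c a₀
        cases (no nz) = coset-one-class _ _ (cong not (trans (cong (line t) (+ᵥ-comm (u₀ +ᵥ t) (vpart k))) (trans (base-line (vpart k)) (cong not l))))
          (λ e → nz (trans (sym (+ₚ-identityˡ (ppart k))) e))
        cases (yes z) = trans (cong c (cong₂ el (trans (cong ((u₀ +ᵥ t) +ᵥ_) (is-t (∨-true {vpart k == e₀} l))) (+ᵥ-cancel u₀ t))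
            (trans (+ₚ-identityˡ (ppart k)) z))) (proj₂ coset-meets-V)
          where
          is-t : (vpart k == e₀) ≡ true ⊎ (vpart k == t) ≡ true → vpart k ≡ t
          is-t (inj₂ e) = ==-≡ e
          is-t (inj₁ e) = ⊥-elim (k≢0 (cong₂ el (==-≡ e) z))

-- Coherent configurations from permutations

module Coherent (p : ℕ) where
  open Enumeration (elem-enum p) using (∑ₑ; ∑-reindex; elements)
  open Inverse using (to; from; strictlyInverseˡ; strictlyInverseʳ)

  basis-refl : ∀ (d : Coloring (M p)) a b → T (basis d a b a b)
  basis-refl d a b = ≡⇒T (≡ᵇ-true {d a b} refl)

  basis-≡ : ∀ (d : Coloring (M p)) {a b x y} → T (basis d a b x y) → d x y ≡ d a b
  basis-≡ d h = ≡ᵇ-≡ (T⇒≡ h)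

  ≡ᵇ-cong : ∀ {a b a' b'} → (a ≡ b → a' ≡ b') → (a' ≡ b' → a ≡ b) → (a ℕ.≡ᵇ b) ≡ (a' ℕ.≡ᵇ b')
  ≡ᵇ-cong f g = bool-ext (λ h → ≡ᵇ-true (f (≡ᵇ-≡ h))) (λ h → ≡ᵇ-true (g (≡ᵇ-≡ h)))

  count-reindex : ∀ (σ : M p ↔ M p) P → SM.count p (P ∘ to σ) ≡ SM.count p P
  count-reindex σ P = trans (count-∑ₑ p (P ∘ to σ))
    (trans (∑-reindex (to σ) (from σ) (strictlyInverseˡ σ) (strictlyInverseʳ σ) (ι ∘ P)) (sym (count-∑ₑ p P)))

  count-cong : ∀ {P Q} → (∀ x → P x ≡ Q x) → SM.count p P ≡ SM.count p Q
  count-cong {P} {Q} h = trans (count-∑ₑ p P) (trans (∑-cong elements (λ x → cong ι (h x))) (sym (count-∑ₑ p Q)))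

  diag-intro : ∀ {x y : M p} → x ≡ y → SM.diagR p x y ≡ true
  diag-intro = ⌊≟⌋-true _≟M_

  diag-elim : ∀ {x y : M p} → SM.diagR p x y ≡ true → x ≡ y
  diag-elim = ⌊≟⌋-≡ _≟M_

  -- A permutation that preserves d and carries one pair to another also carries the intermediate
  -- points of the first pair to those of the second, so they are equally many.
  schurian : ∀ (d : Coloring (M p)) →
    (∀ α β α' β' → d α β ≡ d α' β' → ∃ λ (g : M p ↔ M p) → (∀ x y → d (to g x) (to g y) ≡ d x y) × to g α ≡ α' × to g β ≡ β') →
    (∀ x y x' y' → d x y ≡ d x' y' → d y x ≡ d y' x') →
    (∀ x x' y' → d x x ≡ d x' y' → x' ≡ y') → SM.IsCC p d
  schurian d homogeneous symmetric diagonal = record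
    { diagUnion = λ x y x' y' e → bool-ext (λ h → diag-intro (half x y x' y' e (diag-elim h))) (λ h → diag-intro (half x' y' x y (sym e) (diag-elim h)))
    ; transp = λ a b → (b , a) , λ x y → ≡ᵇ-cong (symmetric y x a b) (symmetric x y b a)
    ; coh = λ a b a' b' e f α β α' β' h h' →
        let (g , pres , gα , gβ) = homogeneous α β α' β' (trans (basis-≡ d h) (sym (basis-≡ d h'))) in
        trans (count-cong λ γ → cong₂ _∧_ (cong (ℕ._≡ᵇ d a b) (sym (pres α γ))) (cong (ℕ._≡ᵇ d a' b') (sym (pres γ β))))
          (trans (count-reindex g (λ γ → basis d a b (to g α) γ ∧ basis d a' b' γ (to g β)))
            (count-cong λ γ → cong₂ (λ u v → basis d a b u γ ∧ basis d a' b' γ v) gα gβ)) }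
    where
    half : ∀ x y x' y' → d x y ≡ d x' y' → x ≡ y → x' ≡ y'
    half x .x x' y' e refl = diagonal x x' y' e

  pullback : ∀ (d : Coloring (M p)) → SM.IsCC p d → (σ : M p ↔ M p) → SM.IsCC p (λ x y → d (to σ x) (to σ y))
  pullback d cc σ = record
    { diagUnion = λ x y x' y' e → bool-ext
        (λ h → diag-intro (injective (diag-elim (trans (sym (diagUnion _ _ _ _ e)) (diag-intro (cong (to σ) (diag-elim h)))))))
        (λ h → diag-intro (injective (diag-elim (trans (diagUnion _ _ _ _ e) (diag-intro (cong (to σ) (diag-elim h)))))))
    ; transp = λ a b → let ((u , v) , h) = transp (to σ a) (to σ b) in
        (from σ u , from σ v) , λ x y → trans (h (to σ x) (to σ y))
          (cong₂ (λ u v → d (to σ x) (to σ y) ℕ.≡ᵇ d u v) (sym (strictlyInverseˡ σ u)) (sym (strictlyInverseˡ σ v)))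
    ; coh = λ a b a' b' e f α β α' β' h h' → trans (count-reindex σ (paths a b a' b' α β))
        (trans (coh (to σ a) (to σ b) (to σ a') (to σ b') (to σ e) (to σ f) (to σ α) (to σ β) (to σ α') (to σ β') h h')
          (sym (count-reindex σ (paths a b a' b' α' β')))) }
    where
    open SM.IsCC p cc
    injective : ∀ {x y} → to σ x ≡ to σ y → x ≡ y
    injective {x} {y} e = trans (sym (strictlyInverseʳ σ x)) (trans (cong (from σ) e) (strictlyInverseʳ σ y))
    paths : M p → M p → M p → M p → M p → M p → M p → Bool
    paths a b a' b' α β γ = basis d (to σ a) (to σ b) (to σ α) γ ∧ basis d (to σ a') (to σ b') γ (to σ β)

  swap : M p → M p → M p → M p
  swap a b z with z ≟M a | z ≟M b
  ... | yes _ | _ = b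
  ... | no _ | yes _ = a
  ... | no _ | no _ = z

  swap-left : ∀ a b → swap a b a ≡ b
  swap-left a b with a ≟M a
  ... | yes _ = refl
  ... | no ne = ⊥-elim (ne refl)

  swap-right : ∀ a b → swap a b b ≡ a
  swap-right a b with b ≟M a | b ≟M b
  ... | yes e | _ = e
  ... | no _ | yes _ = refl
  ... | no _ | no ne = ⊥-elim (ne refl)

  swap-other : ∀ {a b z} → z ≢ a → z ≢ b → swap a b z ≡ z
  swap-other {a} {b} {z} na nb with z ≟M a | z ≟M b
  ... | yes e | _ = ⊥-elim (na e)
  ... | no _ | yes e = ⊥-elim (nb e)
  ... | no _ | no _ = refl

  swap-involutive : ∀ a b z → swap a b (swap a b z) ≡ z
  swap-involutive a b z = cases (z ≟M a) (z ≟M b)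
    where
    cases : Dec (z ≡ a) → Dec (z ≡ b) → swap a b (swap a b z) ≡ z
    cases (yes refl) _ = trans (cong (swap a b) (swap-left a b)) (swap-right a b)
    cases (no _) (yes refl) = trans (cong (swap a b) (swap-right a b)) (swap-left a b)
    cases (no na) (no nb) = trans (cong (swap a b) (swap-other na nb)) (swap-other na nb)

  swap-preserves : ∀ (H : M p → Bool) {a b} → H a ≡ true → H b ≡ true → ∀ z → H z ≡ true → H (swap a b z) ≡ true
  swap-preserves H {a} {b} Ha Hb z Hz with z ≟M a | z ≟M b
  ... | yes _ | _ = Hb
  ... | no _ | yes _ = Ha
  ... | no _ | no _ = Hz

-- Minimality of the closure and its symmetries

module Closure (n : ℕ) (pr : Prime (suc n)) (5≤p : 5 ≤ suc n)
               (col : Coloring (M (suc n))) (cay : IsCayleyM (suc n) col)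
               (E : BRel (M (suc n))) (inE : SM.InE (suc n) col E)
               (col' : Coloring (M (suc n))) (cl : SM.IsClosureE (suc n) col E col') where
  open LargeClasses n pr 5≤p col cay E inE public
  open Coherent p public
  open Inverse using (to; from; strictlyInverseˡ; strictlyInverseʳ)
  module C' = SM.IsCC p (proj₁ cl)

  finer : ∀ x y x' y' → col' x y ≡ col' x' y' → col x y ≡ col x' y'
  finer x y x' y' e = ≡ᵇ-≡ (trans (proj₁ (proj₁ (proj₂ cl)) x' y' x y x' y' e) (≡ᵇ-true {col x' y'} refl))

  fiber-E : ∀ x y → col' x x ≡ col' y y → E x y ≡ true
  fiber-E x y e = proj₂ (∧-true {SM.diagR p y y} (trans (sym (proj₂ (proj₁ (proj₂ cl)) x x x y y e)) (true-∧ (diag-intro refl) (E-refl x))))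

  diagonal' : ∀ x x' y' → col' x x ≡ col' x' y' → x' ≡ y'
  diagonal' x x' y' e = diag-elim (trans (sym (C'.diagUnion x x x' y' e)) (diag-intro refl))

  -- Minimality in the form used below: a coherent d refines the closure once it refines the scheme
  -- and each of its fibers lies in one class of E.
  coarser : ∀ (d : Coloring (M p)) → SM.IsCC p d → (∀ x y x' y' → d x y ≡ d x' y' → col x y ≡ col x' y') →
    (∀ x x' y' → d x x ≡ d x' y' → x' ≡ y' × E x x' ≡ true) →
    ∀ x y x' y' → d x y ≡ d x' y' → col' x y ≡ col' x' y'
  coarser d cc fine diag x y x' y' e = ≡ᵇ-≡ (trans (proj₂ (proj₂ cl) d cc
      ((λ a b x y x' y' e → cong (ℕ._≡ᵇ col a b) (fine x y x' y' e)) , λ z x y x' y' e → bool-ext (half z x y x' y' e) (half z x' y' x y (sym e)))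
      x' y' x y x' y' e) (≡ᵇ-true {col' x' y'} refl))
    where
    half : ∀ z x y x' y' → d x y ≡ d x' y' → SM.diagClass p E z x y ≡ true → SM.diagClass p E z x' y' ≡ true
    half z x y x' y' e h = on (diag-elim (proj₁ (∧-true h)))
      where
      on : x ≡ y → SM.diagClass p E z x' y' ≡ true
      on refl = let (eq , inClass) = diag x x' y' e in
        true-∧ (diag-intro eq) (E-trans (proj₂ (∧-true {SM.diagR p x x} h)) inClass)

  -- The pullback of the closure along σ is coherent and still refines the scheme and the classes of
  -- E, so by minimality it refines the closure.
  closure-perm : ∀ (σ : M p ↔ M p) → (∀ x y x' y' → col (to σ x) (to σ y) ≡ col (to σ x') (to σ y') → col x y ≡ col x' y') →
    (∀ x y → E (to σ x) (to σ y) ≡ true → E x y ≡ true) →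
    ∀ x y x' y' → col' (to σ x) (to σ y) ≡ col' (to σ x') (to σ y') → col' x y ≡ col' x' y'
  closure-perm σ col-σ E-σ = coarser (λ x y → col' (to σ x) (to σ y)) (pullback col' (proj₁ cl) σ)
    (λ x y x' y' e → col-σ x y x' y' (finer _ _ _ _ e))
    (λ x x' y' e → let σe = diagonal' (to σ x) (to σ x') (to σ y') e in
      trans (sym (strictlyInverseʳ σ x')) (trans (cong (from σ) σe) (strictlyInverseʳ σ y')) ,
      E-σ x x' (fiber-E _ _ (trans e (cong (col' (to σ x')) (sym σe)))))

  private
    index : M p → Fin (2 ℕ.* (2 ℕ.* p))
    index (a , b , c) = combine a (combine b c)

    bit : Bool → Fin 2
    bit true = suc zero
    bit false = zero

    index-injective : ∀ u u' → index u ≡ index u' → u ≡ u'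
    index-injective (a , b , c) (a' , b' , c') e =
      let (ea , ebc) = combine-injective a (combine b c) a' (combine b' c') e
          (eb , ec) = combine-injective b c b' c' ebc in cong₂ _,_ ea (cong₂ _,_ eb ec)

    bit-injective : ∀ b b' → bit b ≡ bit b' → b ≡ b'
    bit-injective true true _ = refl
    bit-injective false false _ = refl

  -- Colours are natural numbers, so a tuple of invariants has to be encoded injectively.
  code : M p → M p → Bool → ℕ
  code u v b = toℕ (combine (combine (index u) (index v)) (bit b))

  code-injective : ∀ {u v b u' v' b'} → code u v b ≡ code u' v' b' → u ≡ u' × v ≡ v' × b ≡ b'
  code-injective {u} {v} {b} {u'} {v'} {b'} e =
    let (euv , eb) = combine-injective (combine (index u) (index v)) (bit b) (combine (index u') (index v')) (bit b') (toℕ-injective e)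
        (eu , ev) = combine-injective (index u) (index v) (index u') (index v') euv in
    index-injective u u' eu , index-injective v v' ev , bit-injective b b' eb

  -- If each coset of H has a base point o x and the colour of (x , y) depends only on the base points and on
  -- whether x and y have the same offset, then Sym(H) acts on the closure by permuting all cosets in parallel.
  module Parallel (o : M p → M p) (o-H : ∀ x → H (x - o x) ≡ true) (o-const : ∀ x k → H k ≡ true → o (x + k) ≡ o x)
    (uniform : ∀ x y k k' → H k ≡ true → H k' ≡ true → k ≢ 0ₘ → k' ≢ 0ₘ → c ((o y - o x) + k) ≡ c ((o y - o x) + k')) where
    open SolveM

    offset : M p → M p
    offset x = x - o x

    private
      offset-diff : ∀ x y → y - x ≡ (o y - o x) + (offset y - offset x)
      offset-diff x y = abel (x₁ ⊖ x₀) ((x₃ ⊖ x₂) ⊕ ((x₁ ⊖ x₃) ⊖ (x₀ ⊖ x₂))) refl (x ∷ y ∷ o x ∷ o y ∷ [])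

      -≡0 : ∀ {x y} → x - y ≡ 0ₘ → y ≡ x
      -≡0 {x} {y} e = sym (trans (abel x₀ (x₀ ⊖ x₁ ⊕ x₁) refl (x ∷ y ∷ [])) (trans (cong (_+ y) e) (abel (𝟘 ⊕ x₀) x₀ refl (y ∷ []))))

    -- y - x is a difference of base points plus a difference of offsets. The former agree by
    -- assumption, and by `uniform` the latter matter only through being zero or not.
    col-o : ∀ x y x' y' → o x ≡ o x' → o y ≡ o y' → (offset x ≡ offset y → offset x' ≡ offset y') →
            (offset x' ≡ offset y' → offset x ≡ offset y) → col x y ≡ col x' y'
    col-o x y x' y' ex ey f f' = trans (col-c x y) (trans (cong c (offset-diff x y)) (trans (same (offset x ≟M offset y))
        (trans (cong₂ (λ u v → c ((v - u) + k')) ex ey) (sym (trans (col-c x' y') (cong c (offset-diff x' y')))))))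
      where
      k = offset y - offset x
      k' = offset y' - offset x'
      diff-H : ∀ x y → H (offset y - offset x) ≡ true
      diff-H x y = IsSub.has-+ H-sub _ _ (o-H y) (sub-neg H-sub _ (o-H x))
      same : Dec (offset x ≡ offset y) → c ((o y - o x) + k) ≡ c ((o y - o x) + k')
      same (no ne) = uniform x y k k' (diff-H x y) (diff-H x' y') (ne ∘ -≡0) (ne ∘ f' ∘ -≡0)
      same (yes eq) = cong (λ z → c ((o y - o x) + z)) (trans (vanish (sym eq)) (sym (vanish (sym (f eq)))))
        where
        vanish : ∀ {u v} → u ≡ v → u - v ≡ 0ₘ
        vanish {u} refl = abel (x₀ ⊖ x₀) 𝟘 refl (u ∷ [])

    o-offset : ∀ x → o x + offset x ≡ x
    o-offset x = abel (x₁ ⊕ (x₀ ⊖ x₁)) x₀ refl (x ∷ o x ∷ [])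

    o-o : ∀ x → o (o x) ≡ o x
    o-o x = trans (cong o (abel x₁ (x₀ ⊕ ⊝ (x₀ ⊖ x₁)) refl (x ∷ o x ∷ []))) (o-const x (- offset x) (sub-neg H-sub _ (o-H x)))

    o-at : ∀ x k → H k ≡ true → o (o x + k) ≡ o x
    o-at x k Hk = trans (o-const (o x) k Hk) (o-o x)

    offset-at : ∀ x k → H k ≡ true → offset (o x + k) ≡ k
    offset-at x k Hk = trans (cong (λ z → (o x + k) - z) (o-at x k Hk)) (abel (x₀ ⊕ x₁ ⊖ x₀) x₁ refl (o x ∷ k ∷ []))

    o-E : ∀ {x y} → E x y ≡ true → o x ≡ o y
    o-E {x} {y} e = trans (sym (o-const x (y - x) (trans (sym (E-H x y)) e))) (cong o (abel (x₀ ⊕ (x₁ ⊖ x₀)) x₁ refl (x ∷ y ∷ [])))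

    -- The orbits of Sym(H) on pairs: base points are kept, and of two offsets only their equality
    -- is invariant.
    d : Coloring (M p)
    d x y = code (o x) (o y) ⌊ offset x ≟M offset y ⌋

    same-offset : M p → M p → Bool
    same-offset x y = ⌊ offset x ≟M offset y ⌋

    d-injective : ∀ x y x' y' → d x y ≡ d x' y' → o x ≡ o x' × o y ≡ o y' × same-offset x y ≡ same-offset x' y'
    d-injective x y x' y' e = code-injective {o x} {o y} {same-offset x y} {o x'} {o y'} {same-offset x' y'} e

    module Act (τ τ' : M p → M p) (ττ' : ∀ x → τ (τ' x) ≡ x) (τ'τ : ∀ x → τ' (τ x) ≡ x)
               (τ-H : ∀ k → H k ≡ true → H (τ k) ≡ true) (τ'-H : ∀ k → H k ≡ true → H (τ' k) ≡ true) where
      act-inverse : ∀ (τ τ' : M p → M p) → (∀ x → τ' (τ x) ≡ x) → (∀ k → H k ≡ true → H (τ k) ≡ true) →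
        ∀ x → o (o x + τ (offset x)) + τ' (offset (o x + τ (offset x))) ≡ x
      act-inverse τ τ' τ'τ τ-H x = trans (cong₂ (λ u v → u + τ' v) (o-at x _ (τ-H _ (o-H x))) (offset-at x _ (τ-H _ (o-H x))))
        (trans (cong (o x +_) (τ'τ (offset x))) (o-offset x))

      g : M p ↔ M p
      g = mk↔ₛ′ (λ x → o x + τ (offset x)) (λ x → o x + τ' (offset x)) (act-inverse τ' τ ττ' τ'-H) (act-inverse τ τ' τ'τ τ-H)

      o-g : ∀ x → o (to g x) ≡ o x
      o-g x = o-at x _ (τ-H _ (o-H x))

      offset-g : ∀ x → offset (to g x) ≡ τ (offset x)
      offset-g x = offset-at x _ (τ-H _ (o-H x))

      d-g : ∀ x y → d (to g x) (to g y) ≡ d x y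
      d-g x y = trans (cong₂ (λ u v → code u v ⌊ offset (to g x) ≟M offset (to g y) ⌋) (o-g x) (o-g y)) (cong (code (o x) (o y)) (bool-ext
        (λ h → diag-intro (trans (sym (τ'τ (offset x))) (trans (cong τ' (trans (sym (offset-g x)) (trans (diag-elim h) (offset-g y)))) (τ'τ (offset y)))))
        (λ h → diag-intro (trans (offset-g x) (trans (cong τ (diag-elim h)) (sym (offset-g y)))))))

    homogeneous : ∀ α β α' β' → d α β ≡ d α' β' → ∃ λ (g : M p ↔ M p) → (∀ x y → d (to g x) (to g y) ≡ d x y) × to g α ≡ α' × to g β ≡ β'
    homogeneous α β α' β' e = A.g , A.d-g , moves α α' (proj₁ parts) τα , moves β β' (proj₁ (proj₂ parts)) τβ
      where
      parts : o α ≡ o α' × o β ≡ o β' × ⌊ offset α ≟M offset β ⌋ ≡ ⌊ offset α' ≟M offset β' ⌋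
      parts = d-injective α β α' β' e
      k = offset β
      h' = offset α'
      k' = offset β'
      -- τ₁ takes the offset of α to that of α'. Then τ₂ puts the offset of β right; it leaves that
      -- of α' alone because α, β and α', β' agree on whether their offsets coincide.
      τ₁ : M p → M p
      τ₁ = swap (offset α) h'
      τ₁-H : ∀ z → H z ≡ true → H (τ₁ z) ≡ true
      τ₁-H = swap-preserves H (o-H α) (o-H α')
      τ₂ : M p → M p
      τ₂ = swap (τ₁ k) k'
      τ₂-H : ∀ z → H z ≡ true → H (τ₂ z) ≡ true
      τ₂-H = swap-preserves H (τ₁-H k (o-H β)) (o-H β')
      module A = Act (τ₂ ∘ τ₁) (τ₁ ∘ τ₂)
        (λ x → trans (cong τ₂ (swap-involutive (offset α) h' (τ₂ x))) (swap-involutive (τ₁ k) k' x))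
        (λ x → trans (cong τ₁ (swap-involutive (τ₁ k) k' (τ₁ x))) (swap-involutive (offset α) h' x))
        (λ z Hz → τ₂-H (τ₁ z) (τ₁-H z Hz)) (λ z Hz → τ₁-H (τ₂ z) (τ₂-H z Hz))
      τβ : τ₂ (τ₁ (offset β)) ≡ offset β'
      τβ = swap-left (τ₁ k) k'
      τα : τ₂ (τ₁ (offset α)) ≡ offset α'
      τα = trans (cong τ₂ (swap-left (offset α) h')) (cases (offset α ≟M offset β))
        where
        cases : Dec (offset α ≡ offset β) → τ₂ h' ≡ h'
        cases (yes eq) = trans (cong τ₂ h'≡k') (trans (swap-right (τ₁ k) k') (trans (cong τ₁ (sym eq)) (swap-left (offset α) h')))
          where
          h'≡k' : h' ≡ k'
          h'≡k' = diag-elim (trans (sym (proj₂ (proj₂ parts))) (diag-intro eq))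
        cases (no ne) = swap-other
          (λ eq → ne (trans (sym (swap-involutive (offset α) h' (offset α))) (trans (cong τ₁ (trans (swap-left (offset α) h') eq)) (swap-involutive (offset α) h' k))))
          (λ eq → ne (diag-elim (trans (proj₂ (proj₂ parts)) (diag-intro eq))))
      moves : ∀ x x' → o x ≡ o x' → τ₂ (τ₁ (offset x)) ≡ offset x' → o x + τ₂ (τ₁ (offset x)) ≡ x'
      moves x x' eo ep = trans (cong₂ _+_ eo ep) (o-offset x')

    d-cc : SM.IsCC p d
    d-cc = schurian d homogeneous
      (λ x y x' y' e → let (a , b , f) = d-injective x y x' y' e in
        trans (cong (λ w → code (o y) (o x) w) (trans (symᵇ (offset y) (offset x)) (trans f (symᵇ (offset x') (offset y'))))) (cong₂ (λ u v → code u v ⌊ offset y' ≟M offset x' ⌋) b a))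
      (λ x x' y' e → let (a , b , f) = d-injective x x x' y' e in
        trans (sym (o-offset x')) (trans (cong₂ _+_ (trans (sym a) b) (diag-elim (trans (sym f) (diag-intro {offset x} refl)))) (o-offset y')))
      where
      symᵇ : ∀ u v → ⌊ u ≟M v ⌋ ≡ ⌊ v ≟M u ⌋
      symᵇ u v = bool-ext (λ h → diag-intro (sym (diag-elim h))) (λ h → diag-intro (sym (diag-elim h)))

    d-coarser : ∀ x y x' y' → d x y ≡ d x' y' → col' x y ≡ col' x' y'
    d-coarser = coarser d d-cc
      (λ x y x' y' e → let (a , b , f) = d-injective x y x' y' e in
        col-o x y x' y' a b (λ h → diag-elim (trans (sym f) (diag-intro h))) (λ h → diag-elim (trans f (diag-intro h))))
      (λ x x' y' e → let (a , b , f) = d-injective x x x' y' e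
                         offset-eq = diag-elim (trans (sym f) (diag-intro {offset x} refl)) in
        trans (sym (o-offset x')) (trans (cong₂ _+_ (trans (sym a) b) offset-eq) (o-offset y')) ,
        trans (E-H x x') (trans (cong H (trans (cong₂ _-_ (sym (o-offset x')) (sym (o-offset x))) (trans (cong (λ u → u + offset x' - (o x + offset x)) (sym a))
            (abel (x₀ ⊕ x₁ ⊖ (x₀ ⊕ x₂)) (x₁ ⊖ x₂) refl (o x ∷ offset x' ∷ offset x ∷ [])))))
          (IsSub.has-+ H-sub _ _ (o-H x') (sub-neg H-sub _ (o-H x)))))

    fib-≡ : ∀ {a} {u v : SM.Fib p col' a} → proj₁ u ≡ proj₁ v → u ≡ v
    fib-≡ {u = x , h} {.x , h'} refl = cong (x ,_) (T-irrelevant h h')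

    quasitrivial : SM.Quasitrivial p col'
    quasitrivial a π = A.g , (λ ab x y → cong (ℕ._≡ᵇ col' (proj₁ ab) (proj₂ ab)) (d-coarser _ _ _ _ (A.d-g x y))) , restricts
      where
      oa = o a
      fib-o : ∀ (u : SM.Fib p col' a) → o (proj₁ u) ≡ oa
      fib-o (x , h) = sym (o-E (fiber-E a x (sym (≡ᵇ-≡ (T⇒≡ h)))))
      -- All points of `oa + H` have the same loop colour under `d`, so the fiber of a is this whole
      -- coset.
      fib : ∀ k → H k ≡ true → SM.Fib p col' a
      fib k Hk = oa + k , ≡⇒T (≡ᵇ-true (d-coarser _ _ _ _
        (trans (cong₂ (λ u b → code u u b) (o-at a k Hk) (trans (diag-intro {offset (oa + k)} refl) (sym (diag-intro {offset a} refl)))) refl)))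
      fib-H : ∀ (u : SM.Fib p col' a) → H (proj₁ u - oa) ≡ true
      fib-H u = trans (cong (λ z → H (proj₁ u - z)) (sym (fib-o u))) (o-H (proj₁ u))
      -- A permutation of the fiber is transported to H and extended by the identity outside H.
      local : (SM.Fib p col' a → SM.Fib p col' a) → ∀ k → H k ≡ true ⊎ H k ≡ false → M p
      local f k (inj₁ Hk) = proj₁ (f (fib k Hk)) - oa
      local f k (inj₂ _) = k
      τ : (SM.Fib p col' a → SM.Fib p col' a) → M p → M p
      τ f k = local f k (decide (H k))
      local-irrelevant : ∀ f k Hk → ∀ s → local f k s ≡ proj₁ (f (fib k Hk)) - oa
      local-irrelevant f k Hk (inj₁ Hk') = cong (λ u → proj₁ (f u) - oa) (fib-≡ refl)
      local-irrelevant f k Hk (inj₂ no′) = true≢false Hk no′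
      τ-in : ∀ f k Hk → τ f k ≡ proj₁ (f (fib k Hk)) - oa
      τ-in f k Hk = local-irrelevant f k Hk (decide (H k))
      τ-H : ∀ f k → H k ≡ true → H (τ f k) ≡ true
      τ-H f k Hk = trans (cong H (τ-in f k Hk)) (fib-H (f (fib k Hk)))
      fib-back : ∀ u k Hk → k ≡ proj₁ u - oa → fib k Hk ≡ u
      fib-back u k Hk e = fib-≡ (trans (cong (oa +_) e) (abel (x₁ ⊕ (x₀ ⊖ x₁)) x₀ refl (proj₁ u ∷ oa ∷ [])))
      τ-inverse : ∀ f f' → (∀ u → f' (f u) ≡ u) → ∀ k → τ f' (τ f k) ≡ k
      τ-inverse f f' inv k = cases (decide (H k))
        where
        local-out : H k ≡ false → ∀ s → local f k s ≡ k
        local-out no′ (inj₁ Hk) = true≢false Hk no′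
        local-out no′ (inj₂ _) = refl
        local-out' : H k ≡ false → ∀ s → local f' k s ≡ k
        local-out' no′ (inj₁ Hk) = true≢false Hk no′
        local-out' no′ (inj₂ _) = refl
        cases : H k ≡ true ⊎ H k ≡ false → τ f' (τ f k) ≡ k
        cases (inj₁ Hk) = trans (τ-in f' (τ f k) (τ-H f k Hk))
          (trans (cong (λ u → proj₁ (f' u) - oa) (fib-back (f (fib k Hk)) (τ f k) (τ-H f k Hk) (τ-in f k Hk)))
            (trans (cong (λ u → proj₁ u - oa) (inv (fib k Hk))) (abel (x₁ ⊕ x₀ ⊖ x₁) x₀ refl (k ∷ oa ∷ []))))
        cases (inj₂ no′) = trans (cong (τ f') (local-out no′ (decide (H k)))) (local-out' no′ (decide (H k)))
      module A = Act (τ (to π)) (τ (from π)) (τ-inverse (from π) (to π) (strictlyInverseˡ π)) (τ-inverse (to π) (from π) (strictlyInverseʳ π))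
        (τ-H (to π)) (τ-H (from π))
      restricts : ∀ u → to A.g (proj₁ u) ≡ proj₁ (to π u)
      restricts u = begin
        o (proj₁ u) + τ (to π) (proj₁ u - o (proj₁ u))   ≡⟨ cong (λ z → z + τ (to π) (proj₁ u - z)) (fib-o u) ⟩
        oa + τ (to π) (proj₁ u - oa)                     ≡⟨ cong (oa +_) (τ-in (to π) (proj₁ u - oa) (fib-H u)) ⟩
        oa + (proj₁ (to π (fib _ (fib-H u))) - oa)       ≡⟨ abel (x₁ ⊕ (x₀ ⊖ x₁)) x₀ refl (_ ∷ oa ∷ []) ⟩
        proj₁ (to π (fib _ (fib-H u)))                   ≡⟨ cong (λ v → proj₁ (to π v)) (fib-back u _ (fib-H u) refl) ⟩
        proj₁ (to π u)                                   ∎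
        where open ≡-Reasoning

-- Fibers of the closure when H contains P

module LargeClosure (n : ℕ) (pr : Prime (suc n)) (5≤p : 5 ≤ suc n)
                    (col : Coloring (M (suc n))) (cay : IsCayleyM (suc n) col)
                    (E : BRel (M (suc n))) (inE : SM.InE (suc n) col E)
                    (col' : Coloring (M (suc n))) (cl : SM.IsClosureE (suc n) col E col') where
  open Closure n pr 5≤p col cay E inE col' cl public
  open Inverse using (to; from; strictlyInverseˡ; strictlyInverseʳ)
  open SolveM
  open KleinFacts

  module _ (min : Minimal H) (HP : ∀ d → H (el e₀ d) ≡ true) where
    whole-quasitrivial : (∀ v → S₀ v ≡ true) → SM.Quasitrivial p col'
    whole-quasitrivial full = Parallel.quasitrivial (λ _ → 0ₘ) (λ x → trans (H-S min HP (x - 0ₘ)) (full _)) (λ _ _ _ → refl)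
      λ x y k k' _ _ k≢0 k'≢0 → trans (one-class _ (k≢0 ∘ trans (drop k))) (sym (one-class _ (k'≢0 ∘ trans (drop k'))))
      where
      open WholeGroup min HP full
      drop : ∀ k → k ≡ (0ₘ - 0ₘ) + k
      drop k = abel x₀ ((𝟘 ⊖ 𝟘) ⊕ x₀) refl (k ∷ [])

    line-quasitrivial : ∀ t → (t == e₀) ≡ false → (∀ v → S₀ v ≡ line t v) → SM.Quasitrivial p col'
    line-quasitrivial t t≢0 S-line = Parallel.quasitrivial o o-H o-const uniform
      where
      open LineCosets min HP t t≢0 S-line
      pick : Bool → M p
      pick b = if b then 0ₘ else base
      o : M p → M p
      o x = pick (H x)
      o-H : ∀ x → H (x - o x) ≡ true
      o-H x = cases (decide (H x))
        where
        cases : H x ≡ true ⊎ H x ≡ false → H (x - o x) ≡ true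
        cases (inj₁ h) = trans (cong (λ b → H (x - pick b)) h) (trans (cong H (minus-0 x)) h)
        cases (inj₂ h) = trans (cong (λ b → H (x - pick b)) h) (trans (H-line (x - base)) (trans (base-line (vpart x)) (cong not (trans (sym (H-line x)) h))))
      o-const : ∀ x k → H k ≡ true → o (x + k) ≡ o x
      o-const x k Hk = cong pick (trans (H-line (x + k)) (trans (line-translate t (vpart x) (vpart k) (trans (sym (H-line k)) Hk)) (sym (H-line x))))
      base-neg : - base ≡ base
      base-neg = cong (el _) (SolveP.abel (SolveP.⊝_ SolveP.𝟘) SolveP.𝟘 refl [])
      -- `base` is its own inverse, so the four differences of base points take two values only.
      differences : ∀ b b' → pick b' - pick b ≡ 0ₘ ⊎ pick b' - pick b ≡ base
      differences true true = inj₁ (abel (𝟘 ⊖ 𝟘) 𝟘 refl [])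
      differences true false = inj₂ (minus-0 base)
      differences false true = inj₂ (trans (abel (𝟘 ⊖ x₀) (⊝ x₀) refl (base ∷ [])) base-neg)
      differences false false = inj₁ (abel (x₀ ⊖ x₀) 𝟘 refl (base ∷ []))
      uniform : ∀ x y k k' → H k ≡ true → H k' ≡ true → k ≢ 0ₘ → k' ≢ 0ₘ → c ((o y - o x) + k) ≡ c ((o y - o x) + k')
      uniform x y k k' Hk Hk' k≢0 k'≢0 = cases (differences (H x) (H y))
        where
        zeroˡ : ∀ k → 0ₘ + k ≡ k
        zeroˡ k = abel (𝟘 ⊕ x₀) x₀ refl (k ∷ [])
        cases : o y - o x ≡ 0ₘ ⊎ o y - o x ≡ base → c ((o y - o x) + k) ≡ c ((o y - o x) + k')
        cases (inj₁ e) = trans (cong (λ z → c (z + k)) e) (trans (trans (cong c (zeroˡ k)) (trans (one-class k Hk k≢0)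
          (sym (trans (cong c (zeroˡ k')) (one-class k' Hk' k'≢0))))) (cong (λ z → c (z + k')) (sym e)))
        cases (inj₂ e) = trans (cong (λ z → c (z + k)) e) (trans (trans (off-base k Hk k≢0) (sym (off-base k' Hk' k'≢0))) (cong (λ z → c (z + k')) (sym e)))

  -- H = P: the closure as a function of differences

  module Cosets (H-P : ∀ x → H x ≡ isP x) where
    E-vpart : ∀ {x y} → E x y ≡ true → vpart x ≡ vpart y
    E-vpart {x} {y} e = sym (trans (sym (double-V (vpart x) (vpart y))) (trans (cong (vpart x +ᵥ_) (+ᵥ-comm (vpart x) (vpart y)))
      (trans (cong (vpart x +ᵥ_) (==-≡ (trans (sym (H-P (y - x))) (trans (sym (E-H x y)) e)))) (trans (+ᵥ-comm (vpart x) e₀) (zeroˡ (vpart x))))))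
      where
      zeroˡ : ∀ v → e₀ +ᵥ v ≡ v
      zeroˡ v = cong vpart (abel (𝟘 ⊕ x₀) x₀ refl (el v 0ₚ ∷ []))

    vpart-E : ∀ {x y} → vpart x ≡ vpart y → E x y ≡ true
    vpart-E {x} {y} e = trans (E-H x y) (trans (H-P (y - x)) (trans (cong (λ v → (v +ᵥ vpart x) == e₀) (sym e)) (cong (_== e₀) (self-inverseᵥ (vpart x)))))

    diff : M p → M p → Fin p
    diff x y = ppart y +ₚ (-ₚ ppart x)

    -- The orbits of P acting on pairs by translation; the last argument `true` only fills the flag
    -- of `code`.
    orbit : Coloring (M p)
    orbit x y = code (el (vpart x) 0ₚ) (el (vpart y) (diff x y)) true

    orbit-injective : ∀ x y x' y' → orbit x y ≡ orbit x' y' → vpart x ≡ vpart x' × vpart y ≡ vpart y' × diff x y ≡ diff x' y'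
    orbit-injective x y x' y' e =
      let (a , b , _) = code-injective {el (vpart x) 0ₚ} {el (vpart y) (diff x y)} {true} {el (vpart x') 0ₚ} {el (vpart y') (diff x' y')} {true} e in
      cong vpart a , cong vpart b , cong ppart b

    orbit-cong : ∀ {x y x' y'} → vpart x ≡ vpart x' → vpart y ≡ vpart y' → diff x y ≡ diff x' y' → orbit x y ≡ orbit x' y'
    orbit-cong a b e = cong₂ (λ u v → code u v true) (cong (λ v → el v 0ₚ) a) (cong₂ el b e)

    shift-by : M p → M p ↔ M p
    shift-by g = mk↔ₛ′ (_+ g) (_- g) (λ x → abel (x₀ ⊖ x₁ ⊕ x₁) x₀ refl (x ∷ g ∷ [])) (λ x → abel (x₀ ⊕ x₁ ⊖ x₁) x₀ refl (x ∷ g ∷ []))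

    move : ∀ x x' → vpart x ≡ vpart x' → x + el e₀ (diff x x') ≡ x'
    move x x' e = cong₂ el (trans (cong vpart (+-zeroʳ x)) e)
      (SolveP.abel (SolveP._⊕_ SolveP.x₀ (SolveP._⊖_ SolveP.x₁ SolveP.x₀)) SolveP.x₁ refl (ppart x ∷ ppart x' ∷ []))

    diff-0 : ∀ x y → diff x y ≡ 0ₚ → ppart x ≡ ppart y
    diff-0 x y e = sym (trans (SolveP.abel SolveP.x₁ (SolveP._⊕_ (SolveP._⊖_ SolveP.x₁ SolveP.x₀) SolveP.x₀) refl (ppart x ∷ ppart y ∷ []))
      (trans (cong (_+ₚ ppart x) e) (+ₚ-identityˡ (ppart x))))

    orbit-cc : SM.IsCC p orbit
    orbit-cc = schurian orbit homogeneous
      (λ x y x' y' e → let (a , b , f) = orbit-injective x y x' y' e in orbit-cong {y} {x} {y'} {x'} b a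
        (trans (flip x y) (trans (cong -ₚ_ f) (sym (flip x' y')))))
      (λ x x' y' e → let (a , b , f) = orbit-injective x x x' y' e in
        cong₂ el (trans (sym a) b) (diff-0 x' y' (trans (sym f) (-ₚ-inverseʳ (ppart x)))))
      where
      flip : ∀ x y → diff y x ≡ -ₚ (diff x y)
      flip x y = SolveP.abel (SolveP._⊖_ SolveP.x₀ SolveP.x₁) (SolveP.⊝_ (SolveP._⊖_ SolveP.x₁ SolveP.x₀)) refl (ppart x ∷ ppart y ∷ [])
      homogeneous : ∀ α β α' β' → orbit α β ≡ orbit α' β' → ∃ λ (g : M p ↔ M p) → (∀ x y → orbit (to g x) (to g y) ≡ orbit x y) × to g α ≡ α' × to g β ≡ β'
      homogeneous α β α' β' e = let (a , b , f) = orbit-injective α β α' β' e in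
        shift-by g , (λ x y → orbit-cong {x + g} {y + g} {x} {y} (cong vpart (+-zeroʳ x)) (cong vpart (+-zeroʳ y))
          (SolveP.abel (SolveP._⊖_ (SolveP._⊕_ SolveP.x₁ SolveP.x₂) (SolveP._⊕_ SolveP.x₀ SolveP.x₂)) (SolveP._⊖_ SolveP.x₁ SolveP.x₀) refl (ppart x ∷ ppart y ∷ diff α α' ∷ []))) ,
        move α α' a , trans (cong (λ d → β + el e₀ d) (same-shift f)) (move β β' b)
        where
        g : M p
        g = el e₀ (diff α α')
        same-shift : diff α β ≡ diff α' β' → diff α α' ≡ diff β β'
        same-shift f = trans (SolveP.abel (SolveP._⊖_ SolveP.x₂ SolveP.x₀) (SolveP._⊖_ SolveP.x₃ (SolveP._⊕_ SolveP.x₀ (SolveP._⊖_ SolveP.x₃ SolveP.x₂))) refl (ppart α ∷ ppart β ∷ ppart α' ∷ ppart β' ∷ []))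
          (trans (cong (λ d → ppart β' +ₚ (-ₚ (ppart α +ₚ d))) (sym f))
            (SolveP.abel (SolveP._⊖_ SolveP.x₃ (SolveP._⊕_ SolveP.x₀ (SolveP._⊖_ SolveP.x₁ SolveP.x₀))) (SolveP._⊖_ SolveP.x₃ SolveP.x₁) refl (ppart α ∷ ppart β ∷ ppart α' ∷ ppart β' ∷ [])))

    orbit-coarser : ∀ x y x' y' → vpart x ≡ vpart x' → vpart y ≡ vpart y' → diff x y ≡ diff x' y' → col' x y ≡ col' x' y'
    orbit-coarser x y x' y' a b e = coarser orbit orbit-cc
      (λ x y x' y' e → let (a , b , f) = orbit-injective x y x' y' e in
        trans (col-c x y) (trans (cong c (cong₂ el (cong₂ _+ᵥ_ b a) f)) (sym (col-c x' y'))))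
      (λ x x' y' e → let (a , b , f) = orbit-injective x x x' y' e in
        cong₂ el (trans (sym a) b) (diff-0 x' y' (trans (sym f) (-ₚ-inverseʳ (ppart x)))) , vpart-E a)
      x y x' y' (orbit-cong {x} {y} {x'} {y'} a b e)

    shift' : ∀ g x y x' y' → col' x y ≡ col' x' y' → col' (x + g) (y + g) ≡ col' (x' + g) (y' + g)
    -- `closure-perm` deduces equality of colours before σ from equality after it, hence the inverse
    -- translation.
    shift' g x y x' y' e = closure-perm (shift-by (- g))
      (λ x y x' y' h → trans (sym (col-shift x y (- g))) (trans h (col-shift x' y' (- g))))
      (λ x y h → trans (E-H x y) (trans (cong H (abel (x₁ ⊖ x₀) (x₁ ⊖ x₂ ⊖ (x₀ ⊖ x₂)) refl (x ∷ y ∷ g ∷ []))) (trans (sym (E-H _ _)) h)))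
      (x + g) (y + g) (x' + g) (y' + g)
      (trans (cong₂ col' (cancel x) (cancel y)) (trans e (sym (cong₂ col' (cancel x') (cancel y')))))
      where
      cancel : ∀ x → x + g + - g ≡ x
      cancel x = abel (x₀ ⊕ x₁ ⊖ x₁) x₀ refl (x ∷ g ∷ [])

    multiplier' : ∀ u → u ≢ 0ₚ → ∀ x y x' y' → col' x y ≡ col' x' y' → col' (μ u x) (μ u y) ≡ col' (μ u x') (μ u y')
    multiplier' u u≢0 x y x' y' e = closure-perm scaling
      (λ x y x' y' h → trans (trans (col-c x y) (back (trans (sym (dist x y)) (trans h (dist x' y'))))) (sym (col-c x' y')))
      (λ x y h → vpart-E (E-vpart h))
      (μ u x) (μ u y) (μ u x') (μ u y')
      (trans (cong₂ col' (vu-id x) (vu-id y)) (trans e (sym (cong₂ col' (vu-id x') (vu-id y')))))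
      where
      v : Fin p
      v = proj₁ (inverse u u≢0)
      vu : v *ₚ u ≡ 1ₚ
      vu = proj₂ (inverse u u≢0)
      vu-id : ∀ x → μ v (μ u x) ≡ x
      vu-id = μ-inverse vu
      uv-id : ∀ x → μ u (μ v x) ≡ x
      uv-id = μ-inverse (trans (*ₚ-comm u v) vu)
      scaling : M p ↔ M p
      scaling = mk↔ₛ′ (μ v) (μ u) vu-id uv-id
      μ-- : ∀ x y → μ v (y - x) ≡ μ v y - μ v x
      μ-- x y = trans (abel x₀ (x₀ ⊕ x₁ ⊖ x₁) refl (μ v (y - x) ∷ μ v x ∷ []))
        (cong (_- μ v x) (trans (sym (μ-+ v (y - x) x)) (cong (μ v) (abel (x₁ ⊖ x₀ ⊕ x₀) x₁ refl (x ∷ y ∷ [])))))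
      dist : ∀ x y → col (μ v x) (μ v y) ≡ c (μ v (y - x))
      dist x y = trans (col-c _ _) (cong c (sym (μ-- x y)))
      back : ∀ {z z'} → c (μ v z) ≡ c (μ v z') → c z ≡ c z'
      back {z} {z'} h = subst₂ (λ a b → c a ≡ c b) (uv-id z) (uv-id z') (multiplier u u≢0 _ _ h)

    transpose' : ∀ x y x' y' → col' x y ≡ col' x' y' → col' y x ≡ col' y' x'
    transpose' x y x' y' e = let ((a , b) , h) = C'.transp y' x' in
      ≡ᵇ-≡ (trans (h x y) (≡ᵇ-true (trans e (≡ᵇ-≡ (trans (sym (h x' y')) (≡ᵇ-true {col' y' x'} refl))))))

    abstract
      -- The analogue of `split` for the closure: a positive intersection number is positive for
      -- every pair of that colour.
      path : ∀ {α β α' β'} → col' α β ≡ col' α' β' → ∀ γ → ∃ λ γ' → col' α' γ' ≡ col' α γ × col' γ' β' ≡ col' γ β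
      path {α} {β} {α'} {β'} e γ = found (∑-witness (through α' β') λ z → witness-∑ (through α β) γ
          (true-∧ (≡ᵇ-true {col' α γ} refl) (≡ᵇ-true {col' γ β} refl))
          (trans (sym (count-∑ₑ p (through α β))) (trans (C'.coh α γ γ β α β α β α' β' (basis-refl col' α β) (≡⇒T (≡ᵇ-true (sym e))))
            (trans (count-∑ₑ p (through α' β')) z))))
        where
        through : M p → M p → M p → Bool
        through x y z = basis col' α γ x z ∧ basis col' γ β z y
        found : (∃ λ z → through α' β' z ≡ true) → ∃ λ γ' → col' α' γ' ≡ col' α γ × col' γ' β' ≡ col' γ β
        found (z , h) = z , ≡ᵇ-≡ (proj₁ (∧-true h)) , ≡ᵇ-≡ (proj₂ (∧-true {basis col' α γ α' z} h))

    -- With y itself as the middle point, the transported middle point z has (z , y') coloured like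
    -- the loop at y. So z = y', and y and y' lie in one fiber.
    target' : ∀ x y x' y' → col' x y ≡ col' x' y' → vpart y ≡ vpart y'
    target' x y x' y' e = let (z , _ , h) = path e y in
      E-vpart (fiber-E y y' (trans (sym h) (cong (λ w → col' w y') (diagonal' y z y' (sym h)))))

    -- By invariance under P, the colour of a pair depends only on the two cosets and the difference
    -- of the P-parts; see `col'-W`.
    W : V → V → Fin p → ℕ
    W v w d = col' (el v 0ₚ) (el w d)

    0-0≡0 : 0ₚ +ₚ (-ₚ 0ₚ) ≡ 0ₚ
    0-0≡0 = -ₚ-inverseʳ 0ₚ

    minus-0ₚ : ∀ z → z +ₚ (-ₚ 0ₚ) ≡ z
    minus-0ₚ z = SolveP.abel (SolveP._⊖_ SolveP.x₀ SolveP.𝟘) SolveP.x₀ refl (z ∷ [])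

    col'-W : ∀ x y → col' x y ≡ W (vpart x) (vpart y) (diff x y)
    col'-W x y = orbit-coarser x y (el (vpart x) 0ₚ) (el (vpart y) (diff x y)) refl refl (sym (minus-0ₚ (diff x y)))

    W-scale : ∀ v w u → u ≢ 0ₚ → ∀ d d' → W v w d ≡ W v w d' → W v w (u *ₚ d) ≡ W v w (u *ₚ d')
    W-scale v w u u≢0 d d' e = subst (λ z → col' (el v z) (el w (u *ₚ d)) ≡ col' (el v z) (el w (u *ₚ d'))) (*-zeroʳ u)
      (multiplier' u u≢0 (el v 0ₚ) (el w d) (el v 0ₚ) (el w d') e)

    W-diagonal : ∀ v d → W v v d ≡ W v v 0ₚ → d ≡ 0ₚ
    W-diagonal v d e = cong ppart (sym (diagonal' (el v 0ₚ) (el v 0ₚ) (el v d) (sym e)))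

    W-shift : ∀ v d d' → W e₀ e₀ d ≡ W e₀ e₀ d' → W v v d ≡ W v v d'
    W-shift v d d' e = trans (sym (moved d)) (trans (shift' (el v 0ₚ) (el e₀ 0ₚ) (el e₀ d) (el e₀ 0ₚ) (el e₀ d') e) (moved d'))
      where
      moved : ∀ d → col' (el e₀ 0ₚ + el v 0ₚ) (el e₀ d + el v 0ₚ) ≡ W v v d
      moved d = cong₂ col' (abel (𝟘 ⊕ x₀) x₀ refl (el v 0ₚ ∷ [])) (cong₂ el (cong vpart (abel (𝟘 ⊕ x₀) x₀ refl (el v 0ₚ ∷ []))) (+ₚ-zeroʳ d))

    W-unshift : ∀ v d d' → W v v d ≡ W v v d' → W e₀ e₀ d ≡ W e₀ e₀ d'
    W-unshift v d d' e = trans (sym (moved d)) (trans (shift' (el v 0ₚ) (el v 0ₚ) (el v d) (el v 0ₚ) (el v d') e) (moved d'))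
      where
      moved : ∀ d → col' (el v 0ₚ + el v 0ₚ) (el v d + el v 0ₚ) ≡ W e₀ e₀ d
      moved d = cong₂ col' (cong₂ el (self-inverseᵥ v) (+ₚ-zeroʳ 0ₚ)) (cong₂ el (self-inverseᵥ v) (+ₚ-zeroʳ d))

    module RankTwo (constant : ∀ d → d ≢ 0ₚ → W e₀ e₀ d ≡ W e₀ e₀ 1ₚ) where
      -- Either (0 , 0) sees all of the coset u + P in one colour, or it sees (u , 0) in a colour of its own; in
      -- the latter case W e₀ u 0 is a matching, which carries the constancy of W e₀ e₀ over to W e₀ u.
      W-constant : ∀ u d d' → d ≢ 0ₚ → d' ≢ 0ₚ → W e₀ u d ≡ W e₀ u d'
      W-constant u d d' d≢0 d'≢0 = cases (decide (W e₀ u d ℕ.≡ᵇ W e₀ u 0ₚ))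
        where
        through-path : (∃ λ γ → col' (el e₀ 0ₚ) γ ≡ W e₀ u d × col' γ (el e₀ d') ≡ col' (el u d) (el e₀ d)) → (∀ {z} → W e₀ u z ≡ W e₀ u 0ₚ → z ≡ 0ₚ) → W e₀ u d ≡ W e₀ u d'
        through-path (γ , e , f) matching = trans (sym e) (cong (col' (el e₀ 0ₚ)) γ≡)
          where
          vγ : vpart γ ≡ u
          vγ = target' (el e₀ 0ₚ) γ (el e₀ 0ₚ) (el u d) e
          back : W e₀ u (diff (el e₀ d') γ) ≡ W e₀ u 0ₚ
          back = begin
            W e₀ u (diff (el e₀ d') γ)              ≡⟨ cong (λ v → W e₀ v (diff (el e₀ d') γ)) vγ ⟨
            W e₀ (vpart γ) (diff (el e₀ d') γ)      ≡⟨ col'-W (el e₀ d') γ ⟨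
            col' (el e₀ d') γ                       ≡⟨ transpose' _ _ _ _ f ⟩
            col' (el e₀ d) (el u d)                 ≡⟨ col'-W (el e₀ d) (el u d) ⟩
            W e₀ u (d +ₚ (-ₚ d))                    ≡⟨ cong (W e₀ u) (-ₚ-inverseʳ d) ⟩
            W e₀ u 0ₚ                               ∎
            where open ≡-Reasoning
          γ≡ : γ ≡ el u d'
          γ≡ = cong₂ el vγ (sym (diff-0 (el e₀ d') γ (matching back)))
        cases : (W e₀ u d ℕ.≡ᵇ W e₀ u 0ₚ) ≡ true ⊎ (W e₀ u d ℕ.≡ᵇ W e₀ u 0ₚ) ≡ false → W e₀ u d ≡ W e₀ u d'
        cases (inj₁ h) = let (r , r≢0 , rd) = ratio d'≢0 d≢0 in
          trans (≡ᵇ-≡ h) (sym (subst₂ (λ a b → W e₀ u a ≡ W e₀ u b) rd (*-zeroʳ r) (W-scale e₀ u r r≢0 d 0ₚ (≡ᵇ-≡ h))))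
        cases (inj₂ h) = through-path (path (trans (constant d d≢0) (sym (constant d' d'≢0))) (el u d)) matching
          where
          matching : ∀ {z} → W e₀ u z ≡ W e₀ u 0ₚ → z ≡ 0ₚ
          matching {z} e = by-zero (z ≟F 0ₚ)
            where
            by-zero : Dec (z ≡ 0ₚ) → z ≡ 0ₚ
            by-zero (yes z≡0) = z≡0
            by-zero (no z≢0) = let (r , r≢0 , rz) = ratio d≢0 z≢0 in
              true≢false (≡ᵇ-true (subst₂ (λ a b → W e₀ u a ≡ W e₀ u b) rz (*-zeroʳ r) (W-scale e₀ u r r≢0 z 0ₚ e))) h

      quasitrivial : SM.Quasitrivial p col'
      quasitrivial = Parallel.quasitrivial (λ x → el (vpart x) 0ₚ)
        (λ x → trans (H-P _) (cong (_== e₀) (self-inverseᵥ (vpart x))))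
        (λ x k Hk → cong (λ v → el v 0ₚ) (trans (cong (vpart x +ᵥ_) (==-≡ (trans (sym (H-P k)) Hk))) (cong vpart (+-zeroʳ x))))
        λ x y k k' Hk Hk' k≢0 k'≢0 → uniform (vpart y +ᵥ vpart x) k k' (trans (sym (H-P k)) Hk) (trans (sym (H-P k')) Hk') k≢0 k'≢0
        where
        uniform : ∀ u k k' → isP k ≡ true → isP k' ≡ true → k ≢ 0ₘ → k' ≢ 0ₘ → c (el u (0ₚ +ₚ (-ₚ 0ₚ)) + k) ≡ c (el u (0ₚ +ₚ (-ₚ 0ₚ)) + k')
        uniform u k k' Pk Pk' k≢0 k'≢0 = trans (cong c (sum k Pk)) (trans (trans (sym (col-el (ppart k)))
            (trans (finer _ _ _ _ (W-constant u (ppart k) (ppart k') (λ e → k≢0 (cong₂ el (==-≡ Pk) e)) (λ e → k'≢0 (cong₂ el (==-≡ Pk') e))))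
              (col-el (ppart k')))) (sym (cong c (sum k' Pk'))))
          where
          col-el : ∀ d → col (el e₀ 0ₚ) (el u d) ≡ c (el u d)
          col-el d = refl
          sum : ∀ k → isP k ≡ true → el u (0ₚ +ₚ (-ₚ 0ₚ)) + k ≡ el u (ppart k)
          sum k Pk = cong₂ el (trans (cong (u +ᵥ_) (==-≡ Pk)) (cong vpart (+-zeroʳ (el u 0ₚ))))
            (trans (cong (_+ₚ ppart k) 0-0≡0) (+ₚ-identityˡ (ppart k)))

    -- Fibers as cyclotomic schemes

    module Cyclotomic (d₀ : Fin p) (d₀≢0 : d₀ ≢ 0ₚ) (different : W e₀ e₀ d₀ ≢ W e₀ e₀ 1ₚ) where
      -- The nonzero differences coloured like 1. They form a subgroup because scaling by a unit
      -- preserves equality of colours.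
      K : Fin p → Bool
      K d = not ⌊ d ≟F 0ₚ ⌋ ∧ (W e₀ e₀ d ℕ.≡ᵇ W e₀ e₀ 1ₚ)

      K-elim : ∀ {k} → K k ≡ true → k ≢ 0ₚ × W e₀ e₀ k ≡ W e₀ e₀ 1ₚ
      K-elim {k} h = let (a , b) = ∧-true {not ⌊ k ≟F 0ₚ ⌋} h in (λ e → true≢false (⌊≟⌋-true _≟F_ e) (not-true a)) , ≡ᵇ-≡ b

      K-intro : ∀ {k} → k ≢ 0ₚ → W e₀ e₀ k ≡ W e₀ e₀ 1ₚ → K k ≡ true
      K-intro k≢0 e = true-∧ (cong not (⌊≟⌋-false _≟F_ k≢0)) (≡ᵇ-true e)

      toℕ-* : ∀ k l → toℕ (k *ₚ l) ≡ modN p (toℕ k ℕ.* toℕ l)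
      toℕ-* k l = trans (cong toℕ (*ₚ-def k l)) (toℕ-⟦⟧ (toℕ k ℕ.* toℕ l))

      K-subgroup : IsAutSubgroup p K
      K-subgroup = record
        { hasOne = 1ₚ , ≡⇒T (K-intro 1≢0 refl) , toℕ-1
        ; nonzero = λ k h e → proj₁ (K-elim (T⇒≡ h)) (toℕ-injective (trans e (sym toℕ-0)))
        ; closed = λ k l hk hl → let (k≢0 , ek) = K-elim (T⇒≡ hk) ; (l≢0 , el′) = K-elim (T⇒≡ hl) in
            k *ₚ l , ≡⇒T (K-intro (λ e → l≢0 (*-cancel-0 k≢0 e))
              (trans (W-scale e₀ e₀ k k≢0 l 1ₚ el′) (trans (cong (W e₀ e₀) (*-identityʳ k)) ek))) , toℕ-* k l }

      K-proper : ProperK p K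
      K-proper = d₀ , (λ e → d₀≢0 (toℕ-injective (trans e (sym toℕ-0)))) , λ h → different (proj₂ (K-elim (T⇒≡ h)))

      diffMod-diff : ∀ x y → diffMod p (ppart x) (ppart y) ≡ toℕ (diff x y)
      diffMod-diff x y = sym (trans (cong toℕ (trans (cong₂ _+ₚ_ (sym (⟦toℕ⟧ (ppart y))) (-ₚ-def (ppart x))) (⟦⟧-+ (toℕ (ppart y)) (p ℕ.∸ toℕ (ppart x)))))
        (toℕ-⟦⟧ (toℕ (ppart y) ℕ.+ (p ℕ.∸ toℕ (ppart x)))))

      -- Scaling by the inverse of d' turns d and d' into d / d' and 1, so the quotient lies in K.
      orbit-K : ∀ d d' → W e₀ e₀ d ≡ W e₀ e₀ d' → ∃ λ k → K k ≡ true × d ≡ k *ₚ d'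
      orbit-K d d' e = cases (d' ≟F 0ₚ)
        where
        cases : Dec (d' ≡ 0ₚ) → ∃ λ k → K k ≡ true × d ≡ k *ₚ d'
        cases (yes z) = 1ₚ , K-intro 1≢0 refl , trans (W-diagonal e₀ d (trans e (cong (W e₀ e₀) z))) (sym (trans (*ₚ-identityˡ d') z))
        cases (no d'≢0) = let (k , k≢0 , kd) = ratio d≢0 d'≢0 ; (v , vd) = inverse d' d'≢0 in
            k , K-intro k≢0 (subst₂ (λ a b → W e₀ e₀ a ≡ W e₀ e₀ b) (reduce k v kd vd) vd (W-scale e₀ e₀ v (v≢0 vd) d d' e)) , sym kd
          where
          d≢0 : d ≢ 0ₚ
          d≢0 z = d'≢0 (W-diagonal e₀ d' (trans (sym e) (cong (W e₀ e₀) z)))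
          v≢0 : ∀ {v} → v *ₚ d' ≡ 1ₚ → v ≢ 0ₚ
          v≢0 vd z = 1≢0 (trans (sym vd) (trans (cong (_*ₚ d') z) (*-zeroˡ d')))
          reduce : ∀ k v → k *ₚ d' ≡ d → v *ₚ d' ≡ 1ₚ → v *ₚ d ≡ k
          reduce k v kd vd = trans (cong (v *ₚ_) (sym kd)) (trans (sym (*ₚ-assoc v k d')) (trans (cong (_*ₚ d') (*ₚ-comm v k))
            (trans (*ₚ-assoc k v d') (trans (cong (k *ₚ_) vd) (*-identityʳ k)))))

      K-orbit : ∀ d' k → K k ≡ true → W e₀ e₀ (k *ₚ d') ≡ W e₀ e₀ d'
      K-orbit d' k h = cases (d' ≟F 0ₚ)
        where
        cases : Dec (d' ≡ 0ₚ) → W e₀ e₀ (k *ₚ d') ≡ W e₀ e₀ d'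
        cases (yes refl) = cong (W e₀ e₀) (*-zeroʳ k)
        cases (no d'≢0) = subst₂ (λ a b → W e₀ e₀ a ≡ W e₀ e₀ b) (*ₚ-comm d' k) (*-identityʳ d') (W-scale e₀ e₀ d' d'≢0 k 1ₚ (proj₂ (K-elim h)))

      module _ (a : M p) where
        Fiber : Set
        Fiber = SM.Fib p col' a

        fiber-vpart : ∀ (x : Fiber) → vpart (proj₁ x) ≡ vpart a
        fiber-vpart (x , h) = E-vpart (fiber-E x a (≡ᵇ-≡ (T⇒≡ h)))

        -- The closure is invariant under P, so the fiber of a is its whole coset of P, with the
        -- P-part as a coordinate.
        fiber-point : Fin p → Fiber
        fiber-point d = el (vpart a) d , ≡⇒T (≡ᵇ-true (orbit-coarser _ _ a a refl refl (trans (-ₚ-inverseʳ d) (sym (-ₚ-inverseʳ (ppart a))))))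

        fiber-≡ : ∀ {u v : Fiber} → proj₁ u ≡ proj₁ v → u ≡ v
        fiber-≡ {x , h} {.x , h'} refl = cong (x ,_) (T-irrelevant h h')

        coordinate : Fiber ↔ Fin p
        coordinate = mk↔ₛ′ (ppart ∘ proj₁) fiber-point (λ _ → refl) (λ x → fiber-≡ (cong (λ v → el v (ppart (proj₁ x))) (sym (fiber-vpart x))))

        fiber-W : ∀ (x y : Fiber) → col' (proj₁ x) (proj₁ y) ≡ W (vpart a) (vpart a) (diff (proj₁ x) (proj₁ y))
        fiber-W x y = trans (col'-W (proj₁ x) (proj₁ y)) (cong₂ (λ u v → W u v (diff (proj₁ x) (proj₁ y))) (fiber-vpart x) (fiber-vpart y))

        relation : ∀ (u v x y : Fiber) → SM.homComp p col' a (u , v) x y ≡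
          cycRel p K (ppart (proj₁ u) , ppart (proj₁ v)) (ppart (proj₁ x)) (ppart (proj₁ y))
        relation u v x y = bool-ext forward backward
          where
          D D₀ : Fin p
          D = diff (proj₁ x) (proj₁ y)
          D₀ = diff (proj₁ u) (proj₁ v)
          multiplies : Fin p → Bool
          multiplies k = K k ∧ (diffMod p (ppart (proj₁ x)) (ppart (proj₁ y)) ℕ.≡ᵇ modN p (toℕ k ℕ.* diffMod p (ppart (proj₁ u)) (ppart (proj₁ v))))
          times-D₀ : ∀ k → toℕ (k *ₚ D₀) ≡ modN p (toℕ k ℕ.* diffMod p (ppart (proj₁ u)) (ppart (proj₁ v)))
          times-D₀ k = trans (toℕ-* k D₀) (cong (λ m → modN p (toℕ k ℕ.* m)) (sym (diffMod-diff (proj₁ u) (proj₁ v))))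

          forward : SM.homComp p col' a (u , v) x y ≡ true → anyFin p multiplies ≡ true
          forward h = let (k , Kk , e) = orbit-K D D₀ (W-unshift (vpart a) D D₀ (trans (sym (fiber-W x y)) (trans (≡ᵇ-≡ h) (fiber-W u v)))) in
            Enumeration.true-any (fin-enum p) multiplies k (true-∧ Kk (≡ᵇ-true (trans (diffMod-diff (proj₁ x) (proj₁ y)) (trans (cong toℕ e) (times-D₀ k)))))
          backward : anyFin p multiplies ≡ true → SM.homComp p col' a (u , v) x y ≡ true
          backward h = found (Enumeration.any-true (fin-enum p) multiplies h)
            where
            found : (∃ λ k → multiplies k ≡ true) → SM.homComp p col' a (u , v) x y ≡ true
            found (k , e) = ≡ᵇ-true (trans (fiber-W x y) (trans (W-shift (vpart a) D D₀ same) (sym (fiber-W u v))))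
              where
              parts : K k ≡ true × (diffMod p (ppart (proj₁ x)) (ppart (proj₁ y)) ℕ.≡ᵇ modN p (toℕ k ℕ.* diffMod p (ppart (proj₁ u)) (ppart (proj₁ v)))) ≡ true
              parts = ∧-true e
              D-eq : D ≡ k *ₚ D₀
              D-eq = toℕ-injective (trans (sym (diffMod-diff (proj₁ x) (proj₁ y))) (trans (≡ᵇ-≡ (proj₂ parts)) (sym (times-D₀ k))))
              same : W e₀ e₀ D ≡ W e₀ e₀ D₀
              same = trans (cong (W e₀ e₀) D-eq) (K-orbit D₀ k (proj₁ parts))

        isomorphism : Iso (SM.homComp p col' a) (cycRel p K)
        isomorphism = coordinate , (λ (u , v) → (ppart (proj₁ u) , ppart (proj₁ v)) , relation u v) ,
          (λ (i , j) → (fiber-point i , fiber-point j) , relation (fiber-point i) (fiber-point j))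

    Conclusion : Set
    Conclusion = SM.Quasitrivial p col'
      ⊎ (∀ a → ∃ λ (K : Fin p → Bool) → IsAutSubgroup p K × ProperK p K × Iso (SM.homComp p col' a) (cycRel p K))

    conclusion : Conclusion
    conclusion = by-search (Eₚ.search (λ d → not ⌊ d ≟F 0ₚ ⌋ ∧ not (W e₀ e₀ d ℕ.≡ᵇ W e₀ e₀ 1ₚ)))
      where
      by-search : (∃ λ d → (not ⌊ d ≟F 0ₚ ⌋ ∧ not (W e₀ e₀ d ℕ.≡ᵇ W e₀ e₀ 1ₚ)) ≡ true) ⊎
                  (∀ d → (not ⌊ d ≟F 0ₚ ⌋ ∧ not (W e₀ e₀ d ℕ.≡ᵇ W e₀ e₀ 1ₚ)) ≡ false) → Conclusion
      by-search (inj₁ (d , h)) = inj₂ λ a → Cyc.K , Cyc.K-subgroup , Cyc.K-proper , Cyc.isomorphism a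
        where
        parts : not ⌊ d ≟F 0ₚ ⌋ ≡ true × not (W e₀ e₀ d ℕ.≡ᵇ W e₀ e₀ 1ₚ) ≡ true
        parts = ∧-true {not ⌊ d ≟F 0ₚ ⌋} h
        module Cyc = Cyclotomic d (λ e → true≢false (⌊≟⌋-true _≟F_ e) (not-true (proj₁ parts)))
          (λ e → true≢false (≡ᵇ-true e) (not-true (proj₂ parts)))
      by-search (inj₂ none) = inj₁ (RankTwo.quasitrivial λ d d≢0 → same d d≢0 (decide (W e₀ e₀ d ℕ.≡ᵇ W e₀ e₀ 1ₚ)))
        where
        same : ∀ d → d ≢ 0ₚ → (W e₀ e₀ d ℕ.≡ᵇ W e₀ e₀ 1ₚ) ≡ true ⊎ (W e₀ e₀ d ℕ.≡ᵇ W e₀ e₀ 1ₚ) ≡ false → W e₀ e₀ d ≡ W e₀ e₀ 1ₚ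
        same d d≢0 (inj₁ h) = ≡ᵇ-≡ h
        same d d≢0 (inj₂ h) = true≢false (true-∧ (cong not (⌊≟⌋-false _≟F_ d≢0)) (cong not h)) (none d)

-- Assembly of the two parts of the theorem

module _ (n : ℕ) (pr : Prime (suc n)) (5≤p : 5 ≤ suc n)
         (col : Coloring (M (suc n))) (cay : IsCayleyM (suc n) col)
         (E : BRel (M (suc n))) (inE : SM.InE (suc n) col E)
         (col' : Coloring (M (suc n))) (cl : SM.IsClosureE (suc n) col E col') where
  open LargeClosure n pr 5≤p col cay E inE col' cl

  large-classes : SM.E1 p p col E → (∀ x → p ≤ SM.count p (E x)) → SM.Quasitrivial p col'
    ⊎ (∀ a → ∃ λ (K : Fin p → Bool) → IsAutSubgroup p K × ProperK p K × Iso (SM.homComp p col' a) (cycRel p K))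
  large-classes e1 large = by-subspace (subspace S₀ (IsSub.has-0 H-sub) λ u v Hu Hv →
      trans (cong (λ w → H (el (u +ᵥ v) w)) (sym (+ₚ-identityˡ 0ₚ))) (IsSub.has-+ H-sub (el u 0ₚ) (el v 0ₚ) Hu Hv))
    where
    min : Minimal H
    min = E1-minimal inE e1
    leaves-V-search : (∃ λ x → (H x ∧ not ⌊ ppart x ≟F 0ₚ ⌋) ≡ true) ⊎ (∀ x → (H x ∧ not ⌊ ppart x ≟F 0ₚ ⌋) ≡ false) →
      ∀ d → H (el Klein.e₀ d) ≡ true
    leaves-V-search (inj₁ (x , h)) = contains-P H-sub {x} (proj₁ (∧-true h))
      λ z → true≢false (⌊≟⌋-true _≟F_ z) (not-true (proj₂ (∧-true {H x} h)))
    -- Inside V the subgroup H would have at most 4 elements, fewer than p.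
    leaves-V-search (inj₂ none) = ⊥-elim (ℕ.1+n≰n (ℕ.≤-trans 5≤p (ℕ.≤-trans (large 0ₘ) (V-bound H λ x Hx → in-layer x Hx (ppart x ≟F 0ₚ)))))
      where
      in-layer : ∀ x → H x ≡ true → Dec (ppart x ≡ 0ₚ) → ppart x ≡ 0ₚ
      in-layer x Hx (yes z) = z
      in-layer x Hx (no nz) = true≢false (true-∧ Hx (cong not (⌊≟⌋-false _≟F_ nz))) (none x)
    HP : ∀ d → H (el Klein.e₀ d) ≡ true
    HP = leaves-V-search (search (λ x → H x ∧ not ⌊ ppart x ≟F 0ₚ ⌋))
    by-subspace : Subspace S₀ → SM.Quasitrivial p col'
      ⊎ (∀ a → ∃ λ (K : Fin p → Bool) → IsAutSubgroup p K × ProperK p K × Iso (SM.homComp p col' a) (cycRel p K))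
    by-subspace (trivial h) = Cosets.conclusion λ x → trans (H-S min HP x) (h (vpart x))
    by-subspace (a-line t t≢0 h) = inj₁ (line-quasitrivial min HP t t≢0 h)
    by-subspace (everything h) = inj₁ (whole-quasitrivial min HP h)

theorem6p5 : (p : ℕ) → Prime p → 5 ≤ p →
    (col : Coloring (M p)) → IsCayleyM p col →
    (E : BRel (M p)) → SM.Principal p p col E →
    (col' : Coloring (M p)) → SM.IsClosureE p col E col' →
    ((∀ x → SM.count p (E x) ≤ 4) → SM.QuotAutEq p col E)
    × ((∀ x → p ≤ SM.count p (E x)) →
    SM.Quasitrivial p col'
    ⊎ (∀ a → ∃ λ (K : Fin p → Bool) →
    IsAutSubgroup p K × ProperK p K
    × Iso (SM.homComp p col' a) (cycRel p K)))
theorem6p5 zero _ ()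
theorem6p5 (suc n) pr 5≤p col cay E (inE , inj₁ e1) col' cl =
  -- Under (E1) the classes of E have at least p ≥ 5 elements, which contradicts the hypothesis of
  -- (1).
  (λ small → ⊥-elim (ℕ.1+n≰n (ℕ.≤-trans 5≤p (ℕ.≤-trans (proj₁ e1 (Group.0ₘ n)) (small (Group.0ₘ n)))))) ,
  large-classes n pr 5≤p col cay E inE col' cl e1
theorem6p5 (suc n) pr 5≤p col cay E (inE , inj₂ (noE1 , small , _)) col' cl =
  LineCase.small-classes n pr 5≤p col cay E inE noE1 ,
  λ large → ⊥-elim (ℕ.1+n≰n (ℕ.≤-trans 5≤p (ℕ.≤-trans (large (Group.0ₘ n)) (small (Group.0ₘ n)))))
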